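{- Let $F$ be a face of a Gorenstein polytope $P$ of index $r$. The following are equivalent: (1) $\operatorname{codeg}F+\operatorname{codeg}F^*=r$; (2) there exists a face $G$ of $P$ such that $P$ is a Cayley join of $F$ and $G$, and $P^\times$ is a Cayley join of $F^*$ and $G^*$. In this case $F,G,F^*,G^*$ are Gorenstein polytopes, and - $\operatorname{codeg}P=\operatorname{codeg}F+\operatorname{codeg}G$, - $\deg P=\deg F+\deg G$, - $\operatorname{CYdim}P=\operatorname{CYdim}F+\operatorname{CYdim}G$.
   Context: Let $M\cong\mathbb{Z}^d$ be a lattice with dual $N$ and pairing $\langle\cdot,\cdot\rangle$. Lattice polytopes are convex hulls of finitely many lattice points; $\emptyset$ has dimension $-1$; faces include $\emptyset$ and the whole polytope. Each face is a lattice polytope with respect to the lattice points of its affine hull. For a lattice polytope $Q$ of dimension $e\ge0$, $h^*_Q$ is given by $1+\sum_{k\ge1}\#(kQ\cap\text{lattice})t^k=h^*_Q(t)/(1-t)^{e+1}$. Set $\deg Q=\deg h^*_Q$ and $\operatorname{codeg}Q=e+1-\deg Q$, which is the least positive integer $k$ with a lattice point in the relative interior of $kQ$. By convention $\deg\emptyset=\operatorname{codeg}\emptyset=0$. The Calabi–Yau dimension is $\operatorname{CYdim}Q=\deg Q-\operatorname{codeg}Q$. Gorenstein polytopes: a $d$-dimensional lattice polytope $P\subset M_\mathbb{R}$ is Gorenstein of index $r$ if $rP$ has a unique interior lattice point $m$ and $rP-m$ is reflexive, meaning $0$ is interior and every facet hyperplane is at integral distance $1$ from $0$. The empty polytope is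 also considered Gorenstein. A lattice polytope is Gorenstein precisely when its $h^*$-polynomial is palindromic. Duality: let $C_P\subset(M\oplus\mathbb{Z})_\mathbb{R}$ be the cone generated by $P\times\{1\}$. The dual Gorenstein polytope is $P^\times=\{y\in C_P^\vee:\langle y,(m,r)\rangle=1\}$, a Gorenstein polytope of index $r$ with respect to $N\oplus\mathbb{Z}$. For a face $F$ of $P$, the corresponding face is $F^*=\{y\in P^\times:\langle y,(x,1)\rangle=0\ \forall x\in F\}$. Cayley join: a full-dimensional lattice polytope $Q$ (with respect to its lattice $L$, with dual $L^\vee$) is a Cayley join of faces $F,G$ if $\dim F+\dim G=\dim Q-1$ and $Q$ is isomorphic as a lattice polytope to the Cayley polytope $\operatorname{conv}(F\times\{1\}\cup G\times\{0\})$ in $(L\oplus\mathbb{Z})_\mathbb{R}$. Equivalently, $Q=\operatorname{conv}(F\cup G)$, $\dim F+\dim G=\dim Q-1$, and some $u\in L^\vee$, $\delta\in\mathbb{Z}$ satisfy $\langle u,\cdot\rangle=\delta$ on $F$ and $\langle u,\cdot\rangle=\delta-1$ on $G$. For $Q=P^\times$ the lattice is $N\oplus\mathbb{Z}$ restricted to the affine hull of $P^\times$. -}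

module Defs where

open import Data.Nat as ℕ using (ℕ; zero; suc)
open import Data.Integer as ℤ using (ℤ; +_; -[1+_])
open import Data.Rational as ℚ using (ℚ; 0ℚ; 1ℚ)
open import Data.Rational.Properties as ℚP using ()
open import Data.Fin using (Fin; zero; suc)
open import Data.List using (List; []; _∷_; length; lookup; filter; map; _++_)
open import Data.List.Relation.Unary.All using (All; all?)
open import Data.List.Membership.Propositional using (_∈_)
open import Data.Product using (Σ; ∃; _×_; _,_)
open import Data.Sum using (_⊎_)
open import Data.Unit using (⊤)
open import Relation.Nullary using (¬_)
open import Relation.Binary.PropositionalEquality using (_≡_)
open import Function.Bundles using (_⇔_)

Pt : ℕ → Set
Pt n = Fin n → ℤ

QPt : ℕ → Set
QPt n = Fin n → ℚ

toℚ : ℤ → ℚ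
toℚ z = z ℚ./ 1

toQPt : ∀ {n} → Pt n → QPt n
toQPt x i = toℚ (x i)

sumℚ : ∀ {n} → (Fin n → ℚ) → ℚ
sumℚ {zero} f = 0ℚ
sumℚ {suc n} f = f zero ℚ.+ sumℚ (λ i → f (suc i))

sumℤ : ∀ {n} → (Fin n → ℤ) → ℤ
sumℤ {zero} f = + 0
sumℤ {suc n} f = f zero ℤ.+ sumℤ (λ i → f (suc i))

_·_ : ∀ {n} → QPt n → Pt n → ℚ
u · v = sumℚ (λ i → u i ℚ.* toℚ (v i))

_·ᶻ_ : ∀ {n} → Pt n → Pt n → ℤ
u ·ᶻ v = sumℤ (λ i → u i ℤ.* v i)

ext : ∀ {n} → Pt n → ℤ → Pt (suc n)
ext v a zero = a
ext v a (suc i) = v i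

-- Lattice polytopes, given by a finite list of lattice points (generators)

InConv : ∀ {n} → List (Pt n) → QPt n → Set
InConv {n} gens x =
  Σ (Fin (length gens) → ℚ) λ λs →
    (∀ j → 0ℚ ℚ.≤ λs j) ×
    (sumℚ λs ≡ 1ℚ) ×
    (∀ i → sumℚ (λ j → λs j ℚ.* toℚ (lookup gens j i)) ≡ x i)

Valid : ∀ {n} → List (Pt n) → QPt n → ℚ → Set
Valid gens u c = All (λ v → c ℚ.≤ u · v) gens

-- the face conv(gens) ∩ {⟨u,·⟩ = c}, as the lattice polytope spanned by
-- the generators lying on it (u = 0 gives the polytope itself / ∅)
face : ∀ {n} → List (Pt n) → QPt n → ℚ → List (Pt n)
face gens u c = filter (λ v → u · v ℚP.≟ c) gens

RelInt : ∀ {n} → List (Pt n) → QPt n → Set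
RelInt gens x =
  InConv gens x ×
  (∀ u c → Valid gens u c →
     sumℚ (λ i → u i ℚ.* x i) ≡ c → All (λ v → u · v ≡ c) gens)

scale : ∀ {n} → ℕ → List (Pt n) → List (Pt n)
scale k gens = map (λ v i → + k ℤ.* v i) gens

translate : ∀ {n} → List (Pt n) → Pt n → List (Pt n)
translate gens m = map (λ v i → v i ℤ.- m i) gens

LinIndep : ∀ {n} → List (Pt n) → Set
LinIndep {n} vs =
  (c : Fin (length vs) → ℚ) →
  (∀ i → sumℚ (λ j → c j ℚ.* toℚ (lookup vs j i)) ≡ 0ℚ) →
  ∀ j → c j ≡ 0ℚ

AffIndep : ∀ {n} → List (Pt n) → Set
AffIndep [] = ⊤
AffIndep (w ∷ ws) = LinIndep (map (λ v i → v i ℤ.- w i) ws)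

-- AffRank gens k  :⇔  dim conv(gens) = k - 1   (k = 0 ⇔ empty)
AffRank : ∀ {n} → List (Pt n) → ℕ → Set
AffRank gens k =
  (Σ (List _) λ ws → All (_∈ gens) ws × length ws ≡ k × AffIndep ws) ×
  (∀ ws → All (_∈ gens) ws → AffIndep ws → length ws ℕ.≤ k)

HasIntPt : ∀ {n} → List (Pt n) → ℕ → Set
HasIntPt {n} gens k = Σ (Pt n) λ x → RelInt (scale k gens) (toQPt x)

IsCodeg : ∀ {n} → List (Pt n) → ℕ → Set
IsCodeg gens c =
  (gens ≡ [] × c ≡ 0) ⊎
  (1 ℕ.≤ c × HasIntPt gens c × (∀ j → 1 ℕ.≤ j → j ℕ.< c → ¬ HasIntPt gens j))

-- deg Q = dim Q + 1 - codeg Q ;  deg ∅ = 0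
IsDeg : ∀ {n} → List (Pt n) → ℕ → Set
IsDeg gens δ = Σ ℕ λ k → Σ ℕ λ c → AffRank gens k × IsCodeg gens c × δ ≡ k ℕ.∸ c

IsCYdim : ∀ {n} → List (Pt n) → ℤ → Set
IsCYdim gens z = Σ ℕ λ δ → Σ ℕ λ c → IsDeg gens δ × IsCodeg gens c × z ≡ + δ ℤ.- + c

-- Reflexive and Gorenstein polytopes (w.r.t. the lattice of the affine hull)

IsFacet : ∀ {n} → List (Pt n) → QPt n → ℚ → Set
IsFacet gens u c = Valid gens u c × Σ ℕ λ k → AffRank gens (suc k) × AffRank (face gens u c) k

-- 0 is in the relative interior and every facet lies at lattice distance 1
-- from 0 (integral functional equal to -1 on the facet, ≥ -1 on Q)
Reflexive : ∀ {n} → List (Pt n) → Set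
Reflexive {n} gens =
  RelInt gens (λ _ → 0ℚ) ×
  (∀ u c → IsFacet gens u c →
     Σ (Pt n) λ w → All (λ v → -[1+ 0 ] ℤ.≤ w ·ᶻ v) gens ×
                    All (λ v → w ·ᶻ v ≡ -[1+ 0 ]) (face gens u c))

GorensteinIdx : ∀ {n} → List (Pt n) → ℕ → Pt n → Set
GorensteinIdx {n} gens r m =
  1 ℕ.≤ r ×
  RelInt (scale r gens) (toQPt m) ×
  (∀ (x : Pt n) → RelInt (scale r gens) (toQPt x) → ∀ i → x i ≡ m i) ×
  Reflexive (translate (scale r gens) m)

Gorenstein : ∀ {n} → List (Pt n) → Set
Gorenstein {n} gens = gens ≡ [] ⊎ Σ ℕ λ r → Σ (Pt n) λ m → GorensteinIdx gens r m

-- y ∈ P^× = { y ∈ C_P^∨ : ⟨y,(m,r)⟩ = 1 }  ⊂ (N ⊕ ℤ)_ℚ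
InDual : ∀ {d} → List (Pt d) → ℕ → Pt d → QPt (suc d) → Set
InDual P r m y =
  All (λ v → 0ℚ ℚ.≤ y · ext v (+ 1)) P × (y · ext m (+ r) ≡ 1ℚ)

-- F^* = { y ∈ P^× : ⟨y,(x,1)⟩ = 0 ∀ x ∈ F }, as the lattice polytope spanned
-- by the generators Pd of P^× lying on it
dualFace : ∀ {d} → List (Pt (suc d)) → List (Pt d) → List (Pt (suc d))
dualFace Pd F = filter (λ y → all? (λ v → y ·ᶻ ext v (+ 1) ℤ.≟ + 0) F) Pd

-- Q is a Cayley join of its faces F and G:
-- dim F + dim G = dim Q - 1, Q = conv(F ∪ G), and some integral u, δ with
-- ⟨u,·⟩ = δ on F and = δ - 1 on G
CayleyJoin : ∀ {n} → List (Pt n) → List (Pt n) → List (Pt n) → Set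
CayleyJoin {n} Q F G =
  (Σ ℕ λ kQ → Σ ℕ λ kF → Σ ℕ λ kG →
     AffRank Q kQ × AffRank F kF × AffRank G kG × kF ℕ.+ kG ≡ kQ) ×
  (∀ x → InConv Q x ⇔ InConv (F ++ G) x) ×
  (Σ (Pt n) λ u → Σ ℤ λ δ →
     All (λ v → u ·ᶻ v ≡ δ) F × All (λ v → u ·ᶻ v ≡ δ ℤ.- + 1) G)

Cond2 : ∀ {d} → List (Pt d) → List (Pt (suc d)) → List (Pt d) → Set
Cond2 {d} P Pd F =
  Σ (QPt d) λ u' → Σ ℚ λ c' → Valid P u' c' ×
    CayleyJoin P F (face P u' c') ×
    CayleyJoin Pd (dualFace Pd F) (dualFace Pd (face P u' c'))

Consequences : ∀ {d} → List (Pt d) → List (Pt (suc d)) → List (Pt d) → List (Pt d) → Set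
Consequences P Pd F G =
  Gorenstein F × Gorenstein G × Gorenstein (dualFace Pd F) × Gorenstein (dualFace Pd G) ×
  (∀ cP cF cG → IsCodeg P cP → IsCodeg F cF → IsCodeg G cG → cP ≡ cF ℕ.+ cG) ×
  (∀ dP dF dG → IsDeg P dP → IsDeg F dF → IsDeg G dG → dP ≡ dF ℕ.+ dG) ×
  (∀ yP yF yG → IsCYdim P yP → IsCYdim F yF → IsCYdim G yG → yP ≡ yF ℤ.+ yG)

{-# OPTIONS --safe #-}

-- Write M = (m, r), E for the height functional (0, 1), C_F for the cone over F × {1}, and let X ∈ C_F, Y ∈ C_{F*}
-- be interior lattice points of height codeg F, codeg F*. Since E is interior to the dual cone, E = Σ κᵥ v with all
-- κᵥ > 0, v running over the generators of P^×. Let y = Σ_{v ∈ F*} κᵥ v. As ⟨v,X⟩ ≥ 1 off F* and ⟨Y,p⟩ ≥ 1 off F,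
-- codeg F = ⟨E,X⟩ ≥ Σ_{v ∉ F*} κᵥ and Y - y lies in the dual cone, so codeg F* = ⟨Y,M⟩ ≥ ⟨y,M⟩ = r - Σ_{v ∉ F*} κᵥ.
-- Hence codeg F + codeg F* ≥ r, and equality forces ⟨v,X⟩ = 1 off F*, Y = y, and ⟨v,p⟩ = 0 for v ∉ F*, p ∉ F.
-- Then G = {Y = 1} is the face sought, and Y, X are the functionals of the two Cayley joins.
--
-- Conversely the functionals of two Cayley joins are integers in [0,1] at the generators, so every generator of P lies
-- in F or G and every generator of P^× in F* or G*. This splits M = X + (M - X) and E = Y + (E - Y) into lattice points
-- that turn out to be the least interior ones of C_F, C_G and of C_{F*}, C_{G*}.
module Submission where

open import Defs
open import Data.Nat as ℕ using (ℕ; zero; suc)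
import Data.Nat.Properties as ℕP
open import Data.Integer as ℤ using (ℤ; -[1+_]) renaming (+_ to pos)
import Data.Integer.Properties as ℤP
import Data.Integer.Solver
open import Data.Rational
  using (ℚ; 0ℚ; 1ℚ; _+_; _*_; _-_; -_; _≤_; _<_; _⊔_; _⊓_; 1/_; ≢-nonZero; positive; nonNegative; toℚᵘ)
open import Data.Rational.Properties as ℚP
  using (≤-refl; ≤-trans; ≤-antisym; ≤-reflexive; <⇒≤; toℚᵘ-injective; toℚᵘ-cancel-≤; toℚᵘ-mono-≤; toℚᵘ-fromℚᵘ; toℚᵘ-homo-+; toℚᵘ-homo-*)
open import Data.Rational.Unnormalised as ℚᵘ using (mkℚᵘ; *≡*; *≤*)
import Data.Rational.Unnormalised.Properties as ℚᵘP
open import Data.Rational.Solver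
open +-*-Solver
open import Data.Fin using (Fin; zero; suc)
open import Data.Fin.Properties as FinP using (¬∀⟶∃¬)
open import Data.List using (List; []; _∷_; length; lookup; map; _++_)
open import Data.List.Properties using (length-++)
open import Data.List.Relation.Unary.All as All using (All; []; _∷_; all?)
import Data.List.Relation.Unary.All.Properties as AllP
open import Data.List.Relation.Unary.Any using (here; there; index)
open import Data.List.Relation.Unary.Any.Properties using (lookup-index)
open import Data.List.Membership.Propositional using (_∈_; find)
open import Data.List.Membership.Propositional.Properties
  using (∈-filter⁺; ∈-filter⁻; ∈-++⁺ˡ; ∈-++⁺ʳ; ∈-++⁻; ∈-map⁺; ∈-map⁻; ∈-lookup)
open import Data.Product using (Σ; _×_; _,_; proj₁; proj₂)
open import Data.Sum using (_⊎_; inj₁; inj₂)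
open import Data.Empty using (⊥; ⊥-elim)
open import Relation.Nullary using (¬_; Dec; yes; no)
open import Relation.Binary using (tri<; tri≈; tri>)
open import Relation.Binary.PropositionalEquality
  using (_≡_; _≢_; refl; sym; trans; cong; cong₂; subst; subst₂; module ≡-Reasoning)
open import Function.Base using (_∘_; case_of_)
open import Function.Bundles using (_⇔_; Equivalence; mk⇔)

-- Duality enters in one direction only: a functional nonnegative on `P`, divided by its value at
-- `M`, is a point of `P^×` and hence a nonnegative combination of `Pd`. The way back from `Pd` to
-- points of the cone over `P` exhibits the point, usually as part of a decomposition of `M`, and
-- identifies it by the fact that only 0 vanishes on all of `Pd`. This is why `F` and `F*` receive
-- different arguments although the statement is symmetric in `P` and `P^×`, while the exchange of
-- `F` and `G` is a true symmetry of the proof. Codegree and Gorenstein property follow from one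
-- criterion. If a family of nonnegative integral functionals is 1 at an interior lattice point,
-- then every other interior lattice point has values at least 1, which is meant to make the first
-- point the least. The linear parts of the same functionals are the facet normals that reflexivity
-- asks for. Points of cones are carried as finitely supported measures on generators, so that they
-- can be cut along a cover of the generators or freed of weightless atoms.

private module ℤS = Data.Integer.Solver.+-*-Solver

private variable
  n : ℕ
  A B : Set

-- Ordered-field arithmetic on ℚ and the embedding of ℤ

-- Reduces an inequality to the sign of `e` and a ring identity, which the solver can decide.
≤-by : ∀ {p q e} → 0ℚ ≤ e → q - p ≡ e → p ≤ q
≤-by {p} {q} {e} 0≤e eq = subst₂ _≤_ (ℚP.+-identityʳ p) lem (ℚP.+-monoʳ-≤ p 0≤e)
  where
  lem : p + e ≡ q
  lem = trans (cong (p +_) (sym eq)) (solve 2 (λ p q → p :+ (q :- p) := q) refl p q)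

0≤-diff : ∀ {p q} → p ≤ q → 0ℚ ≤ q - p
0≤-diff {p} {q} p≤q = subst (_≤ q - p) (ℚP.+-inverseʳ p) (ℚP.+-monoˡ-≤ (- p) p≤q)

0≤+ : ∀ {p q} → 0ℚ ≤ p → 0ℚ ≤ q → 0ℚ ≤ p + q
0≤+ = ℚP.+-mono-≤

0≤* : ∀ {p q} → 0ℚ ≤ p → 0ℚ ≤ q → 0ℚ ≤ p * q
0≤* {p} {q} 0≤p 0≤q =
  ℚP.nonNegative⁻¹ (p * q) {{ℚP.nonNeg*nonNeg⇒nonNeg p {{nonNegative 0≤p}} q {{nonNegative 0≤q}}}}

0≤1 : 0ℚ ≤ 1ℚ
0≤1 = ℚP.nonNegative⁻¹ 1ℚ

0<1 : 0ℚ < 1ℚ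
0<1 = ℚP.positive⁻¹ 1ℚ

<⇒≢0 : ∀ {p} → 0ℚ < p → p ≢ 0ℚ
<⇒≢0 0<p p≡0 = ℚP.<-irrefl (sym p≡0) 0<p

≤∧≢⇒0< : ∀ {p} → 0ℚ ≤ p → p ≢ 0ℚ → 0ℚ < p
≤∧≢⇒0< {p} 0≤p p≢0 with ℚP.<-cmp 0ℚ p
... | tri< a _ _ = a
... | tri≈ _ b _ = ⊥-elim (p≢0 (sym b))
... | tri> _ _ c = ⊥-elim (p≢0 (≤-antisym (<⇒≤ c) 0≤p))

+≡0⇒≡0 : ∀ {p q} → 0ℚ ≤ p → 0ℚ ≤ q → p + q ≡ 0ℚ → p ≡ 0ℚ × q ≡ 0ℚ
+≡0⇒≡0 {p} {q} 0≤p 0≤q eq =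
  ≤-antisym (≤-by 0≤q (trans (cong (_- p) (sym eq)) (solve 2 (λ p q → (p :+ q) :- p := q) refl p q))) 0≤p ,
  ≤-antisym (≤-by 0≤p (trans (cong (_- q) (sym eq)) (solve 2 (λ p q → (p :+ q) :- q := p) refl p q))) 0≤q

inverse : ∀ p → p ≢ 0ℚ → Σ ℚ λ q → q * p ≡ 1ℚ
inverse p p≢0 = 1/_ p {{≢-nonZero p≢0}} , ℚP.*-inverseˡ p {{≢-nonZero p≢0}}

inverse⁺ : ∀ p → 0ℚ < p → Σ ℚ λ q → 0ℚ < q × q * p ≡ 1ℚ
inverse⁺ p 0<p = q , ≤∧≢⇒0< 0≤q q≢0 , qp
  where
  q = proj₁ (inverse p (<⇒≢0 0<p))
  qp = proj₂ (inverse p (<⇒≢0 0<p))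
  q≢0 : q ≢ 0ℚ
  q≢0 q≡0 = <⇒≢0 0<1 (trans (sym qp) (trans (cong (_* p) q≡0) (ℚP.*-zeroˡ p)))
  0≤q : 0ℚ ≤ q
  0≤q = ℚP.nonNegative⁻¹ q {{ℚP.pos⇒nonNeg q {{ℚP.1/pos⇒pos p {{positive 0<p}}}}}}

*≡0⇒≡0 : ∀ {p q} → p ≢ 0ℚ → p * q ≡ 0ℚ → q ≡ 0ℚ
*≡0⇒≡0 {p} {q} p≢0 eq with inverse p p≢0
... | i , ip = begin
  q            ≡⟨ sym (ℚP.*-identityˡ q) ⟩
  1ℚ * q       ≡⟨ cong (_* q) (sym ip) ⟩
  (i * p) * q  ≡⟨ ℚP.*-assoc i p q ⟩
  i * (p * q)  ≡⟨ cong (i *_) eq ⟩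
  i * 0ℚ       ≡⟨ ℚP.*-zeroʳ i ⟩
  0ℚ ∎
  where open ≡-Reasoning

square-nonneg : ∀ p → 0ℚ ≤ p * p
square-nonneg p with ℚP.≤-total 0ℚ p
... | inj₁ 0≤p = 0≤* 0≤p 0≤p
... | inj₂ p≤0 = subst (0ℚ ≤_) (solve 1 (λ p → (con 0ℚ :- p) :* (con 0ℚ :- p) := p :* p) refl p)
                   (0≤* (0≤-diff p≤0) (0≤-diff p≤0))

square≡0 : ∀ {p} → p * p ≡ 0ℚ → p ≡ 0ℚ
square≡0 {p} eq with p ℚP.≟ 0ℚ
... | yes p≡0 = p≡0
... | no p≢0 = *≡0⇒≡0 p≢0 eq

toℚᵘ-toℚ : ∀ z → toℚᵘ (toℚ z) ℚᵘ.≃ mkℚᵘ z 0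
toℚᵘ-toℚ z = toℚᵘ-fromℚᵘ (mkℚᵘ z 0)

toℚ-+ : ∀ a b → toℚ (a ℤ.+ b) ≡ toℚ a + toℚ b
toℚ-+ a b = toℚᵘ-injective
  (ℚᵘP.≃-trans (toℚᵘ-toℚ (a ℤ.+ b))
  (ℚᵘP.≃-trans (*≡* (cong (ℤ._* pos 1) (cong₂ ℤ._+_ (sym (ℤP.*-identityʳ a)) (sym (ℤP.*-identityʳ b)))))
  (ℚᵘP.≃-trans (ℚᵘP.+-cong (ℚᵘP.≃-sym (toℚᵘ-toℚ a)) (ℚᵘP.≃-sym (toℚᵘ-toℚ b)))
               (ℚᵘP.≃-sym (toℚᵘ-homo-+ (toℚ a) (toℚ b))))))

toℚ-* : ∀ a b → toℚ (a ℤ.* b) ≡ toℚ a * toℚ b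
toℚ-* a b = toℚᵘ-injective
  (ℚᵘP.≃-trans (toℚᵘ-toℚ (a ℤ.* b))
  (ℚᵘP.≃-trans (*≡* refl)
  (ℚᵘP.≃-trans (ℚᵘP.*-cong (ℚᵘP.≃-sym (toℚᵘ-toℚ a)) (ℚᵘP.≃-sym (toℚᵘ-toℚ b)))
               (ℚᵘP.≃-sym (toℚᵘ-homo-* (toℚ a) (toℚ b))))))

toℚ-injective : ∀ {a b} → toℚ a ≡ toℚ b → a ≡ b
toℚ-injective {a} {b} eq
  with ℚᵘP.≃-trans (ℚᵘP.≃-sym (toℚᵘ-toℚ a)) (ℚᵘP.≃-trans (ℚᵘP.≃-reflexive (cong toℚᵘ eq)) (toℚᵘ-toℚ b))
... | *≡* e = trans (sym (ℤP.*-identityʳ a)) (trans e (ℤP.*-identityʳ b))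

toℚ-mono : ∀ {a b} → a ℤ.≤ b → toℚ a ≤ toℚ b
toℚ-mono {a} {b} a≤b = toℚᵘ-cancel-≤
  (ℚᵘP.≤-respˡ-≃ (ℚᵘP.≃-sym (toℚᵘ-toℚ a)) (ℚᵘP.≤-respʳ-≃ (ℚᵘP.≃-sym (toℚᵘ-toℚ b))
    (*≤* (subst₂ ℤ._≤_ (sym (ℤP.*-identityʳ a)) (sym (ℤP.*-identityʳ b)) a≤b))))

toℚ-cancel : ∀ {a b} → toℚ a ≤ toℚ b → a ℤ.≤ b
toℚ-cancel {a} {b} le
  with ℚᵘP.≤-respˡ-≃ (toℚᵘ-toℚ a) (ℚᵘP.≤-respʳ-≃ (toℚᵘ-toℚ b) (toℚᵘ-mono-≤ le))
... | *≤* e = subst₂ ℤ._≤_ (ℤP.*-identityʳ a) (ℤP.*-identityʳ b) e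

toℚ-neg : ∀ a → toℚ (ℤ.- a) ≡ - toℚ a
toℚ-neg a = begin
  toℚ (ℤ.- a)                        ≡⟨ solve 2 (λ x y → x := (x :+ y) :- y) refl (toℚ (ℤ.- a)) (toℚ a) ⟩
  toℚ (ℤ.- a) + toℚ a - toℚ a        ≡⟨ cong (_- toℚ a) (sym (toℚ-+ (ℤ.- a) a)) ⟩
  toℚ (ℤ.- a ℤ.+ a) - toℚ a          ≡⟨ cong (λ z → toℚ z - toℚ a) (ℤP.+-inverseˡ a) ⟩
  0ℚ - toℚ a                         ≡⟨ ℚP.+-identityˡ _ ⟩
  - toℚ a ∎
  where open ≡-Reasoning

toℚ-sub : ∀ a b → toℚ (a ℤ.- b) ≡ toℚ a - toℚ b
toℚ-sub a b = trans (toℚ-+ a (ℤ.- b)) (cong (toℚ a +_) (toℚ-neg b))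

-- Integrality turns positivity into a gap here; the lower bounds by 1 in the codegree arguments
-- rest on it.
1≤toℚ : ∀ z → 0ℚ ≤ toℚ z → toℚ z ≢ 0ℚ → 1ℚ ≤ toℚ z
1≤toℚ z 0≤z z≢0 = toℚ-mono {pos 1} {z} (ℤP.i<j⇒suc[i]≤j (ℤP.≤∧≢⇒< (toℚ-cancel {pos 0} {z} 0≤z) λ e → z≢0 (cong toℚ (sym e))))

-- Finite sums

sum-cong : {f g : Fin n → ℚ} → (∀ i → f i ≡ g i) → sumℚ f ≡ sumℚ g
sum-cong {zero} f≗g = refl
sum-cong {suc n} f≗g = cong₂ _+_ (f≗g zero) (sum-cong (λ i → f≗g (suc i)))

sum-0 : ∀ n → sumℚ {n} (λ _ → 0ℚ) ≡ 0ℚ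
sum-0 zero = refl
sum-0 (suc n) = trans (ℚP.+-identityˡ _) (sum-0 n)

sum-≡0 : {f : Fin n → ℚ} → (∀ i → f i ≡ 0ℚ) → sumℚ f ≡ 0ℚ
sum-≡0 {n} f≡0 = trans (sum-cong f≡0) (sum-0 n)

sum-lin : ∀ a b (f g : Fin n → ℚ) → sumℚ (λ i → a * f i + b * g i) ≡ a * sumℚ f + b * sumℚ g
sum-lin {zero} a b f g = solve 2 (λ a b → con 0ℚ := a :* con 0ℚ :+ b :* con 0ℚ) refl a b
sum-lin {suc n} a b f g =
  trans (cong ((a * f zero + b * g zero) +_) (sum-lin a b (f ∘ suc) (g ∘ suc)))
        (solve 6 (λ a b x y s t → (a :* x :+ b :* y) :+ (a :* s :+ b :* t) := a :* (x :+ s) :+ b :* (y :+ t))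
               refl a b (f zero) (g zero) (sumℚ (f ∘ suc)) (sumℚ (g ∘ suc)))

sum-* : ∀ a (f : Fin n → ℚ) → sumℚ (λ i → a * f i) ≡ a * sumℚ f
sum-* {zero} a f = sym (ℚP.*-zeroʳ a)
sum-* {suc n} a f = trans (cong (a * f zero +_) (sum-* a (f ∘ suc))) (sym (ℚP.*-distribˡ-+ a _ _))

sum-+ : (f g : Fin n → ℚ) → sumℚ (λ i → f i + g i) ≡ sumℚ f + sumℚ g
sum-+ f g = trans (sum-cong (λ i → sym (cong₂ _+_ (ℚP.*-identityˡ (f i)) (ℚP.*-identityˡ (g i)))))
              (trans (sum-lin 1ℚ 1ℚ f g) (cong₂ _+_ (ℚP.*-identityˡ (sumℚ f)) (ℚP.*-identityˡ (sumℚ g))))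

sum-swap : ∀ {m n} (f : Fin m → Fin n → ℚ) →
  sumℚ (λ i → sumℚ (f i)) ≡ sumℚ (λ j → sumℚ (λ i → f i j))
sum-swap {zero} {n} f = sym (sum-0 n)
sum-swap {suc m} f = trans (cong (sumℚ (f zero) +_) (sum-swap (f ∘ suc)))
  (sym (sum-+ (f zero) (λ j → sumℚ (λ i → f (suc i) j))))

sum-nonneg : {f : Fin n → ℚ} → (∀ i → 0ℚ ≤ f i) → 0ℚ ≤ sumℚ f
sum-nonneg {zero} 0≤f = ≤-refl
sum-nonneg {suc n} 0≤f = 0≤+ (0≤f zero) (sum-nonneg (0≤f ∘ suc))

sum-nonneg≡0 : {f : Fin n → ℚ} → (∀ i → 0ℚ ≤ f i) → sumℚ f ≡ 0ℚ → ∀ i → f i ≡ 0ℚ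
sum-nonneg≡0 {suc n} 0≤f eq zero = proj₁ (+≡0⇒≡0 (0≤f zero) (sum-nonneg (0≤f ∘ suc)) eq)
sum-nonneg≡0 {suc n} 0≤f eq (suc i) =
  sum-nonneg≡0 (0≤f ∘ suc) (proj₂ (+≡0⇒≡0 (0≤f zero) (sum-nonneg (0≤f ∘ suc)) eq)) i

sum-single : (i₀ : Fin n) (f : Fin n → ℚ) → (∀ i → i ≢ i₀ → f i ≡ 0ℚ) → sumℚ f ≡ f i₀
sum-single zero f off = trans (cong (f zero +_) (sum-≡0 (λ i → off (suc i) (λ ())))) (ℚP.+-identityʳ _)
sum-single (suc i₀) f off =
  trans (cong₂ _+_ (off zero (λ ())) (sum-single i₀ (f ∘ suc) (λ i ne → off (suc i) (λ { refl → ne refl }))))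
        (ℚP.+-identityˡ _)

toℚ-sum : (f : Fin n → ℤ) → toℚ (sumℤ f) ≡ sumℚ (toℚ ∘ f)
toℚ-sum {zero} f = refl
toℚ-sum {suc n} f = trans (toℚ-+ (f zero) _) (cong (toℚ (f zero) +_) (toℚ-sum (f ∘ suc)))

-- Rational vectors

infix 8 _∙_
_∙_ : QPt n → QPt n → ℚ
u ∙ x = sumℚ (λ i → u i * x i)

lin : ℚ → QPt n → ℚ → QPt n → QPt n
lin a x b y i = a * x i + b * y i

∙-cong : {u u' x x' : QPt n} → (∀ i → u i ≡ u' i) → (∀ i → x i ≡ x' i) → u ∙ x ≡ u' ∙ x'
∙-cong p q = sum-cong (λ i → cong₂ _*_ (p i) (q i))

∙-congʳ : (u : QPt n) {x x' : QPt n} → (∀ i → x i ≡ x' i) → u ∙ x ≡ u ∙ x'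
∙-congʳ u = ∙-cong {u = u} (λ _ → refl)

∙-congˡ : {u u' : QPt n} (x : QPt n) → (∀ i → u i ≡ u' i) → u ∙ x ≡ u' ∙ x
∙-congˡ x p = ∙-cong {x = x} p (λ _ → refl)

∙-comm : (u x : QPt n) → u ∙ x ≡ x ∙ u
∙-comm u x = sum-cong (λ i → ℚP.*-comm (u i) (x i))

∙-linʳ : ∀ (u : QPt n) a x b y → u ∙ lin a x b y ≡ a * (u ∙ x) + b * (u ∙ y)
∙-linʳ u a x b y = trans
  (sum-cong (λ i → solve 5 (λ u a x b y → u :* (a :* x :+ b :* y) := a :* (u :* x) :+ b :* (u :* y))
                     refl (u i) a (x i) b (y i)))
  (sum-lin a b (λ i → u i * x i) (λ i → u i * y i))

∙-linˡ : ∀ a (u : QPt n) b v x → lin a u b v ∙ x ≡ a * (u ∙ x) + b * (v ∙ x)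
∙-linˡ a u b v x = trans (∙-comm (lin a u b v) x)
  (trans (∙-linʳ x a u b v) (cong₂ (λ s t → a * s + b * t) (∙-comm x u) (∙-comm x v)))

infixl 6 _⊖_
_⊖_ : QPt n → QPt n → QPt n
(x ⊖ y) i = x i - y i

∙-⊖ʳ : (u x y : QPt n) → u ∙ (x ⊖ y) ≡ u ∙ x - u ∙ y
∙-⊖ʳ u x y = trans
  (∙-congʳ u (λ i → solve 2 (λ x y → x :- y := con 1ℚ :* x :+ con (- 1ℚ) :* y) refl (x i) (y i)))
  (trans (∙-linʳ u 1ℚ x (- 1ℚ) y)
    (solve 2 (λ x y → con 1ℚ :* x :+ con (- 1ℚ) :* y := x :- y) refl (u ∙ x) (u ∙ y)))

∙-⊖ˡ : (u v x : QPt n) → (u ⊖ v) ∙ x ≡ u ∙ x - v ∙ x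
∙-⊖ˡ u v x = trans (∙-comm (u ⊖ v) x)
  (trans (∙-⊖ʳ x u v) (cong₂ _-_ (∙-comm x u) (∙-comm x v)))

∙-≡0ʳ : (u : QPt n) {x : QPt n} → (∀ i → x i ≡ 0ℚ) → u ∙ x ≡ 0ℚ
∙-≡0ʳ u x≡0 = sum-≡0 (λ i → trans (cong (u i *_) (x≡0 i)) (ℚP.*-zeroʳ (u i)))

self∙≡0 : {x : QPt n} → x ∙ x ≡ 0ℚ → ∀ i → x i ≡ 0ℚ
self∙≡0 {x = x} eq i = square≡0 (sum-nonneg≡0 (λ i → square-nonneg (x i)) eq i)

qext : ℚ → QPt n → QPt (suc n)
qext a u zero = a
qext a u (suc i) = u i

basis : Fin n → QPt n
basis zero zero = 1ℚ
basis zero (suc j) = 0ℚ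
basis (suc i) zero = 0ℚ
basis (suc i) (suc j) = basis i j

basis-∙ : (i : Fin n) (x : QPt n) → basis i ∙ x ≡ x i
basis-∙ {suc n} zero x = trans (cong₂ _+_ (ℚP.*-identityˡ (x zero)) (sum-≡0 (λ i → ℚP.*-zeroˡ (x (suc i)))))
  (ℚP.+-identityʳ _)
basis-∙ {suc n} (suc i) x = trans (cong₂ _+_ (ℚP.*-zeroˡ (x zero)) (basis-∙ i (x ∘ suc))) (ℚP.+-identityˡ _)

toℚ-∙ : (x y : Pt n) → toℚ (x ·ᶻ y) ≡ toQPt x ∙ toQPt y
toℚ-∙ x y = trans (toℚ-sum (λ i → x i ℤ.* y i)) (sum-cong (λ i → toℚ-* (x i) (y i)))

hat : Pt n → QPt (suc n)
hat v = toQPt (ext v (pos 1))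

height : QPt (suc n)
height = basis zero

height-hat : (v : Pt n) → height ∙ hat v ≡ 1ℚ
height-hat v = basis-∙ zero (hat v)

∙-hat : (u : QPt (suc n)) (v : Pt n) → u ∙ hat v ≡ u zero + (u ∘ suc) · v
∙-hat u v = cong (_+ ((u ∘ suc) · v)) (ℚP.*-identityʳ (u zero))

-- Finitely supported measures

-- Lists rather than coefficient functions on the generators, so that adding, cutting and dropping
-- atoms are list operations. Two measures are compared by their integrals of all functions, which
-- forgets order and repetition.
Meas : Set → Set
Meas A = List (ℚ × A)

∫ : (A → ℚ) → Meas A → ℚ
∫ f [] = 0ℚ
∫ f ((w , a) ∷ W) = w * f a + ∫ f W

_on_ : Meas A → (A → Set) → Set
W on S = All (λ p → S (proj₂ p)) W

_on⁺_ : Meas A → (A → Set) → Set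
W on⁺ S = All (λ p → 0ℚ ≤ proj₁ p × S (proj₂ p)) W

on⁺⇒on : {S : A → Set} {W : Meas A} → W on⁺ S → W on S
on⁺⇒on = All.map proj₂

∫-cong-on : {S : A → Set} {f g : A → ℚ} {W : Meas A} → W on S → (∀ a → S a → f a ≡ g a) → ∫ f W ≡ ∫ g W
∫-cong-on [] e = refl
∫-cong-on {W = (w , a) ∷ W} (s ∷ ss) e = cong₂ _+_ (cong (w *_) (e a s)) (∫-cong-on ss e)

∫-cong : {f g : A → ℚ} (W : Meas A) → (∀ a → f a ≡ g a) → ∫ f W ≡ ∫ g W
∫-cong [] e = refl
∫-cong ((w , a) ∷ W) e = cong₂ _+_ (cong (w *_) (e a)) (∫-cong W e)

∫-lin : ∀ a b (f g : A → ℚ) W → ∫ (λ x → a * f x + b * g x) W ≡ a * ∫ f W + b * ∫ g W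
∫-lin a b f g [] = solve 2 (λ a b → con 0ℚ := a :* con 0ℚ :+ b :* con 0ℚ) refl a b
∫-lin a b f g ((w , x) ∷ W) = trans (cong (w * (a * f x + b * g x) +_) (∫-lin a b f g W))
  (solve 7 (λ w a b x y s t → w :* (a :* x :+ b :* y) :+ (a :* s :+ b :* t) := a :* (w :* x :+ s) :+ b :* (w :* y :+ t))
    refl w a b (f x) (g x) (∫ f W) (∫ g W))

∫-sub : ∀ (f g : A → ℚ) W → ∫ (λ x → f x - g x) W ≡ ∫ f W - ∫ g W
∫-sub f g W = trans (∫-cong W (λ x → solve 2 (λ x y → x :- y := con 1ℚ :* x :+ con (- 1ℚ) :* y) refl (f x) (g x)))
  (trans (∫-lin 1ℚ (- 1ℚ) f g W) (solve 2 (λ x y → con 1ℚ :* x :+ con (- 1ℚ) :* y := x :- y) refl (∫ f W) (∫ g W)))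

∫-* : ∀ a (f : A → ℚ) W → ∫ (λ x → a * f x) W ≡ a * ∫ f W
∫-* a f [] = sym (ℚP.*-zeroʳ a)
∫-* a f ((w , x) ∷ W) = trans (cong (w * (a * f x) +_) (∫-* a f W))
  (solve 4 (λ w a x s → w :* (a :* x) :+ a :* s := a :* (w :* x :+ s)) refl w a (f x) (∫ f W))

∫-≡0 : {S : A → Set} {f : A → ℚ} {W : Meas A} → W on S → (∀ a → S a → f a ≡ 0ℚ) → ∫ f W ≡ 0ℚ
∫-≡0 [] e = refl
∫-≡0 {W = (w , a) ∷ W} (s ∷ ss) e =
  trans (cong₂ _+_ (trans (cong (w *_) (e a s)) (ℚP.*-zeroʳ w)) (∫-≡0 ss e)) (ℚP.+-identityˡ 0ℚ)

∫-++ : (f : A → ℚ) (V W : Meas A) → ∫ f (V ++ W) ≡ ∫ f V + ∫ f W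
∫-++ f [] W = sym (ℚP.+-identityˡ _)
∫-++ f ((w , a) ∷ V) W = trans (cong (w * f a +_) (∫-++ f V W)) (sym (ℚP.+-assoc (w * f a) (∫ f V) (∫ f W)))

rescale : ℚ → Meas A → Meas A
rescale c = map (λ p → c * proj₁ p , proj₂ p)

∫-rescale : ∀ c (f : A → ℚ) W → ∫ f (rescale c W) ≡ c * ∫ f W
∫-rescale c f [] = sym (ℚP.*-zeroʳ c)
∫-rescale c f ((w , a) ∷ W) = trans (cong₂ _+_ (ℚP.*-assoc c w (f a)) (∫-rescale c f W)) (sym (ℚP.*-distribˡ-+ c _ _))

rescale-on⁺ : ∀ {c} {S : A → Set} {W : Meas A} → 0ℚ ≤ c → W on⁺ S → rescale c W on⁺ S
rescale-on⁺ 0≤c [] = []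
rescale-on⁺ 0≤c ((0≤w , s) ∷ ss) = (0≤* 0≤c 0≤w , s) ∷ rescale-on⁺ 0≤c ss

∫-nonneg : {S : A → Set} {f : A → ℚ} {W : Meas A} → W on⁺ S → (∀ a → S a → 0ℚ ≤ f a) → 0ℚ ≤ ∫ f W
∫-nonneg [] 0≤f = ≤-refl
∫-nonneg {W = (w , a) ∷ W} ((0≤w , s) ∷ ss) 0≤f = 0≤+ (0≤* 0≤w (0≤f a s)) (∫-nonneg ss 0≤f)

∫-nonneg≡0 : {S : A → Set} {f : A → ℚ} {W : Meas A} → W on⁺ S → (∀ a → S a → 0ℚ ≤ f a) → ∫ f W ≡ 0ℚ →
  All (λ p → proj₁ p * f (proj₂ p) ≡ 0ℚ) W
∫-nonneg≡0 [] 0≤f eq = []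
∫-nonneg≡0 {W = (w , a) ∷ W} ((0≤w , s) ∷ ss) 0≤f eq =
  let e , e' = +≡0⇒≡0 (0≤* 0≤w (0≤f a s)) (∫-nonneg ss 0≤f) eq
  in e ∷ ∫-nonneg≡0 ss 0≤f e'

-- An atom on which f does not vanish is weightless once ∫ f = 0.
∫-support : {S T : A → Set} {f : A → ℚ} {W : Meas A} → W on⁺ S → (∀ a → S a → 0ℚ ≤ f a) → ∫ f W ≡ 0ℚ →
  (∀ a → S a → f a ≡ 0ℚ → T a) →
  Σ (Meas A) λ V → V on⁺ T × (∀ g → ∫ g V ≡ ∫ g W)
∫-support [] 0≤f eq t = [] , [] , λ _ → refl
∫-support {S = S} {T = T} {f = f} {W = (w , a) ∷ W} ((0≤w , s) ∷ ss) 0≤f eq t =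
  let e , e' = +≡0⇒≡0 (0≤* 0≤w (0≤f a s)) (∫-nonneg ss 0≤f) eq
  in add e (f a ℚP.≟ 0ℚ) (∫-support ss 0≤f e' t)
  where
  add : w * f a ≡ 0ℚ → Dec (f a ≡ 0ℚ) → (Σ (Meas _) λ V → V on⁺ T × (∀ g → ∫ g V ≡ ∫ g W)) →
    Σ (Meas _) λ V → V on⁺ T × (∀ g → ∫ g V ≡ w * g a + ∫ g W)
  add _ (yes fa≡0) (V , Vt , V≡) = (w , a) ∷ V , (0≤w , t a s fa≡0) ∷ Vt , λ g → cong (w * g a +_) (V≡ g)
  add e (no fa≢0) (V , Vt , V≡) = V , Vt , λ g →
    trans (V≡ g) (sym (trans (cong (_+ ∫ g W) (trans (cong (_* g a) w≡0) (ℚP.*-zeroˡ (g a)))) (ℚP.+-identityˡ _)))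
    where
    w≡0 : w ≡ 0ℚ
    w≡0 = *≡0⇒≡0 fa≢0 (trans (ℚP.*-comm (f a) w) e)

-- Applied to `M` and to the height, this cut produces the lattice points of the joined faces.
∫-split : {S T T' : A → Set} {W : Meas A} → W on⁺ S → (∀ a → S a → T a ⊎ T' a) →
  Σ (Meas A) λ V → Σ (Meas A) λ V' → V on⁺ T × V' on⁺ T' × (∀ g → ∫ g W ≡ ∫ g V + ∫ g V')
∫-split [] t = [] , [] , [] , [] , λ g → sym (ℚP.+-identityˡ 0ℚ)
∫-split {W = (w , a) ∷ W} ((0≤w , s) ∷ ss) t with ∫-split ss t | t a s
... | V , V' , vt , vt' , e | inj₁ ta = (w , a) ∷ V , V' , (0≤w , ta) ∷ vt , vt' ,
  λ g → trans (cong (w * g a +_) (e g)) (sym (ℚP.+-assoc (w * g a) (∫ g V) (∫ g V')))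
... | V , V' , vt , vt' , e | inj₂ ta' = V , (w , a) ∷ V' , vt , (0≤w , ta') ∷ vt' ,
  λ g → trans (cong (w * g a +_) (e g)) (solve 3 (λ x y z → x :+ (y :+ z) := y :+ (x :+ z)) refl (w * g a) (∫ g V) (∫ g V'))

∫-sum : (F : A → Fin n → ℚ) (W : Meas A) → ∫ (λ a → sumℚ (F a)) W ≡ sumℚ (λ i → ∫ (λ a → F a i) W)
∫-sum {n = n} F [] = sym (sum-0 n)
∫-sum F ((w , a) ∷ W) = trans (cong₂ _+_ (sym (sum-* w (F a))) (∫-sum F W))
  (sym (sum-+ (λ i → w * F a i) (λ i → ∫ (λ a → F a i) W)))

barycentre : (A → QPt n) → Meas A → QPt n
barycentre h W i = ∫ (λ a → h a i) W

∙-barycentre : (u : QPt n) (h : A → QPt n) (W : Meas A) → u ∙ barycentre h W ≡ ∫ (λ a → u ∙ h a) W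
∙-barycentre u h W = trans (sum-cong (λ i → sym (∫-* (u i) (λ a → h a i) W))) (sym (∫-sum (λ a i → u i * h a i) W))

pushforward : (A → B) → Meas A → Meas B
pushforward f = map (λ p → proj₁ p , f (proj₂ p))

∫-pushforward : (f : A → B) (g : B → ℚ) (W : Meas A) → ∫ g (pushforward f W) ≡ ∫ (g ∘ f) W
∫-pushforward f g [] = refl
∫-pushforward f g ((w , a) ∷ W) = cong (w * g (f a) +_) (∫-pushforward f g W)

toMeas : (L : List A) → (Fin (length L) → ℚ) → Meas A
toMeas [] c = []
toMeas (a ∷ L) c = (c zero , a) ∷ toMeas L (c ∘ suc)

∫-toMeas : (f : A → ℚ) (L : List A) (c : Fin (length L) → ℚ) → ∫ f (toMeas L c) ≡ sumℚ (λ j → c j * f (lookup L j))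
∫-toMeas f [] c = refl
∫-toMeas f (a ∷ L) c = cong (c zero * f a +_) (∫-toMeas f L (c ∘ suc))

toMeas-on : (L : List A) (c : Fin (length L) → ℚ) → toMeas L c on (_∈ L)
toMeas-on [] c = []
toMeas-on (a ∷ L) c = here refl ∷ All.map there (toMeas-on L (c ∘ suc))

toMeas-on⁺ : (L : List A) (c : Fin (length L) → ℚ) → (∀ j → 0ℚ ≤ c j) → toMeas L c on⁺ (_∈ L)
toMeas-on⁺ [] c 0≤c = []
toMeas-on⁺ (a ∷ L) c 0≤c =
  (0≤c zero , here refl) ∷ All.map (λ (p , q) → p , there q) (toMeas-on⁺ L (c ∘ suc) (0≤c ∘ suc))

atom : {A : Set} (L : List A) {a : A} (w : ℚ) → 0ℚ ≤ w → a ∈ L →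
  Σ (Fin (length L) → ℚ) λ c → (∀ j → 0ℚ ≤ c j) × (∀ (f : A → ℚ) → sumℚ (λ j → c j * f (lookup L j)) ≡ w * f a)
atom (a ∷ L) w 0≤w (here refl) = (λ { zero → w ; (suc _) → 0ℚ }) , (λ { zero → 0≤w ; (suc _) → ≤-refl }) ,
  λ f → trans (cong (w * f a +_) (sum-≡0 (λ j → ℚP.*-zeroˡ (f (lookup L j))))) (ℚP.+-identityʳ (w * f a))
atom (b ∷ L) {a} w 0≤w (there a∈) with atom L w 0≤w a∈
... | c , 0≤c , e = (λ { zero → 0ℚ ; (suc j) → c j }) , (λ { zero → ≤-refl ; (suc j) → 0≤c j }) ,
  λ f → trans (cong₂ _+_ (ℚP.*-zeroˡ (f b)) (e f)) (ℚP.+-identityˡ (w * f a))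

-- Each atom contributes a coefficient function living at one position of `L`; adding these merges
-- repeated atoms into the fixed-length coefficients of `InConv`.
fromMeas : {A : Set} (L : List A) (W : Meas A) → W on⁺ (_∈ L) →
  Σ (Fin (length L) → ℚ) λ c → (∀ j → 0ℚ ≤ c j) × (∀ (f : A → ℚ) → sumℚ (λ j → c j * f (lookup L j)) ≡ ∫ f W)
fromMeas L [] [] = (λ _ → 0ℚ) , (λ _ → ≤-refl) , λ f → sum-≡0 (λ j → ℚP.*-zeroˡ (f (lookup L j)))
fromMeas L ((w , a) ∷ W) ((0≤w , a∈) ∷ ss) with atom L w 0≤w a∈ | fromMeas L W ss
... | c , 0≤c , e | c' , 0≤c' , e' = (λ j → c j + c' j) , (λ j → 0≤+ (0≤c j) (0≤c' j)) ,
  λ f → trans (sum-cong (λ j → ℚP.*-distribʳ-+ (f (lookup L j)) (c j) (c' j)))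
          (trans (sum-+ (λ j → c j * f (lookup L j)) (λ j → c' j * f (lookup L j))) (cong₂ _+_ (e f) (e' f)))

-- A relation in place of a map lets the choice of `b` depend on the membership proof for `a`, as it
-- does when preimages are picked from a mapped list.
∫-relate : {S : A → Set} {S' : B → Set} {R : B → A → Set} {W : Meas A} → W on⁺ S →
  (∀ a → S a → Σ B λ b → S' b × R b a) →
  Σ (Meas B) λ V → V on⁺ S' × (∀ f g → (∀ b a → R b a → g b ≡ f a) → ∫ g V ≡ ∫ f W)
∫-relate [] t = [] , [] , λ _ _ _ → refl
∫-relate {W = (w , a) ∷ W} ((0≤w , s) ∷ ss) t =
  let b , s' , r = t a s
      V , Vs , e = ∫-relate ss t
  in (w , b) ∷ V , (0≤w , s') ∷ Vs , λ f g h → cong₂ _+_ (cong (w *_) (h b a r)) (e f g h)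

-- Cones over lattice polytopes

-- The map `h` is left open because generators of `P` must be lifted to height 1, whereas those of
-- `P^×` already live in the space of the dual cone.
ConeOf : (A → QPt n) → List A → QPt n → Set
ConeOf {A} h L x = Σ (Meas A) λ W → W on⁺ (_∈ L) × (∀ i → barycentre h W i ≡ x i)

Cone : List (Pt n) → QPt (suc n) → Set
Cone = ConeOf hat

cone-∙ : (u : QPt n) {h : A → QPt n} {L : List A} {x : QPt n} (k : ConeOf h L x) → u ∙ x ≡ ∫ (λ a → u ∙ h a) (proj₁ k)
cone-∙ u {h} (W , _ , e) = trans (sym (∙-congʳ u e)) (∙-barycentre u h W)

cone-nonneg : (u : QPt n) {h : A → QPt n} {L : List A} {x : QPt n} → ConeOf h L x → (∀ a → a ∈ L → 0ℚ ≤ u ∙ h a) → 0ℚ ≤ u ∙ x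
cone-nonneg u k 0≤u = subst (0ℚ ≤_) (sym (cone-∙ u k)) (∫-nonneg (proj₁ (proj₂ k)) 0≤u)

cone-const : (u : QPt n) {h : A → QPt n} {L : List A} {x : QPt n} → ConeOf h L x → (c : ℚ) (v : QPt n) →
  (∀ a → a ∈ L → u ∙ h a ≡ c * (v ∙ h a)) → u ∙ x ≡ c * (v ∙ x)
cone-const u {h} {x = x} k c v e = begin
  u ∙ x                                  ≡⟨ cone-∙ u k ⟩
  ∫ (λ a → u ∙ h a) (proj₁ k)            ≡⟨ ∫-cong-on (on⁺⇒on (proj₁ (proj₂ k))) e ⟩
  ∫ (λ a → c * (v ∙ h a)) (proj₁ k)      ≡⟨ ∫-* c (λ a → v ∙ h a) (proj₁ k) ⟩
  c * ∫ (λ a → v ∙ h a) (proj₁ k)        ≡⟨ cong (c *_) (sym (cone-∙ v k)) ⟩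
  c * (v ∙ x) ∎
  where open ≡-Reasoning

cone-≡0 : (u : QPt n) {h : A → QPt n} {L : List A} {x : QPt n} → ConeOf h L x →
  (∀ a → a ∈ L → u ∙ h a ≡ 0ℚ) → u ∙ x ≡ 0ℚ
cone-≡0 u k e = trans (cone-∙ u k) (∫-≡0 (on⁺⇒on (proj₁ (proj₂ k))) e)

∫-const : (c : ℚ) (W : Meas A) → ∫ (λ _ → c) W ≡ c * ∫ (λ _ → 1ℚ) W
∫-const c W = trans (∫-cong W (λ _ → sym (ℚP.*-identityʳ c))) (∫-* c (λ _ → 1ℚ) W)

conv⇒meas : {gens : List (Pt n)} {x : QPt n} → InConv gens x →
  Σ (Meas (Pt n)) λ W → W on⁺ (_∈ gens) × ∫ (λ _ → 1ℚ) W ≡ 1ℚ × (∀ i → barycentre toQPt W i ≡ x i)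
conv⇒meas {gens = gens} (c , 0≤c , Σc , e) = toMeas gens c , toMeas-on⁺ gens c 0≤c ,
  trans (∫-toMeas (λ _ → 1ℚ) gens c) (trans (sum-cong (λ j → ℚP.*-identityʳ (c j))) Σc) ,
  λ i → trans (∫-toMeas (λ v → toℚ (v i)) gens c) (e i)

meas⇒conv : {gens : List (Pt n)} {x : QPt n} (W : Meas (Pt n)) → W on⁺ (_∈ gens) → ∫ (λ _ → 1ℚ) W ≡ 1ℚ →
  (∀ i → barycentre toQPt W i ≡ x i) → InConv gens x
meas⇒conv {gens = gens} W W∈ mass e =
  let c , 0≤c , c≡ = fromMeas gens W W∈
  in c , 0≤c , trans (sum-cong (λ j → sym (ℚP.*-identityʳ (c j)))) (trans (c≡ (λ _ → 1ℚ)) mass) ,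
     λ i → trans (c≡ (λ v → toℚ (v i))) (e i)

conv-mono : {L L' : List (Pt n)} → (∀ v → v ∈ L → v ∈ L') → (x : QPt n) → InConv L x → InConv L' x
conv-mono L⊆L' x xL = let W , W∈ , mass , e = conv⇒meas xL
                      in meas⇒conv W (All.map (λ { {w , v} (p , v∈) → p , L⊆L' v v∈ }) W∈) mass e

vertex∈conv : (L : List (Pt n)) {v : Pt n} → v ∈ L → InConv L (toQPt v)
vertex∈conv L {v} v∈ = meas⇒conv ((1ℚ , v) ∷ []) ((0≤1 , v∈) ∷ [])
  (solve 0 (con 1ℚ :* con 1ℚ :+ con 0ℚ := con 1ℚ) refl)
  (λ i → solve 1 (λ x → con 1ℚ :* x :+ con 0ℚ := x) refl (toℚ (v i)))

-- The homogeneous form of `RelInt`: a supporting functional that touches `x` contains the whole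
-- cone in its zero set. For empty `L` the point 0 is interior, in accordance with codegree 0 of the
-- empty polytope.
Int : List (Pt n) → QPt (suc n) → Set
Int L x = Cone L x × (∀ u → (∀ v → v ∈ L → 0ℚ ≤ u ∙ hat v) → u ∙ x ≡ 0ℚ → ∀ v → v ∈ L → u ∙ hat v ≡ 0ℚ)

int-cong : {L : List (Pt n)} {x y : QPt (suc n)} → (∀ i → x i ≡ y i) → Int L x → Int L y
int-cong x≗y ((W , W∈ , e) , int) = (W , W∈ , λ i → trans (e i) (x≗y i)) ,
  λ u 0≤u u∙y → int u 0≤u (trans (∙-congʳ u x≗y) u∙y)

-- Interior points of the image of L under v ↦ ρ v - m.
module Image {n} (L L' : List (Pt n)) (ρ : ℚ) (0<ρ : 0ℚ < ρ) (m : QPt n)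
  (to : ∀ v → v ∈ L → Σ (Pt n) λ v' → v' ∈ L' × (∀ i → toℚ (v' i) ≡ ρ * toℚ (v i) - m i))
  (from : ∀ v' → v' ∈ L' → Σ (Pt n) λ v → v ∈ L × (∀ i → toℚ (v' i) ≡ ρ * toℚ (v i) - m i)) where

  Rel : Pt n → Pt n → Set
  Rel v v' = ∀ i → toℚ (v' i) ≡ ρ * toℚ (v i) - m i

  -- The point of the cone at height `ρ` whose affine counterpart `(x + m) / ρ` is sent to `x`.
  homogenise : QPt n → QPt (suc n)
  homogenise x = qext ρ (λ i → x i + m i)

  ·-image : ∀ u {v v'} → Rel v v' → u · v' ≡ ρ * (u · v) - u ∙ m
  ·-image u {v} e = trans (∙-congʳ u (λ i → trans (e i)
      (solve 3 (λ r x y → r :* x :- y := r :* x :+ con (- 1ℚ) :* y) refl ρ (toℚ (v i)) (m i))))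
    (trans (∙-linʳ u ρ (toQPt v) (- 1ℚ) m)
      (solve 3 (λ r x y → r :* x :+ con (- 1ℚ) :* y := r :* x :- y) refl ρ (u · v) (u ∙ m)))

  ∙-homogenise : ∀ (u : QPt (suc n)) x → u ∙ homogenise x ≡ u zero * ρ + ((u ∘ suc) ∙ x + (u ∘ suc) ∙ m)
  ∙-homogenise u x = cong (u zero * ρ +_) (trans
    (sum-cong (λ i → ℚP.*-distribˡ-+ (u (suc i)) (x i) (m i))) (sum-+ (λ i → u (suc i) * x i) (λ i → u (suc i) * m i)))

  pull : QPt n → ℚ → QPt (suc n)
  pull u c = qext (- (c + u ∙ m)) (λ i → ρ * u i)

  scaled-∙ : ∀ (u x : QPt n) → (λ i → ρ * u i) ∙ x ≡ ρ * (u ∙ x)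
  scaled-∙ u x = trans (sum-cong (λ i → ℚP.*-assoc ρ (u i) (x i))) (sum-* ρ (λ i → u i * x i))

  pull-hat : ∀ u c {v v'} → Rel v v' → pull u c ∙ hat v ≡ u · v' - c
  pull-hat u c {v} {v'} e = trans (∙-hat (pull u c) v) (trans (cong (- (c + u ∙ m) +_) (scaled-∙ u (toQPt v)))
    (trans (solve 3 (λ c s t → :- (c :+ s) :+ t := (t :- s) :- c) refl c (u ∙ m) (ρ * (u · v)))
           (cong (_- c) (sym (·-image u {v} {v'} e)))))

  relInt⇒int : ∀ x → RelInt L' x → Int L (homogenise x)
  relInt⇒int x (conv , int) = cone , interior
    where
    cone : Cone L (homogenise x)
    cone =
      let W , W∈ , mass , e = conv⇒meas conv
          V , V∈ , V≡ = ∫-relate {R = Rel} W∈ from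
      in rescale ρ V , rescale-on⁺ (<⇒≤ 0<ρ) V∈ , λ
        { zero → trans (∫-rescale ρ (λ _ → 1ℚ) V)
            (trans (cong (ρ *_) (trans (V≡ (λ _ → 1ℚ) (λ _ → 1ℚ) (λ _ _ _ → refl)) mass)) (ℚP.*-identityʳ ρ))
        ; (suc i) → begin
            ∫ (λ v → toℚ (v i)) (rescale ρ V)        ≡⟨ ∫-rescale ρ (λ v → toℚ (v i)) V ⟩
            ρ * ∫ (λ v → toℚ (v i)) V                ≡⟨ sym (∫-* ρ (λ v → toℚ (v i)) V) ⟩
            ∫ (λ v → ρ * toℚ (v i)) V                ≡⟨ V≡ (λ v' → 1ℚ * toℚ (v' i) + m i * 1ℚ) _ (λ v v' r →
                                                          trans (solve 2 (λ x y → x := con 1ℚ :* (x :- y) :+ y :* con 1ℚ) refl (ρ * toℚ (v i)) (m i))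
                                                            (cong (λ z → 1ℚ * z + m i * 1ℚ) (sym (r i)))) ⟩
            ∫ (λ v' → 1ℚ * toℚ (v' i) + m i * 1ℚ) W  ≡⟨ ∫-lin 1ℚ (m i) (λ v' → toℚ (v' i)) (λ _ → 1ℚ) W ⟩
            1ℚ * ∫ (λ v' → toℚ (v' i)) W + m i * ∫ (λ _ → 1ℚ) W
                                                     ≡⟨ cong₂ (λ s t → 1ℚ * s + m i * t) (e i) mass ⟩
            1ℚ * x i + m i * 1ℚ                      ≡⟨ solve 2 (λ x y → con 1ℚ :* x :+ y :* con 1ℚ := x :+ y) refl (x i) (m i) ⟩
            x i + m i ∎ }
      where open ≡-Reasoning
    interior : ∀ u → (∀ v → v ∈ L → 0ℚ ≤ u ∙ hat v) → u ∙ homogenise x ≡ 0ℚ → ∀ v → v ∈ L → u ∙ hat v ≡ 0ℚ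
    interior u 0≤u u∙x v v∈ = *≡0⇒≡0 (<⇒≢0 0<ρ) (trans (sym (scaled {v} {proj₁ (to v v∈)} (proj₂ (proj₂ (to v v∈)))))
        (trans (cong (_- c) (All.lookup (int u' c valid u'∙x) (proj₁ (proj₂ (to v v∈))))) (ℚP.+-inverseʳ c)))
      where
      u' = u ∘ suc
      c = - (ρ * u zero + u' ∙ m)
      scaled : ∀ {v v'} → Rel v v' → u' · v' - c ≡ ρ * (u ∙ hat v)
      scaled {v} {v'} e = trans (cong (_- c) (·-image u' {v} {v'} e))
        (trans (solve 4 (λ r a s t → (r :* t :- s) :- (:- (r :* a :+ s)) := r :* (a :+ t)) refl ρ (u zero) (u' ∙ m) (u' · v))
               (cong (ρ *_) (sym (∙-hat u v))))
      valid : Valid L' u' c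
      valid = All.tabulate λ {v'} v'∈ → let v , v∈ , e = from v' v'∈ in
        ≤-by (0≤* (<⇒≤ 0<ρ) (0≤u v v∈)) (scaled {v} {v'} e)
      u'∙x : u' ∙ x ≡ c
      u'∙x = trans (solve 4 (λ r a s t → t := (a :* r :+ (t :+ s)) :+ :- (r :* a :+ s)) refl ρ (u zero) (u' ∙ m) (u' ∙ x))
        (trans (cong (_+ c) (trans (sym (∙-homogenise u x)) u∙x)) (ℚP.+-identityˡ c))

  int⇒relInt : ∀ x → Int L (homogenise x) → RelInt L' x
  int⇒relInt x (cone@(W , W∈ , e) , int) = conv , interior
    where
    ρ⁻¹ = proj₁ (inverse⁺ ρ 0<ρ)
    ρ⁻¹ρ : ρ⁻¹ * ρ ≡ 1ℚ
    ρ⁻¹ρ = proj₂ (proj₂ (inverse⁺ ρ 0<ρ))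
    conv : InConv L' x
    conv =
      let V , V∈ , V≡ = ∫-relate {R = λ v' v → Rel v v'} W∈ to
          mass : ∫ (λ _ → 1ℚ) (rescale ρ⁻¹ V) ≡ 1ℚ
          mass = trans (∫-rescale ρ⁻¹ (λ _ → 1ℚ) V)
                   (trans (cong (ρ⁻¹ *_) (trans (V≡ (λ _ → 1ℚ) (λ _ → 1ℚ) (λ _ _ _ → refl)) (e zero))) ρ⁻¹ρ)
      in meas⇒conv (rescale ρ⁻¹ V) (rescale-on⁺ (<⇒≤ (proj₁ (proj₂ (inverse⁺ ρ 0<ρ)))) V∈) mass λ i → begin
        ∫ (λ v' → toℚ (v' i)) (rescale ρ⁻¹ V)            ≡⟨ ∫-rescale ρ⁻¹ (λ v' → toℚ (v' i)) V ⟩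
        ρ⁻¹ * ∫ (λ v' → toℚ (v' i)) V                    ≡⟨ cong (ρ⁻¹ *_) (V≡ (λ v → ρ * toℚ (v i) + (- m i) * 1ℚ) _
                                                              (λ v' v r → trans (r i) (solve 2 (λ x y → x :- y := x :+ :- y :* con 1ℚ) refl (ρ * toℚ (v i)) (m i)))) ⟩
        ρ⁻¹ * ∫ (λ v → ρ * toℚ (v i) + (- m i) * 1ℚ) W   ≡⟨ cong (ρ⁻¹ *_) (∫-lin ρ (- m i) (λ v → toℚ (v i)) (λ _ → 1ℚ) W) ⟩
        ρ⁻¹ * (ρ * ∫ (λ v → toℚ (v i)) W + (- m i) * ∫ (λ _ → 1ℚ) W)
                                                         ≡⟨ cong₂ (λ s t → ρ⁻¹ * (ρ * s + (- m i) * t)) (e (suc i)) (e zero) ⟩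
        ρ⁻¹ * (ρ * (x i + m i) + (- m i) * ρ)            ≡⟨ solve 4 (λ q r x m → q :* (r :* (x :+ m) :+ :- m :* r) := (q :* r) :* x) refl ρ⁻¹ ρ (x i) (m i) ⟩
        (ρ⁻¹ * ρ) * x i                                  ≡⟨ trans (cong (_* x i) ρ⁻¹ρ) (ℚP.*-identityˡ (x i)) ⟩
        x i ∎
      where open ≡-Reasoning
    interior : ∀ u c → Valid L' u c → sumℚ (λ i → u i * x i) ≡ c → All (λ v → u · v ≡ c) L'
    interior u c valid u∙x = All.tabulate λ {v'} v'∈ →
      let v , v∈ , e = from v' v'∈
      in trans (solve 2 (λ x c → x := (x :- c) :+ c) refl (u · v') c)
           (trans (cong (_+ c) (trans (sym (pull-hat u c {v} {v'} e)) (int (pull u c) nonneg vanish v v∈))) (ℚP.+-identityˡ c))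
      where
      nonneg : ∀ v → v ∈ L → 0ℚ ≤ pull u c ∙ hat v
      nonneg v v∈ = let v' , v'∈ , e = to v v∈ in
        subst (0ℚ ≤_) (sym (pull-hat u c {v} {v'} e)) (0≤-diff (All.lookup valid v'∈))
      vanish : pull u c ∙ homogenise x ≡ 0ℚ
      vanish = trans (∙-homogenise (pull u c) x) (trans
        (cong₂ (λ s t → - (c + u ∙ m) * ρ + (s + t)) (scaled-∙ u x) (scaled-∙ u m))
        (trans (solve 4 (λ c s r t → :- (c :+ s) :* r :+ (r :* t :+ r :* s) := r :* (t :- c)) refl c (u ∙ m) ρ (u ∙ x))
          (trans (cong (λ z → ρ * (z - c)) u∙x) (solve 2 (λ r c → r :* (c :- c) := con 0ℚ) refl ρ c))))

0<toℚ : ∀ {k} → 1 ℕ.≤ k → 0ℚ < toℚ (pos k)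
0<toℚ {k} 1≤k = ℚP.<-≤-trans 0<1 (toℚ-mono {pos 1} {pos k} (ℤ.+≤+ 1≤k))

module ScaledImage {n} (L : List (Pt n)) (k : ℕ) (1≤k : 1 ℕ.≤ k) where
  private
    Scaled : Pt n → Pt n → Set
    Scaled v v' = ∀ i → toℚ (v' i) ≡ toℚ (pos k) * toℚ (v i) - 0ℚ
    scaled : ∀ v → Scaled v (λ i → pos k ℤ.* v i)
    scaled v i = trans (toℚ-* (pos k) (v i)) (sym (ℚP.+-identityʳ _))
    to : ∀ v → v ∈ L → Σ (Pt n) λ v' → v' ∈ scale k L × Scaled v v'
    to v v∈ = _ , ∈-map⁺ (λ v i → pos k ℤ.* v i) v∈ , scaled v
    from : ∀ v' → v' ∈ scale k L → Σ (Pt n) λ v → v ∈ L × Scaled v v'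
    from v' v'∈ with ∈-map⁻ (λ v i → pos k ℤ.* v i) v'∈
    ... | v , v∈ , refl = v , v∈ , scaled v
  open Image L (scale k L) (toℚ (pos k)) (0<toℚ 1≤k) (λ _ → 0ℚ) to from

  scale-relInt⇒int : (x : Pt n) → RelInt (scale k L) (toQPt x) → Int L (toQPt (ext x (pos k)))
  scale-relInt⇒int x int = int-cong (λ { zero → refl ; (suc i) → ℚP.+-identityʳ (toℚ (x i)) }) (relInt⇒int (toQPt x) int)

  int⇒scale-relInt : (x : Pt n) → Int L (toQPt (ext x (pos k))) → RelInt (scale k L) (toQPt x)
  int⇒scale-relInt x int = int⇒relInt (toQPt x)
    (int-cong (λ { zero → refl ; (suc i) → sym (ℚP.+-identityʳ (toℚ (x i))) }) int)

open ScaledImage public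

-- Codegree and the Gorenstein property from a least interior lattice point

codeg⇒int : {L : List (Pt n)} {c : ℕ} → IsCodeg L c → Σ (Pt n) λ x → Int L (toQPt (ext x (pos c)))
codeg⇒int (inj₁ (refl , refl)) =
  (λ _ → pos 0) , ([] , [] , λ { zero → refl ; (suc i) → refl }) , λ u _ _ v ()
codeg⇒int {L = L} {c} (inj₂ (1≤c , (x , int) , _)) = x , scale-relInt⇒int L c 1≤c x int

-- The height is nonnegative on the cone and 1 at every generator, so it cannot vanish at an
-- interior point while a generator exists.
int-height≡0 : {L : List (Pt n)} {x : QPt (suc n)} → Int L x → x zero ≡ 0ℚ → ∀ v → ¬ (v ∈ L)
int-height≡0 {x = x} (_ , int) x₀ v v∈ = <⇒≢0 0<1 (trans (sym (height-hat v))
  (int height (λ v _ → subst (0ℚ ≤_) (sym (height-hat v)) 0≤1) (trans (basis-∙ zero x) x₀) v v∈))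

cone-empty : {L : List (Pt n)} {x : QPt (suc n)} → (∀ v → ¬ (v ∈ L)) → Cone L x → ∀ i → x i ≡ 0ℚ
cone-empty empty (W , W∈ , e) i = trans (sym (e i)) (∫-≡0 (on⁺⇒on W∈) (λ v v∈ → ⊥-elim (empty v v∈)))

[]⊎∈ : (L : List A) → L ≡ [] ⊎ Σ A (_∈ L)
[]⊎∈ [] = inj₁ refl
[]⊎∈ (a ∷ L) = inj₂ (a , here refl)

-- The `ρ r` stand in for the facet normals of the cone over `F`: by `detect`, the zeros on `F` of a
-- supporting functional that is nonzero somewhere on `F` are zeros of some `ρ r`. The hypothesis
-- `least` is kept abstract because it is proved differently for a face of `P` and for a dual face.
module Core {n} (F : List (Pt n)) (X : Pt n) (k : ℕ) {R : Set} (ρ : R → Pt (suc n))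
  (int : Int F (toQPt (ext X (pos k))))
  (ρ-nonneg : ∀ r p → p ∈ F → 0ℚ ≤ toQPt (ρ r) ∙ hat p)
  (ρ-X : ∀ r → toQPt (ρ r) ∙ toQPt (ext X (pos k)) ≡ 1ℚ)
  (least : ∀ x j → Cone F (toQPt (ext x (pos j))) → (∀ r → 1ℚ ≤ toQPt (ρ r) ∙ toQPt (ext x (pos j))) →
    k ℕ.≤ j × (j ≡ k → ∀ i → x i ≡ X i))
  (detect : ∀ u → (∀ p → p ∈ F → 0ℚ ≤ u ∙ hat p) → (Σ (Pt n) λ p → p ∈ F × u ∙ hat p ≢ 0ℚ) →
    Σ R λ r → ∀ p → p ∈ F → u ∙ hat p ≡ 0ℚ → toQPt (ρ r) ∙ hat p ≡ 0ℚ) where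

  -- If `ρ r` vanished at the interior point, it would vanish on `F` and therefore at `X`, where it
  -- is 1.
  int≥1 : ∀ x j → Int F (toQPt (ext x (pos j))) → ∀ r → 1ℚ ≤ toQPt (ρ r) ∙ toQPt (ext x (pos j))
  int≥1 x j (cone , intx) r = subst (1ℚ ≤_) (toℚ-∙ (ρ r) (ext x (pos j)))
    (1≤toℚ (ρ r ·ᶻ ext x (pos j)) (subst (0ℚ ≤_) (sym (toℚ-∙ (ρ r) (ext x (pos j)))) (cone-nonneg (toQPt (ρ r)) cone (ρ-nonneg r)))
      (λ e → <⇒≢0 0<1 (trans (sym (ρ-X r)) (cone-≡0 (toQPt (ρ r)) (proj₁ int)
        (intx (toQPt (ρ r)) (ρ-nonneg r) (trans (sym (toℚ-∙ (ρ r) (ext x (pos j)))) e))))))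

  int-least : ∀ x j → Int F (toQPt (ext x (pos j))) → k ℕ.≤ j × (j ≡ k → ∀ i → x i ≡ X i)
  int-least x j intx = least x j (proj₁ intx) (int≥1 x j intx)

  1≤k : ∀ {v} → v ∈ F → 1 ℕ.≤ k
  1≤k {v} v∈ = ℕP.n≢0⇒n>0 λ k≡0 → int-height≡0 int (cong (λ k → toℚ (pos k)) k≡0) v v∈

  codeg : ∀ c → IsCodeg F c → c ≡ k
  codeg c (inj₁ (refl , refl)) = ℤP.+-injective (toℚ-injective {pos 0} {pos k} (sym (cone-empty (λ v ()) (proj₁ int) zero)))
  codeg c (inj₂ (1≤c , (x , intx) , min)) = ℕP.≤-antisym (ℕP.≮⇒≥ (k≮c ([]⊎∈ F))) (proj₁ (int-least x c intx'))
    where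
    intx' = scale-relInt⇒int F c 1≤c x intx
    k≮c : F ≡ [] ⊎ (Σ (Pt n) (_∈ F)) → ¬ (k ℕ.< c)
    -- The second alternative of `IsCodeg` does not exclude an empty `F` by itself; but the cone
    -- over it is the origin, without points at height `c ≥ 1`.
    k≮c (inj₁ refl) _ = <⇒≢0 (0<toℚ 1≤c) (cone-empty (λ v ()) (proj₁ intx') zero)
    k≮c (inj₂ (v , v∈)) k<c = min k (1≤k v∈) k<c (X , int⇒scale-relInt F k (1≤k v∈) X int)

  private
    Q : List (Pt n)
    Q = translate (scale k F) X
    Rel : Pt n → Pt n → Set
    Rel v v' = ∀ i → toℚ (v' i) ≡ toℚ (pos k) * toℚ (v i) - toQPt X i
    affine : ∀ (v : Pt n) i → toℚ (pos k ℤ.* v i ℤ.- X i) ≡ toℚ (pos k) * toℚ (v i) - toℚ (X i)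
    affine v i = trans (toℚ-sub (pos k ℤ.* v i) (X i)) (cong (_- toℚ (X i)) (toℚ-* (pos k) (v i)))
    to : ∀ v → v ∈ F → Σ (Pt n) λ v' → v' ∈ Q × Rel v v'
    to v v∈ = _ , ∈-map⁺ _ (∈-map⁺ _ v∈) , affine v
    from : ∀ v' → v' ∈ Q → Σ (Pt n) λ v → v ∈ F × Rel v v'
    from v' v'∈ with ∈-map⁻ _ v'∈
    ... | v'' , v''∈ , refl with ∈-map⁻ _ v''∈
    ... | v , v∈ , refl = v , v∈ , affine v

  -- For a facet of `kF - X`, take the linear part of a `ρ r` that vanishes on the corresponding
  -- points of `F`. At `kv - X` its value is `k` times the value of `ρ r` at `hat v`, minus 1,
  -- because `ρ r` is 1 at `X`.
  reflexive : ∀ {v} → v ∈ F → Reflexive Q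
  reflexive v∈ = int⇒relInt (λ _ → 0ℚ) (int-cong (λ { zero → refl ; (suc i) → sym (ℚP.+-identityˡ (toℚ (X i))) }) int) , facets
    where
    open Image F Q (toℚ (pos k)) (0<toℚ (1≤k v∈)) (toQPt X) to from hiding (Rel)
    facets : ∀ u c → IsFacet Q u c → Σ (Pt n) λ w →
      All (λ v → -[1+ 0 ] ℤ.≤ w ·ᶻ v) Q × All (λ v → w ·ᶻ v ≡ -[1+ 0 ]) (face Q u c)
    facets u c (valid , j , ((ws , ws∈ , len , indep) , _) , (_ , max)) = w , lower , attained
      where
      nonneg : ∀ p → p ∈ F → 0ℚ ≤ pull u c ∙ hat p
      nonneg p p∈ = let p' , p'∈ , e = to p p∈ in
        subst (0ℚ ≤_) (sym (pull-hat u c {p} {p'} e)) (0≤-diff (All.lookup valid p'∈))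
      proper : Σ (Pt n) λ p → p ∈ F × pull u c ∙ hat p ≢ 0ℚ
      proper with all? (λ p → pull u c ∙ hat p ℚP.≟ 0ℚ) F
      ... | no ¬all = find (AllP.¬All⇒Any¬ (λ p → pull u c ∙ hat p ℚP.≟ 0ℚ) F ¬all)
      -- Otherwise the face is all of `Q`, and the `j + 1` affinely independent points of `Q` lie in
      -- a face of rank `j`.
      ... | yes all = ⊥-elim (ℕP.<-irrefl refl (subst (ℕ._≤ j) len (max ws (All.map onFace ws∈) indep)))
        where
        onFace : ∀ {v'} → v' ∈ Q → v' ∈ face Q u c
        onFace {v'} v'∈ = let v , v∈ , e = from v' v'∈ in
          ∈-filter⁺ (λ v → u · v ℚP.≟ c) v'∈
            (trans (solve 2 (λ x c → x := (x :- c) :+ c) refl (u · v') c)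
              (trans (cong (_+ c) (trans (sym (pull-hat u c {v} {v'} e)) (All.lookup all v∈))) (ℚP.+-identityˡ c)))
      r = proj₁ (detect (pull u c) nonneg proper)
      r-vanish = proj₂ (detect (pull u c) nonneg proper)
      w : Pt n
      w i = ρ r (suc i)
      w-value : ∀ {v v'} → Rel v v' → toℚ (w ·ᶻ v') ≡ toℚ (pos k) * (toQPt (ρ r) ∙ hat v) - 1ℚ
      w-value {v} {v'} e = trans (toℚ-∙ w v') (trans (·-image (toQPt w) {v} {v'} e) (begin
        K * s - t                              ≡⟨ solve 4 (λ k s t a → k :* s :- t := k :* (a :+ s) :- (a :* k :+ t)) refl K s t a ⟩
        K * (a + s) - (a * K + t)              ≡⟨ cong₂ (λ x y → K * x - y) (sym (∙-hat (toQPt (ρ r)) v)) (ρ-X r) ⟩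
        K * (toQPt (ρ r) ∙ hat v) - 1ℚ ∎))
        where
        open ≡-Reasoning
        K = toℚ (pos k)
        s = toQPt w · v
        t = toQPt w · X
        a = toℚ (ρ r zero)
      lower : All (λ v → -[1+ 0 ] ℤ.≤ w ·ᶻ v) Q
      lower = All.tabulate λ {v'} v'∈ → let v , v∈ , e = from v' v'∈ in
        toℚ-cancel { -[1+ 0 ]} {w ·ᶻ v'} (≤-by (0≤* (<⇒≤ (0<toℚ (1≤k v∈))) (ρ-nonneg r v v∈))
          (trans (cong (_- (- 1ℚ)) (w-value {v} {v'} e))
            (solve 1 (λ x → (x :- con 1ℚ) :- (:- con 1ℚ) := x) refl (toℚ (pos k) * (toQPt (ρ r) ∙ hat v)))))
      attained : All (λ v → w ·ᶻ v ≡ -[1+ 0 ]) (face Q u c)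
      attained = All.tabulate λ {v'} v'∈face →
        let v'∈ , u·v'≡c = ∈-filter⁻ (λ v → u · v ℚP.≟ c) {xs = Q} v'∈face
            v , v∈ , e = from v' v'∈
            ρv≡0 = r-vanish v v∈ (trans (pull-hat u c {v} {v'} e) (trans (cong (_- c) u·v'≡c) (ℚP.+-inverseʳ c)))
        in toℚ-injective {w ·ᶻ v'} { -[1+ 0 ]} (trans (w-value {v} {v'} e)
             (trans (cong (λ z → toℚ (pos k) * z - 1ℚ) ρv≡0) (solve 1 (λ k → k :* con 0ℚ :- con 1ℚ := :- con 1ℚ) refl (toℚ (pos k)))))

  gorenstein : Gorenstein F
  gorenstein = go ([]⊎∈ F)
    where
    go : F ≡ [] ⊎ (Σ (Pt n) (_∈ F)) → Gorenstein F
    go (inj₁ F≡[]) = inj₁ F≡[]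
    go (inj₂ (v , v∈)) = inj₂ (k , X , 1≤k v∈ , int⇒scale-relInt F k (1≤k v∈) X int ,
      (λ x intx → proj₂ (int-least x k (scale-relInt⇒int F k (1≤k v∈) x intx)) refl) , reflexive v∈)

-- Affine independence and rank

Coeffs : List A → Set
Coeffs L = Fin (length L) → ℚ

Combines : (L : List A) → Coeffs L → (L' : List B) → Coeffs L' → (B → A) → Set
Combines {A} L c L' c' f = ∀ (φ : A → ℚ) → sumℚ (λ j → c j * φ (lookup L j)) ≡ sumℚ (λ j → c' j * φ (f (lookup L' j)))

-- The index types `Fin (length (map f L))` and `Fin (length L)` agree only after induction on `L`,
-- so coefficients are carried across together with the facts about sums and vanishing.
map-coeffs : (f : A → B) (L : List A) (c : Coeffs (map f L)) →
  Σ (Coeffs L) λ c' → Combines (map f L) c L c' f × ((∀ j → c' j ≡ 0ℚ) → ∀ j → c j ≡ 0ℚ)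
map-coeffs f [] c = c , (λ φ → refl) , λ _ ()
map-coeffs f (a ∷ L) c = let c' , e , z = map-coeffs f L (c ∘ suc) in
  (λ { zero → c zero ; (suc j) → c' j }) , (λ φ → cong (c zero * φ (f a) +_) (e φ)) ,
  λ { c'≡0 zero → c'≡0 zero ; c'≡0 (suc j) → z (c'≡0 ∘ suc) j }

map-coeffs⁻ : (f : A → B) (L : List A) (c' : Coeffs L) →
  Σ (Coeffs (map f L)) λ c → Combines (map f L) c L c' f × ((∀ j → c j ≡ 0ℚ) → ∀ j → c' j ≡ 0ℚ)
map-coeffs⁻ f [] c = c , (λ φ → refl) , λ _ ()
map-coeffs⁻ f (a ∷ L) c = let c' , e , z = map-coeffs⁻ f L (c ∘ suc) in
  (λ { zero → c zero ; (suc j) → c' j }) , (λ φ → cong (c zero * φ (f a) +_) (e φ)) ,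
  λ { c'≡0 zero → c'≡0 zero ; c'≡0 (suc j) → z (c'≡0 ∘ suc) j }

++-coeffs : (L L' : List A) (c : Coeffs (L ++ L')) →
  Σ (Coeffs L) λ c₁ → Σ (Coeffs L') λ c₂ →
    (∀ (φ : A → ℚ) → sumℚ (λ j → c j * φ (lookup (L ++ L') j)) ≡
       sumℚ (λ j → c₁ j * φ (lookup L j)) + sumℚ (λ j → c₂ j * φ (lookup L' j))) ×
    ((∀ j → c₁ j ≡ 0ℚ) → (∀ j → c₂ j ≡ 0ℚ) → ∀ j → c j ≡ 0ℚ)
++-coeffs [] L' c = (λ ()) , c , (λ φ → sym (ℚP.+-identityˡ (sumℚ (λ j → c j * φ (lookup L' j))))) , λ _ z → z
++-coeffs (a ∷ L) L' c = let c₁ , c₂ , e , z = ++-coeffs L L' (c ∘ suc) in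
  (λ { zero → c zero ; (suc j) → c₁ j }) , c₂ ,
  (λ φ → trans (cong (c zero * φ a +_) (e φ))
    (sym (ℚP.+-assoc (c zero * φ a) (sumℚ (λ j → c₁ j * φ (lookup L j))) (sumℚ (λ j → c₂ j * φ (lookup L' j)))))) ,
  λ { z₁ z₂ zero → z₁ zero ; z₁ z₂ (suc j) → z (z₁ ∘ suc) z₂ j }

hatSum : (ws : List (Pt n)) → Coeffs ws → QPt (suc n)
hatSum ws c i = sumℚ (λ j → c j * hat (lookup ws j) i)

∙-hatSum : (u : QPt (suc n)) (ws : List (Pt n)) (c : Coeffs ws) → u ∙ hatSum ws c ≡ sumℚ (λ j → c j * (u ∙ hat (lookup ws j)))
∙-hatSum u ws c = begin
  sumℚ (λ i → u i * sumℚ (λ j → c j * hat (lookup ws j) i))      ≡⟨ sum-cong (λ i → sym (sum-* (u i) (λ j → c j * hat (lookup ws j) i))) ⟩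
  sumℚ (λ i → sumℚ (λ j → u i * (c j * hat (lookup ws j) i)))    ≡⟨ sum-swap (λ i j → u i * (c j * hat (lookup ws j) i)) ⟩
  sumℚ (λ j → sumℚ (λ i → u i * (c j * hat (lookup ws j) i)))    ≡⟨ sum-cong (λ j → sum-cong (λ i → swap (u i) (c j) (hat (lookup ws j) i))) ⟩
  sumℚ (λ j → sumℚ (λ i → c j * (u i * hat (lookup ws j) i)))    ≡⟨ sum-cong (λ j → sum-* (c j) (λ i → u i * hat (lookup ws j) i)) ⟩
  sumℚ (λ j → c j * (u ∙ hat (lookup ws j))) ∎
  where
  open ≡-Reasoning
  swap : ∀ a b x → a * (b * x) ≡ b * (a * x)
  swap = solve 3 (λ a b x → a :* (b :* x) := b :* (a :* x)) refl

-- Affine independence without the base point that `AffIndep` singles out: linear independence of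
-- the points lifted to height 1.
HatIndep : List (Pt n) → Set
HatIndep ws = (c : Coeffs ws) → (∀ i → hatSum ws c i ≡ 0ℚ) → ∀ j → c j ≡ 0ℚ

sum-*1 : (f : Fin n → ℚ) → sumℚ (λ j → f j * 1ℚ) ≡ sumℚ f
sum-*1 f = sum-cong (λ j → ℚP.*-identityʳ (f j))

translated-sum : (w : Pt n) (ws : List (Pt n)) (c : Coeffs ws) (i : Fin n) →
  sumℚ (λ j → c j * toℚ (lookup ws j i ℤ.- w i)) ≡ sumℚ (λ j → c j * toℚ (lookup ws j i)) - toℚ (w i) * sumℚ c
translated-sum w ws c i = trans
  (sum-cong (λ j → trans (cong (c j *_) (toℚ-sub (lookup ws j i) (w i)))
    (solve 3 (λ c x y → c :* (x :- y) := con 1ℚ :* (c :* x) :+ :- y :* c) refl (c j) (toℚ (lookup ws j i)) (toℚ (w i)))))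
  (trans (sum-lin 1ℚ (- toℚ (w i)) (λ j → c j * toℚ (lookup ws j i)) c)
    (solve 3 (λ s y t → con 1ℚ :* s :+ :- y :* t := s :- y :* t) refl (sumℚ (λ j → c j * toℚ (lookup ws j i))) (toℚ (w i)) (sumℚ c)))

-- The height coordinate says that the coefficients sum to 0, so subtracting `w` from every point
-- changes nothing; the term of `w` itself drops out and its coefficient is recovered last.
affIndep⇒hatIndep : (ws : List (Pt n)) → AffIndep ws → HatIndep ws
affIndep⇒hatIndep [] _ c _ ()
affIndep⇒hatIndep {n} (w ∷ ws) indep c e = λ { zero → c₀≡0 ; (suc j) → tail≡0 j }
  where
  s₀ : c zero + sumℚ (c ∘ suc) ≡ 0ℚ
  s₀ = trans (sym (cong₂ _+_ (ℚP.*-identityʳ (c zero)) (sum-*1 (c ∘ suc)))) (e zero)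
  shifted : ∀ i → sumℚ (λ j → c (suc j) * toℚ (lookup ws j i ℤ.- w i)) ≡ 0ℚ
  shifted i = trans (translated-sum w ws (c ∘ suc) i)
    (trans (solve 4 (λ c w s t → s :- w :* t := (c :* w :+ s) :- w :* (c :+ t)) refl (c zero) (toℚ (w i))
             (sumℚ (λ j → c (suc j) * toℚ (lookup ws j i))) (sumℚ (c ∘ suc)))
      (trans (cong₂ (λ x y → x - toℚ (w i) * y) (e (suc i)) s₀)
        (solve 1 (λ w → con 0ℚ :- w :* con 0ℚ := con 0ℚ) refl (toℚ (w i)))))
  lifted = map-coeffs⁻ (λ v i → v i ℤ.- w i) ws (c ∘ suc)
  tail≡0 : ∀ j → c (suc j) ≡ 0ℚ
  tail≡0 = proj₂ (proj₂ lifted) (indep (proj₁ lifted) (λ i → trans (proj₁ (proj₂ lifted) (λ v → toℚ (v i))) (shifted i)))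
  c₀≡0 : c zero ≡ 0ℚ
  c₀≡0 = trans (sym (ℚP.+-identityʳ (c zero))) (trans (cong (c zero +_) (sym (sum-≡0 tail≡0))) s₀)

hatIndep⇒affIndep : (ws : List (Pt n)) → HatIndep ws → AffIndep ws
hatIndep⇒affIndep [] _ = _
hatIndep⇒affIndep (w ∷ ws) indep c e = z (λ j → indep full eqs (suc j))
  where
  lowered = map-coeffs (λ v i → v i ℤ.- w i) ws c
  c' = proj₁ lowered
  z = proj₂ (proj₂ lowered)
  full : Coeffs (w ∷ ws)
  full zero = - sumℚ c'
  full (suc j) = c' j
  eqs : ∀ i → hatSum (w ∷ ws) full i ≡ 0ℚ
  eqs zero = trans (cong₂ _+_ (ℚP.*-identityʳ (- sumℚ c')) (sum-*1 c')) (ℚP.+-inverseˡ (sumℚ c'))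
  eqs (suc i) = trans (solve 3 (λ s w t → (:- s) :* w :+ t := t :- w :* s) refl (sumℚ c') (toℚ (w i))
                        (sumℚ (λ j → c' j * toℚ (lookup ws j i))))
    (trans (sym (translated-sum w ws c' i)) (trans (sym (proj₁ (proj₂ lowered) (λ v → toℚ (v i)))) (e i)))

-- A certificate of independence by biorthogonal functionals. It yields coordinates explicitly, so
-- dependence of a further point can be decided.
DualSystem : List (Pt n) → Set
DualSystem {n} bs = Σ (Fin (length bs) → QPt (suc n)) λ w →
  (∀ i → w i ∙ hat (lookup bs i) ≡ 1ℚ) × (∀ i j → i ≢ j → w i ∙ hat (lookup bs j) ≡ 0ℚ)

-- The double annihilator, which for finitely many vectors is their span; `spanned⇒expansion`
-- recovers coefficients from a dual system.
Spanned : List (Pt n) → Pt n → Set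
Spanned bs v = ∀ u → (∀ b → b ∈ bs → u ∙ hat b ≡ 0ℚ) → u ∙ hat v ≡ 0ℚ

Expansion : (bs : List (Pt n)) → DualSystem bs → Pt n → Set
Expansion bs (w , _) v = ∀ k → hat v k ≡ hatSum bs (λ j → w j ∙ hat v) k

module _ (bs : List (Pt n)) (D : DualSystem bs) where
  private
    w = proj₁ D

  ∙-expansion : ∀ u v → Expansion bs D v → u ∙ hat v ≡ sumℚ (λ j → (w j ∙ hat v) * (u ∙ hat (lookup bs j)))
  ∙-expansion u v e = trans (∙-congʳ u e) (∙-hatSum u bs (λ j → w j ∙ hat v))

  expansion⇒spanned : ∀ v → Expansion bs D v → Spanned bs v
  expansion⇒spanned v e u u≡0 = trans (∙-expansion u v e)
    (sum-≡0 (λ j → trans (cong ((w j ∙ hat v) *_) (u≡0 _ (∈-lookup j))) (ℚP.*-zeroʳ (w j ∙ hat v))))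

  -- Row `k` of the projection `1 - Σ bⱼ wⱼ`. Every row kills the `bⱼ`, and a vector killed by all
  -- rows is in their span.
  residual : Fin (suc n) → QPt (suc n)
  residual k = basis k ⊖ (λ m → sumℚ (λ j → w j m * hat (lookup bs j) k))

  residual-∙ : ∀ k x → residual k ∙ x ≡ x k - sumℚ (λ j → (w j ∙ x) * hat (lookup bs j) k)
  residual-∙ k x = trans (∙-⊖ˡ (basis k) (λ m → sumℚ (λ j → w j m * hat (lookup bs j) k)) x) (cong₂ _-_ (basis-∙ k x) (begin
    sumℚ (λ m → sumℚ (λ j → w j m * b j) * x m)      ≡⟨ sum-cong (λ m → trans (ℚP.*-comm (sumℚ (λ j → w j m * b j)) (x m)) (sym (sum-* (x m) (λ j → w j m * b j)))) ⟩
    sumℚ (λ m → sumℚ (λ j → x m * (w j m * b j)))    ≡⟨ sum-swap (λ m j → x m * (w j m * b j)) ⟩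
    sumℚ (λ j → sumℚ (λ m → x m * (w j m * b j)))    ≡⟨ sum-cong (λ j → sum-cong (λ m → rot (x m) (w j m) (b j))) ⟩
    sumℚ (λ j → sumℚ (λ m → b j * (w j m * x m)))    ≡⟨ sum-cong (λ j → trans (sum-* (b j) (λ m → w j m * x m)) (ℚP.*-comm (b j) (w j ∙ x))) ⟩
    sumℚ (λ j → (w j ∙ x) * b j) ∎))
    where
    open ≡-Reasoning
    b = λ j → hat (lookup bs j) k
    rot : ∀ x w b → x * (w * b) ≡ b * (w * x)
    rot = solve 3 (λ x w b → x :* (w :* b) := b :* (w :* x)) refl

  residual-lookup : ∀ k i → residual k ∙ hat (lookup bs i) ≡ 0ℚ
  residual-lookup k i = trans (residual-∙ k (hat (lookup bs i)))
    (trans (cong (λ z → hat (lookup bs i) k - z) (trans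
      (sum-single i _ (λ j j≢i → trans (cong (_* hat (lookup bs j) k) (proj₂ (proj₂ D) j i j≢i)) (ℚP.*-zeroˡ (hat (lookup bs j) k))))
      (trans (cong (_* hat (lookup bs i) k) (proj₁ (proj₂ D) i)) (ℚP.*-identityˡ (hat (lookup bs i) k)))))
      (ℚP.+-inverseʳ (hat (lookup bs i) k)))

  residual≡0⇒expansion : ∀ v → (∀ k → residual k ∙ hat v ≡ 0ℚ) → Expansion bs D v
  residual≡0⇒expansion v e k = trans
    (solve 2 (λ x y → x := (x :- y) :+ y) refl (hat v k) (hatSum bs (λ j → w j ∙ hat v) k))
    (trans (cong (_+ hatSum bs (λ j → w j ∙ hat v) k) (trans (sym (residual-∙ k (hat v))) (e k))) (ℚP.+-identityˡ (hatSum bs (λ j → w j ∙ hat v) k)))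

  residual-∈ : ∀ k b → b ∈ bs → residual k ∙ hat b ≡ 0ℚ
  residual-∈ k b b∈ = subst (λ b → residual k ∙ hat b ≡ 0ℚ) (sym (lookup-index b∈)) (residual-lookup k (index b∈))

  spanned⇒expansion : ∀ v → Spanned bs v → Expansion bs D v
  spanned⇒expansion v s = residual≡0⇒expansion v (λ k → s (residual k) (residual-∈ k))

  dual⇒hatIndep : HatIndep bs
  dual⇒hatIndep c e i = begin
    c i                                            ≡⟨ sym (ℚP.*-identityʳ (c i)) ⟩
    c i * 1ℚ                                       ≡⟨ cong (c i *_) (sym (proj₁ (proj₂ D) i)) ⟩
    c i * (w i ∙ hat (lookup bs i))                ≡⟨ sym (sum-single i (λ j → c j * (w i ∙ hat (lookup bs j)))
                                                       (λ j j≢i → trans (cong (c j *_) (proj₂ (proj₂ D) i j (j≢i ∘ sym))) (ℚP.*-zeroʳ (c j)))) ⟩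
    sumℚ (λ j → c j * (w i ∙ hat (lookup bs j)))   ≡⟨ sym (∙-hatSum (w i) bs c) ⟩
    w i ∙ hatSum bs c                              ≡⟨ ∙-≡0ʳ (w i) e ⟩
    0ℚ ∎
    where open ≡-Reasoning

  -- A Gram-Schmidt step: a residual row that is nonzero at `v` is scaled to the functional dual to
  -- `v`, and each old functional is corrected by a multiple of it so as to vanish at `v`.
  adjoin : ∀ v → Expansion bs D v ⊎ DualSystem (v ∷ bs)
  adjoin v with FinP.all? (λ k → residual k ∙ hat v ℚP.≟ 0ℚ)
  ... | yes all = inj₁ (residual≡0⇒expansion v all)
  ... | no ¬all = inj₂ (w⁺ , ones , zeros)
    where
    k = proj₁ (¬∀⟶∃¬ _ _ (λ k → residual k ∙ hat v ℚP.≟ 0ℚ) ¬all)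
    k≢0 = proj₂ (¬∀⟶∃¬ _ _ (λ k → residual k ∙ hat v ℚP.≟ 0ℚ) ¬all)
    q = proj₁ (inverse (residual k ∙ hat v) k≢0)
    new : QPt (suc n)
    new m = q * residual k m
    new-∙ : ∀ x → new ∙ x ≡ q * (residual k ∙ x)
    new-∙ x = trans (sum-cong (λ m → ℚP.*-assoc q (residual k m) (x m))) (sum-* q (λ m → residual k m * x m))
    new-v : new ∙ hat v ≡ 1ℚ
    new-v = trans (new-∙ (hat v)) (proj₂ (inverse (residual k ∙ hat v) k≢0))
    new-b : ∀ i → new ∙ hat (lookup bs i) ≡ 0ℚ
    new-b i = trans (new-∙ (hat (lookup bs i))) (trans (cong (q *_) (residual-lookup k i)) (ℚP.*-zeroʳ q))
    w⁺ : Fin (suc (length bs)) → QPt (suc n)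
    w⁺ zero = new
    w⁺ (suc i) = lin 1ℚ (w i) (- (w i ∙ hat v)) new
    old-b : ∀ i j → w⁺ (suc i) ∙ hat (lookup bs j) ≡ w i ∙ hat (lookup bs j)
    old-b i j = trans (∙-linˡ 1ℚ (w i) (- (w i ∙ hat v)) new (hat (lookup bs j)))
      (trans (cong (λ z → 1ℚ * (w i ∙ hat (lookup bs j)) + - (w i ∙ hat v) * z) (new-b j))
        (solve 2 (λ x y → con 1ℚ :* x :+ y :* con 0ℚ := x) refl (w i ∙ hat (lookup bs j)) (- (w i ∙ hat v))))
    ones : ∀ i → w⁺ i ∙ hat (lookup (v ∷ bs) i) ≡ 1ℚ
    ones zero = new-v
    ones (suc i) = trans (old-b i i) (proj₁ (proj₂ D) i)
    zeros : ∀ i j → i ≢ j → w⁺ i ∙ hat (lookup (v ∷ bs) j) ≡ 0ℚ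
    zeros zero zero ne = ⊥-elim (ne refl)
    zeros zero (suc j) _ = new-b j
    zeros (suc i) zero _ = trans (∙-linˡ 1ℚ (w i) (- (w i ∙ hat v)) new (hat v))
      (trans (cong (λ z → 1ℚ * (w i ∙ hat v) + - (w i ∙ hat v) * z) new-v)
        (solve 1 (λ x → con 1ℚ :* x :+ (:- x) :* con 1ℚ := con 0ℚ) refl (w i ∙ hat v)))
    zeros (suc i) (suc j) ne = trans (old-b i j) (proj₂ (proj₂ D) i j (λ i≡j → ne (cong suc i≡j)))

hatIndep⇒dual : (ws : List (Pt n)) → HatIndep ws → DualSystem ws
hatIndep⇒dual [] _ = (λ ()) , (λ ()) , λ ()
hatIndep⇒dual (v ∷ ws) indep = case adjoin ws D v of λ
  { (inj₂ D⁺) → D⁺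
  ; (inj₁ e) → ⊥-elim (<⇒≢0 0<1 (trans (solve 0 (con 1ℚ := :- con (- 1ℚ)) refl) (cong -_ (indep (dependency e) (vanishes e) zero)))) }
  where
  tail-indep : HatIndep ws
  tail-indep c e j = indep (λ { zero → 0ℚ ; (suc j) → c j })
    (λ i → trans (cong₂ _+_ (ℚP.*-zeroˡ (hat v i)) (e i)) (ℚP.+-identityˡ 0ℚ)) (suc j)
  D = hatIndep⇒dual ws tail-indep
  dependency : Expansion ws D v → Coeffs (v ∷ ws)
  dependency e zero = - 1ℚ
  dependency e (suc j) = proj₁ D j ∙ hat v
  vanishes : ∀ e i → hatSum (v ∷ ws) (dependency e) i ≡ 0ℚ
  vanishes e i = trans (cong (λ z → - 1ℚ * hat v i + z) (sym (e i)))
    (solve 1 (λ x → con (- 1ℚ) :* x :+ x := con 0ℚ) refl (hat v i))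

-- Greedy extension, started from the empty list to find a basis and from an independent family to
-- compare its length with that of a basis.
extend : (bs : List (Pt n)) → DualSystem bs → (L : List (Pt n)) →
  Σ (List (Pt n)) λ bs' → DualSystem bs' × length bs ℕ.≤ length bs' × (∀ b → b ∈ bs → b ∈ bs') ×
    (∀ b → b ∈ bs' → b ∈ bs ⊎ b ∈ L) × (∀ v → v ∈ L → Spanned bs' v)
extend bs D [] = bs , D , ℕP.≤-refl , (λ _ b∈ → b∈) , (λ _ → inj₁) , λ _ ()
extend bs D (v ∷ L) = case adjoin bs D v of λ
  { (inj₁ e) → let bs' , D' , len , ⊇ , ⊆ , sp = extend bs D L in
      bs' , D' , len , ⊇ ,
      (λ b b∈ → case ⊆ b b∈ of λ { (inj₁ p) → inj₁ p ; (inj₂ p) → inj₂ (there p) }) ,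
      λ { _ (here refl) u u≡0 → expansion⇒spanned bs D v e u (λ b b∈ → u≡0 b (⊇ b b∈)) ; v' (there p) → sp v' p }
  ; (inj₂ D⁺) → let bs' , D' , len , ⊇ , ⊆ , sp = extend (v ∷ bs) D⁺ L in
      bs' , D' , ℕP.<⇒≤ len , (λ b b∈ → ⊇ b (there b∈)) ,
      (λ b b∈ → case ⊆ b b∈ of λ { (inj₁ (here e)) → inj₂ (here e) ; (inj₁ (there p)) → inj₁ p ; (inj₂ p) → inj₂ (there p) }) ,
      λ { _ (here refl) u u≡0 → u≡0 v (⊇ v (here refl)) ; v' (there p) → sp v' p } }

sum-1 : ∀ n → sumℚ {n} (λ _ → 1ℚ) ≡ toℚ (pos n)
sum-1 zero = refl
sum-1 (suc n) = trans (cong (1ℚ +_) (sum-1 n)) (sym (toℚ-+ (pos 1) (pos n)))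

-- With π = Σ bᵢ wᵢ and π' = Σ b'ⱼ w'ⱼ projecting onto the same span, both lengths equal tr(π π').
dual-trace : (bs bs' : List (Pt n)) (D : DualSystem bs) (D' : DualSystem bs') → (∀ b → b ∈ bs → Spanned bs' b) →
  toℚ (pos (length bs)) ≡
  sumℚ (λ i → sumℚ (λ j → (proj₁ D' j ∙ hat (lookup bs i)) * (proj₁ D i ∙ hat (lookup bs' j))))
dual-trace bs bs' D D' sp = trans (sym (sum-1 (length bs))) (sum-cong λ i →
  trans (sym (proj₁ (proj₂ D) i)) (∙-expansion bs' D' (proj₁ D i) (lookup bs i)
    (spanned⇒expansion bs' D' (lookup bs i) (sp _ (∈-lookup i)))))

dual-length : (bs bs' : List (Pt n)) → DualSystem bs → DualSystem bs' →
  (∀ b → b ∈ bs → Spanned bs' b) → (∀ b → b ∈ bs' → Spanned bs b) → length bs ≡ length bs'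
dual-length bs bs' D D' sp sp' = ℤP.+-injective (toℚ-injective {pos (length bs)} {pos (length bs')}
  (trans (dual-trace bs bs' D D' sp) (trans
    (sum-swap (λ i j → (proj₁ D' j ∙ hat (lookup bs i)) * (proj₁ D i ∙ hat (lookup bs' j))))
    (trans (sum-cong (λ j → sum-cong (λ i → ℚP.*-comm (proj₁ D' j ∙ hat (lookup bs i)) (proj₁ D i ∙ hat (lookup bs' j)))))
      (sym (dual-trace bs' bs D' D sp'))))))

IsAffBasis : List (Pt n) → List (Pt n) → Set
IsAffBasis L bs = (∀ b → b ∈ bs → b ∈ L) × HatIndep bs × (∀ v → v ∈ L → Spanned bs v)

affBasis : (L : List (Pt n)) → Σ (List (Pt n)) (IsAffBasis L)
affBasis L = let bs , D , _ , _ , ⊆ , sp = extend [] ((λ ()) , (λ ()) , λ ()) L in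
  bs , (λ b b∈ → case ⊆ b b∈ of λ { (inj₂ p) → p }) , dual⇒hatIndep bs D , sp

-- For maximality, an independent `ws` is extended to a basis within `L`, and bases of the same span
-- have equal length.
affBasis⇒affRank : (L bs : List (Pt n)) → IsAffBasis L bs → AffRank L (length bs)
affBasis⇒affRank L bs (bs⊆L , indep , sp) =
  (bs , All.tabulate (λ {b} → bs⊆L b) , refl , hatIndep⇒affIndep bs indep) , λ ws ws∈ ws-indep →
    let bs' , D' , len , ⊇ , ⊆ , sp' = extend ws (hatIndep⇒dual ws (affIndep⇒hatIndep ws ws-indep)) L
        bs'⊆L = λ b b∈ → case ⊆ b b∈ of λ { (inj₁ p) → All.lookup ws∈ p ; (inj₂ p) → p }
    in subst (length ws ℕ.≤_) (dual-length bs' bs D' (hatIndep⇒dual bs indep)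
         (λ b b∈ → sp b (bs'⊆L b b∈)) (λ b b∈ → sp' b (bs⊆L b b∈))) len

-- A generator outside the span of `ws` could be adjoined, against the maximality of `k`.
affRank⇒affBasis : (L : List (Pt n)) {k : ℕ} → AffRank L k → Σ (List (Pt n)) λ ws → length ws ≡ k × IsAffBasis L ws
affRank⇒affBasis L {k} ((ws , ws∈ , len , indep) , max) = ws , len , (λ b → All.lookup ws∈) , affIndep⇒hatIndep ws indep , λ v v∈ →
  case adjoin ws D v of λ
    { (inj₁ e) → expansion⇒spanned ws D v e
    ; (inj₂ D⁺) → ⊥-elim (ℕP.<-irrefl len
        (max (v ∷ ws) (v∈ ∷ ws∈) (hatIndep⇒affIndep (v ∷ ws) (dual⇒hatIndep (v ∷ ws) D⁺)))) }
  where D = hatIndep⇒dual ws (affIndep⇒hatIndep ws indep)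

affRank-unique : {L : List (Pt n)} {k k' : ℕ} → AffRank L k → AffRank L k' → k ≡ k'
affRank-unique ((ws , ws∈ , len , indep) , max) ((ws' , ws'∈ , len' , indep') , max') =
  ℕP.≤-antisym (subst (ℕ._≤ _) len (max' ws ws∈ indep)) (subst (ℕ._≤ _) len' (max ws' ws'∈ indep'))

-- Codegree against rank, and ranks of skew faces

sumPts : List (Pt n) → Pt n
sumPts [] i = pos 0
sumPts (v ∷ vs) i = v i ℤ.+ sumPts vs i

unitMeas : List A → Meas A
unitMeas = map (1ℚ ,_)

unitMeas-on⁺ : {S : A → Set} (L : List A) → (∀ a → a ∈ L → S a) → unitMeas L on⁺ S
unitMeas-on⁺ [] _ = []
unitMeas-on⁺ (a ∷ L) s = (0≤1 , s a (here refl)) ∷ unitMeas-on⁺ L (λ a a∈ → s a (there a∈))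

unitMeas-nonneg≡0 : {f : A → ℚ} (L : List A) → (∀ a → a ∈ L → 0ℚ ≤ f a) → ∫ f (unitMeas L) ≡ 0ℚ → ∀ a → a ∈ L → f a ≡ 0ℚ
unitMeas-nonneg≡0 {f = f} L 0≤f e a a∈ = trans (sym (ℚP.*-identityˡ (f a)))
  (All.lookup (∫-nonneg≡0 (unitMeas-on⁺ L (λ _ p → p)) 0≤f e) (∈-map⁺ (1ℚ ,_) a∈))

sumPts-barycentre : (ws : List (Pt n)) → ∀ i → barycentre hat (unitMeas ws) i ≡ toQPt (ext (sumPts ws) (pos (length ws))) i
sumPts-barycentre [] zero = refl
sumPts-barycentre [] (suc i) = refl
sumPts-barycentre (v ∷ ws) zero = trans (cong₂ _+_ (ℚP.*-identityˡ 1ℚ) (sumPts-barycentre ws zero)) (sym (toℚ-+ (pos 1) (pos (length ws))))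
sumPts-barycentre (v ∷ ws) (suc i) = trans (cong₂ _+_ (ℚP.*-identityˡ (toℚ (v i))) (sumPts-barycentre ws (suc i))) (sym (toℚ-+ (v i) (sumPts ws i)))

-- A nonnegative functional that vanishes at the sum vanishes at each basis point, and these span
-- `L`.
basis-sum-int : (L ws : List (Pt n)) → IsAffBasis L ws → Int L (toQPt (ext (sumPts ws) (pos (length ws))))
basis-sum-int L ws (ws⊆L , _ , sp) = cone , λ u 0≤u u≡0 v v∈ → sp v v∈ u λ b b∈ →
    unitMeas-nonneg≡0 ws (λ a a∈ → 0≤u a (ws⊆L a a∈)) (trans (sym (cone-∙ u cone)) u≡0) b b∈
  where
  cone : Cone L _
  cone = unitMeas ws , unitMeas-on⁺ ws ws⊆L , sumPts-barycentre ws

-- The sum of an affine basis is an interior lattice point with the rank as its height. The bound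
-- makes the truncated subtraction in `IsDeg` a genuine one.
codeg≤rank : {L : List (Pt n)} {k c : ℕ} → AffRank L k → IsCodeg L c → c ℕ.≤ k
codeg≤rank _ (inj₁ (_ , refl)) = ℕ.z≤n
codeg≤rank {L = L} {k} {c} rank (inj₂ (1≤c , (x , intx) , min)) with affRank⇒affBasis L rank
... | ws , refl , basis-ws = ℕP.≮⇒≥ λ k<c → min (length ws) 1≤k k<c
    (sumPts ws , int⇒scale-relInt L (length ws) 1≤k (sumPts ws) (basis-sum-int L ws basis-ws))
  where
  1≤k : 1 ℕ.≤ length ws
  1≤k = ℕP.n≢0⇒n>0 λ k≡0 → <⇒≢0 (0<toℚ 1≤c) (cone-empty
    (int-height≡0 (basis-sum-int L ws basis-ws) (cong (λ k → toℚ (pos k)) k≡0)) (proj₁ (scale-relInt⇒int L c 1≤c x intx)) zero)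

Annihilated : List (Pt n) → QPt (suc n) → Set
Annihilated F x = ∀ u → (∀ v → v ∈ F → u ∙ hat v ≡ 0ℚ) → u ∙ x ≡ 0ℚ

hatSum-annihilated : {F : List (Pt n)} (bs : List (Pt n)) (c : Coeffs bs) → (∀ b → b ∈ bs → b ∈ F) → Annihilated F (hatSum bs c)
hatSum-annihilated bs c bs⊆ u u≡0 = trans (∙-hatSum u bs c)
  (sum-≡0 (λ j → trans (cong (c j *_) (u≡0 _ (bs⊆ _ (∈-lookup j)))) (ℚP.*-zeroʳ (c j))))

-- The linear spans of the two cones meet only in 0, that is, the faces are skew; this is what makes
-- their ranks add up.
Direct : List (Pt n) → List (Pt n) → Set
Direct F G = ∀ x y → Annihilated F x → Annihilated G y → (∀ i → x i + y i ≡ 0ℚ) → ∀ i → x i ≡ 0ℚ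

affBasis-++ : {L F G : List (Pt n)} (bF bG : List (Pt n)) → IsAffBasis F bF → IsAffBasis G bG →
  (∀ v → v ∈ F → v ∈ L) → (∀ v → v ∈ G → v ∈ L) → (∀ v → v ∈ L → v ∈ F ⊎ v ∈ G) → Direct F G →
  IsAffBasis L (bF ++ bG)
affBasis-++ {L = L} bF bG (bF⊆ , indepF , spF) (bG⊆ , indepG , spG) F⊆L G⊆L cover direct = ⊆ , indep , sp
  where
  ⊆ : ∀ b → b ∈ bF ++ bG → b ∈ L
  ⊆ b b∈ = case ∈-++⁻ bF b∈ of λ { (inj₁ p) → F⊆L b (bF⊆ b p) ; (inj₂ p) → G⊆L b (bG⊆ b p) }
  sp : ∀ v → v ∈ L → Spanned (bF ++ bG) v
  sp v v∈ u u≡0 = case cover v v∈ of λ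
    { (inj₁ p) → spF v p u (λ b b∈ → u≡0 b (∈-++⁺ˡ b∈))
    ; (inj₂ p) → spG v p u (λ b b∈ → u≡0 b (∈-++⁺ʳ bF b∈)) }
  indep : HatIndep (bF ++ bG)
  indep c e = z (indepF cF x≡0) (indepG cG y≡0)
    where
    cF = proj₁ (++-coeffs bF bG c)
    cG = proj₁ (proj₂ (++-coeffs bF bG c))
    split = proj₁ (proj₂ (proj₂ (++-coeffs bF bG c)))
    z = proj₂ (proj₂ (proj₂ (++-coeffs bF bG c)))
    x+y≡0 : ∀ i → hatSum bF cF i + hatSum bG cG i ≡ 0ℚ
    x+y≡0 i = trans (sym (split (λ v → hat v i))) (e i)
    x≡0 : ∀ i → hatSum bF cF i ≡ 0ℚ
    x≡0 = direct (hatSum bF cF) (hatSum bG cG) (hatSum-annihilated bF cF bF⊆) (hatSum-annihilated bG cG bG⊆) x+y≡0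
    y≡0 : ∀ i → hatSum bG cG i ≡ 0ℚ
    y≡0 i = trans (sym (ℚP.+-identityˡ (hatSum bG cG i))) (trans (cong (_+ hatSum bG cG i) (sym (x≡0 i))) (x+y≡0 i))

affRank-++ : {L F G : List (Pt n)} →
  (∀ v → v ∈ F → v ∈ L) → (∀ v → v ∈ G → v ∈ L) → (∀ v → v ∈ L → v ∈ F ⊎ v ∈ G) → Direct F G →
  Σ ℕ λ kL → Σ ℕ λ kF → Σ ℕ λ kG → AffRank L kL × AffRank F kF × AffRank G kG × kF ℕ.+ kG ≡ kL
affRank-++ {L = L} {F} {G} F⊆L G⊆L cover direct =
  let bF , basisF = affBasis F
      bG , basisG = affBasis G
  in length (bF ++ bG) , length bF , length bG ,
     affBasis⇒affRank L (bF ++ bG) (affBasis-++ bF bG basisF basisG F⊆L G⊆L cover direct) ,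
     affBasis⇒affRank F bF basisF , affBasis⇒affRank G bG basisG , sym (length-++ bF)

-- Bounds, small perturbations and finite searches

upper-bound : (f : A → ℚ) (L : List A) → Σ ℚ λ K → ∀ a → a ∈ L → f a ≤ K
upper-bound f [] = 0ℚ , λ _ ()
upper-bound f (a ∷ L) = let K , b = upper-bound f L in
  f a ⊔ K , λ { _ (here refl) → ℚP.p≤p⊔q (f a) K ; a' (there p) → ≤-trans (b a' p) (ℚP.p≤q⊔p (f a) K) }

0<⊓ : ∀ {p q} → 0ℚ < p → 0ℚ < q → 0ℚ < p ⊓ q
0<⊓ {p} {q} 0<p 0<q = case ℚP.⊓-sel p q of λ
  { (inj₁ e) → subst (0ℚ <_) (sym e) 0<p ; (inj₂ e) → subst (0ℚ <_) (sym e) 0<q }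

-- For a single `a`, the quotient of `f a` by the maximum of `g a` and 1 will do; the 1 keeps the
-- divisor positive whatever the sign of `g a`. Allowing every smaller `δ` lets the minimum serve
-- the whole list.
room : (f g : A → ℚ) (L : List A) → (∀ a → a ∈ L → 0ℚ < f a) →
  Σ ℚ λ ε → 0ℚ < ε × (∀ δ → 0ℚ ≤ δ → δ ≤ ε → ∀ a → a ∈ L → 0ℚ ≤ f a + (- δ) * g a)
room f g [] _ = 1ℚ , 0<1 , λ _ _ _ _ ()
room f g (a ∷ L) 0<f =
  let ε , 0<ε , h = room f g L (λ b b∈ → 0<f b (there b∈))
  in ε ⊓ εₐ , 0<⊓ 0<ε 0<εₐ , λ
    { δ 0≤δ δ≤ _ (here refl) → fits δ 0≤δ (≤-trans δ≤ (ℚP.p⊓q≤q ε εₐ))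
    ; δ 0≤δ δ≤ b (there b∈) → h δ 0≤δ (≤-trans δ≤ (ℚP.p⊓q≤p ε εₐ)) b b∈ }
  where
  K = g a ⊔ 1ℚ
  0<K : 0ℚ < K
  0<K = ℚP.<-≤-trans 0<1 (ℚP.p≤q⊔p (g a) 1ℚ)
  K⁻¹ = proj₁ (inverse⁺ K 0<K)
  K⁻¹K = proj₂ (proj₂ (inverse⁺ K 0<K))
  εₐ = f a * K⁻¹
  0<εₐ : 0ℚ < εₐ
  0<εₐ = ≤∧≢⇒0< (0≤* (<⇒≤ (0<f a (here refl))) (<⇒≤ (proj₁ (proj₂ (inverse⁺ K 0<K)))))
    (λ e → <⇒≢0 (proj₁ (proj₂ (inverse⁺ K 0<K))) (*≡0⇒≡0 (<⇒≢0 (0<f a (here refl))) e))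
  fits : ∀ δ → 0ℚ ≤ δ → δ ≤ εₐ → 0ℚ ≤ f a + (- δ) * g a
  fits δ 0≤δ δ≤ = subst (0ℚ ≤_) regroup (0≤+ (0≤* 0≤δ (0≤-diff (ℚP.p≤p⊔q (g a) 1ℚ))) (0≤* (0≤-diff δ≤) (<⇒≤ 0<K)))
    where
    regroup : δ * (K - g a) + (εₐ - δ) * K ≡ f a + (- δ) * g a
    regroup = trans (solve 5 (λ d k g f i → d :* (k :- g) :+ (f :* i :- d) :* k := f :* (i :* k) :+ (:- d) :* g) refl δ K (g a) (f a) K⁻¹)
      (trans (cong (λ z → f a * z + (- δ) * g a) K⁻¹K) (cong (_+ (- δ) * g a) (ℚP.*-identityʳ (f a))))

-- The atom found has nonzero weight, so a nonnegative `g` of integral 0 must vanish at it.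
some-atom : {S : A → Set} {W : Meas A} → W on⁺ S → (f : A → ℚ) → ∫ f W ≢ 0ℚ →
  Σ A λ a → S a × (∀ g → (∀ b → S b → 0ℚ ≤ g b) → ∫ g W ≡ 0ℚ → g a ≡ 0ℚ)
some-atom [] f ne = ⊥-elim (ne refl)
some-atom {A} {S} {(w , a) ∷ W} ((0≤w , s) ∷ ss) f ne = go (w ℚP.≟ 0ℚ)
  where
  go : Dec (w ≡ 0ℚ) → Σ A λ a' → S a' × (∀ g → (∀ b → S b → 0ℚ ≤ g b) → w * g a + ∫ g W ≡ 0ℚ → g a' ≡ 0ℚ)
  go (no w≢0) = a , s , λ g 0≤g e → *≡0⇒≡0 w≢0 (proj₁ (+≡0⇒≡0 (0≤* 0≤w (0≤g a s)) (∫-nonneg ss 0≤g) e))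
  go (yes w≡0) = let a' , s' , h = some-atom ss f (λ e → ne (trans (cong₂ _+_ (trans (cong (_* f a) w≡0) (ℚP.*-zeroˡ (f a))) e) (ℚP.+-identityˡ 0ℚ))) in
    a' , s' , λ g 0≤g e → h g 0≤g (proj₂ (+≡0⇒≡0 (0≤* 0≤w (0≤g a s)) (∫-nonneg ss 0≤g) e))

search : {S T : A → Set} (L : List A) → (∀ a → a ∈ L → S a ⊎ T a) → (Σ A λ a → a ∈ L × S a) ⊎ (∀ a → a ∈ L → T a)
search [] _ = inj₂ λ _ ()
search (a ∷ L) h = case h a (here refl) of λ
  { (inj₁ s) → inj₁ (a , here refl , s)
  ; (inj₂ t) → case search L (λ b b∈ → h b (there b∈)) of λ
    { (inj₁ (b , b∈ , s)) → inj₁ (b , there b∈ , s)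
    ; (inj₂ ts) → inj₂ λ { _ (here refl) → t ; b (there b∈) → ts b b∈ } } }

negPt : Pt n → Pt n
negPt x i = ℤ.- x i

negPt-∙ : (x : Pt n) (y : QPt n) → toQPt (negPt x) ∙ y ≡ - (toQPt x ∙ y)
negPt-∙ x y = trans (sum-cong (λ i → trans (cong (_* y i) (toℚ-neg (x i)))
    (solve 2 (λ x y → (:- x) :* y := (con (- 1ℚ)) :* (x :* y)) refl (toℚ (x i)) (y i))))
  (trans (sum-* (- 1ℚ) (λ i → toℚ (x i) * y i)) (solve 1 (λ x → con (- 1ℚ) :* x := :- x) refl (toQPt x ∙ y)))

-- A point x of the cone of Pd as a functional on the hats, which lie in one dimension more.
pad : Pt n → Pt (suc n)
pad x = ext x (pos 0)

pad-∙ : (x v : Pt n) (j : ℤ) → toQPt (pad x) ∙ toQPt (ext v j) ≡ toQPt x ∙ toQPt v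
pad-∙ x v j = trans (cong (_+ (toQPt x ∙ toQPt v)) (ℚP.*-zeroˡ (toℚ j))) (ℚP.+-identityˡ (toQPt x ∙ toQPt v))

ext-η : (x : Pt (suc n)) (a : ℤ) → x zero ≡ a → ∀ i → toQPt x i ≡ toQPt (ext (λ i → x (suc i)) a) i
ext-η x a e zero = cong toℚ e
ext-η x a e (suc i) = refl

natural : (z : ℤ) → 0ℚ ≤ toℚ z → Σ ℕ λ k → z ≡ pos k
natural z 0≤z = ℤ.∣ z ∣ , sym (ℤP.0≤i⇒+∣i∣≡i (toℚ-cancel {pos 0} {z} 0≤z))

-- The cone over P and the generators of its dual

module Setup (d : ℕ) (P : List (Pt d)) (r : ℕ) (1≤r : 1 ℕ.≤ r) (m : Pt d)
  (int-M : Int P (toQPt (ext m (pos r))))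
  (Pd : List (Pt (suc d))) (dual : ∀ y → InConv Pd y ⇔ InDual P r m y) where

  M : Pt (suc d)
  M = ext m (pos r)

  infix 8 _⟨_⟩
  _⟨_⟩ : Pt (suc d) → Pt d → ℚ
  y ⟨ p ⟩ = toQPt y ∙ hat p

  cone-M : Cone P (toQPt M)
  cone-M = proj₁ int-M

  Pd-dual : ∀ v → v ∈ Pd → InDual P r m (toQPt v)
  Pd-dual v v∈ = Equivalence.to (dual (toQPt v)) (vertex∈conv Pd v∈)

  Pd-nonneg : ∀ v p → v ∈ Pd → p ∈ P → 0ℚ ≤ v ⟨ p ⟩
  Pd-nonneg v p v∈ p∈ = All.lookup (proj₁ (Pd-dual v v∈)) p∈

  Pd-M : ∀ v → v ∈ Pd → toQPt v ∙ toQPt M ≡ 1ℚ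
  Pd-M v v∈ = proj₂ (Pd-dual v v∈)

  -- P^× is bounded, so it contains no line direction t.
  vanish-P : ∀ t → (∀ p → p ∈ P → t ∙ hat p ≡ 0ℚ) → ∀ i → t i ≡ 0ℚ
  vanish-P t t≡0 = go (t ∙ t ℚP.≟ 0ℚ)
    where
    go : Dec (t ∙ t ≡ 0ℚ) → ∀ i → t i ≡ 0ℚ
    go (yes e) = self∙≡0 e
    go (no tt≢0) = ⊥-elim (ℚP.<-irrefl refl (ℚP.<-≤-trans K<K+1 K+1≤K))
      where
      K = proj₁ (upper-bound (λ v → t ∙ toQPt v) Pd)
      ρ = proj₁ (inverse⁺ (toℚ (pos r)) (0<toℚ 1≤r))
      0<ρ = proj₁ (proj₂ (inverse⁺ (toℚ (pos r)) (0<toℚ 1≤r)))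
      ρr = proj₂ (proj₂ (inverse⁺ (toℚ (pos r)) (0<toℚ 1≤r)))
      s = proj₁ (inverse (t ∙ t) tt≢0)
      -- `ρ * height` already satisfies the equation at `M`; `c` moves it along `t` until `t ∙ y`
      -- exceeds the bound `K` by 1.
      c = (K + 1ℚ - ρ * (t ∙ height)) * s
      y = lin ρ height c t
      y-dual : InDual P r m y
      y-dual = All.tabulate (λ {p} p∈ → subst (0ℚ ≤_) (sym (trans (∙-linˡ ρ height c t (hat p))
            (trans (cong₂ (λ a b → ρ * a + c * b) (height-hat p) (t≡0 p p∈))
              (solve 2 (λ r c → r :* con 1ℚ :+ c :* con 0ℚ := r) refl ρ c)))) (<⇒≤ 0<ρ)) ,
        trans (∙-linˡ ρ height c t (toQPt M)) (trans (cong₂ (λ a b → ρ * a + c * b) (basis-∙ zero (toQPt M)) (cone-≡0 t cone-M t≡0))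
          (trans (solve 3 (λ r k c → r :* k :+ c :* con 0ℚ := r :* k) refl ρ (toℚ (pos r)) c) ρr))
      ty : t ∙ y ≡ K + 1ℚ
      ty = trans (∙-linʳ t ρ height c t) (trans
        (solve 4 (λ x k s t → x :+ ((k :- x) :* s) :* t := x :+ (k :- x) :* (s :* t)) refl (ρ * (t ∙ height)) (K + 1ℚ) s (t ∙ t))
        (trans (cong (λ z → ρ * (t ∙ height) + (K + 1ℚ - ρ * (t ∙ height)) * z) (proj₂ (inverse (t ∙ t) tt≢0)))
          (solve 2 (λ x k → x :+ (k :- x) :* con 1ℚ := k) refl (ρ * (t ∙ height)) (K + 1ℚ))))
      K+1≤K : K + 1ℚ ≤ K
      K+1≤K =
        let W , W∈ , mass , e = conv⇒meas (Equivalence.from (dual y) y-dual)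
            ≤K = ∫-nonneg {f = λ v → K - t ∙ toQPt v} W∈ (λ v v∈ → 0≤-diff (proj₂ (upper-bound (λ v → t ∙ toQPt v) Pd) v v∈))
        in ≤-by ≤K (sym (trans (∫-sub (λ _ → K) (λ v → t ∙ toQPt v) W) (cong₂ _-_
             (trans (∫-const K W) (trans (cong (K *_) mass) (ℚP.*-identityʳ K)))
             (trans (sym (∙-barycentre t toQPt W)) (trans (∙-congʳ t e) ty)))))
      K<K+1 : K < K + 1ℚ
      K<K+1 = subst (_< K + 1ℚ) (ℚP.+-identityʳ K) (ℚP.+-monoʳ-< K 0<1)

  M-nonneg : ∀ t → (∀ p → p ∈ P → 0ℚ ≤ t ∙ hat p) → 0ℚ ≤ t ∙ toQPt M
  M-nonneg t = cone-nonneg t cone-M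

  M-vanish : ∀ t → (∀ p → p ∈ P → 0ℚ ≤ t ∙ hat p) → t ∙ toQPt M ≡ 0ℚ → ∀ i → t i ≡ 0ℚ
  M-vanish t 0≤t e = vanish-P t (proj₂ int-M t 0≤t e)

  -- Dividing by the value at `M` gives a point of `P^×`. If that value is 0, then `y` itself is 0
  -- because `M` is interior.
  cone-Pd : ∀ y → (∀ p → p ∈ P → 0ℚ ≤ y ∙ hat p) → ConeOf toQPt Pd y
  cone-Pd y 0≤y = go (y ∙ toQPt M ℚP.≟ 0ℚ)
    where
    go : Dec (y ∙ toQPt M ≡ 0ℚ) → ConeOf toQPt Pd y
    go (yes e) = [] , [] , λ i → sym (M-vanish y 0≤y e i)
    go (no s≢0) =
      let s = y ∙ toQPt M
          q , 0<q , qs = inverse⁺ s (≤∧≢⇒0< (M-nonneg y 0≤y) s≢0)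
          scaled : ∀ x → (λ i → q * y i) ∙ x ≡ q * (y ∙ x)
          scaled x = trans (sum-cong (λ i → ℚP.*-assoc q (y i) (x i))) (sum-* q (λ i → y i * x i))
          W , W∈ , _ , e = conv⇒meas (Equivalence.from (dual (λ i → q * y i))
            (All.tabulate (λ {p} p∈ → subst (0ℚ ≤_) (sym (scaled (hat p))) (0≤* (<⇒≤ 0<q) (0≤y p p∈))) ,
             trans (scaled (toQPt M)) qs))
      in rescale s W , rescale-on⁺ (M-nonneg y 0≤y) W∈ , λ i →
        trans (∫-rescale s (λ v → toQPt v i) W) (trans (cong (s *_) (e i))
          (trans (solve 3 (λ s q y → s :* (q :* y) := (q :* s) :* y) refl s q (y i)) (trans (cong (_* y i) qs) (ℚP.*-identityˡ (y i)))))

  -- The height is 1 on every hat, so it is interior to the dual cone and stays in it after a small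
  -- move in any direction.
  shrink : ∀ y → Σ ℚ λ ε → 0ℚ < ε × (∀ p → p ∈ P → 0ℚ ≤ lin 1ℚ height (- ε) y ∙ hat p)
  shrink y =
    let ε , 0<ε , h = room (λ _ → 1ℚ) (λ p → y ∙ hat p) P (λ _ _ → 0<1)
    in ε , 0<ε , λ p p∈ → subst (0ℚ ≤_) (sym (trans (∙-linˡ 1ℚ height (- ε) y (hat p))
         (cong (λ z → z + (- ε) * (y ∙ hat p)) (trans (ℚP.*-identityˡ (height ∙ hat p)) (height-hat p))))) (h ε (<⇒≤ 0<ε) ≤-refl p p∈)

  -- The height is a combination of all the generators of P^× with positive coefficients.
  abstract
    height-strict : Σ (ConeOf toQPt Pd height) λ k → ∀ (f : Pt (suc d) → ℚ) → (∀ v → v ∈ Pd → 0ℚ ≤ f v) →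
      ∫ f (proj₁ k) ≡ 0ℚ → ∀ v → v ∈ Pd → f v ≡ 0ℚ
    height-strict =
      let S = barycentre toQPt (unitMeas Pd)
          -- `height - ε S` is still a combination of `Pd`; adding `ε S` back leaves weight at least
          -- `ε` on every generator. The test function `f` may be any function, not only a linear
          -- one, so it can later be cut off to part of the generators.
          ε , 0<ε , 0≤ = shrink S
          W , W∈ , e = cone-Pd (lin 1ℚ height (- ε) S) 0≤
          U∈ = unitMeas-on⁺ Pd (λ _ p → p)
          κ = rescale ε (unitMeas Pd) ++ W
          ∫κ : ∀ (f : Pt (suc d) → ℚ) → ∫ f κ ≡ ε * ∫ f (unitMeas Pd) + ∫ f W
          ∫κ f = trans (∫-++ f (rescale ε (unitMeas Pd)) W) (cong (_+ ∫ f W) (∫-rescale ε f (unitMeas Pd)))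
      in (κ , AllP.++⁺ (rescale-on⁺ (<⇒≤ 0<ε) U∈) W∈ ,
           λ i → trans (∫κ (λ v → toQPt v i)) (trans (cong (ε * S i +_) (e i))
             (solve 3 (λ e s h → e :* s :+ (con 1ℚ :* h :+ (:- e) :* s) := h) refl ε (S i) (height {d} i)))) ,
         λ f 0≤f e0 → unitMeas-nonneg≡0 Pd 0≤f (*≡0⇒≡0 (<⇒≢0 0<ε) (proj₁ (+≡0⇒≡0
           (0≤* (<⇒≤ 0<ε) (∫-nonneg U∈ 0≤f)) (∫-nonneg W∈ 0≤f) (trans (sym (∫κ f)) e0))))

  height-cone : ConeOf toQPt Pd height
  height-cone = proj₁ height-strict

  -- Both the height and `height - ε s` are combinations of `Pd`, so `s` vanishes at both; the
  -- difference of the two values is `ε (s ∙ s)`.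
  vanish-Pd : ∀ s → (∀ v → v ∈ Pd → s ∙ toQPt v ≡ 0ℚ) → ∀ i → s i ≡ 0ℚ
  vanish-Pd s s≡0 =
    let ε , 0<ε , 0≤ = shrink s
        e = trans (sym (∙-linʳ s 1ℚ height (- ε) s)) (cone-≡0 s (cone-Pd (lin 1ℚ height (- ε) s) 0≤) s≡0)
    in self∙≡0 (*≡0⇒≡0 (<⇒≢0 0<ε) (trans
         (solve 3 (λ h e t → e :* t := con 1ℚ :* h :- (con 1ℚ :* h :+ (:- e) :* t)) refl (s ∙ height) ε (s ∙ s))
         (trans (cong₂ (λ a b → 1ℚ * a - b) (cone-≡0 s height-cone s≡0) e) (solve 0 (con 1ℚ :* con 0ℚ :- con 0ℚ := con 0ℚ) refl))))

  -- The first coordinate of `s` is its pairing with the height, a strictly positive combination of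
  -- `Pd`.
  height-least : ∀ s → (∀ v → v ∈ Pd → 0ℚ ≤ toQPt v ∙ s) → 0ℚ ≤ s zero × (s zero ≡ 0ℚ → ∀ i → s i ≡ 0ℚ)
  height-least s 0≤s = subst (0ℚ ≤_) s∙height (∫-nonneg (proj₁ (proj₂ height-cone)) 0≤s') , λ s₀ →
      vanish-Pd s (λ v v∈ → proj₂ height-strict (λ v → s ∙ toQPt v) 0≤s' (trans s∙height s₀) v v∈)
    where
    0≤s' : ∀ v → v ∈ Pd → 0ℚ ≤ s ∙ toQPt v
    0≤s' v v∈ = subst (0ℚ ≤_) (∙-comm (toQPt v) s) (0≤s v v∈)
    s∙height : ∫ (λ v → s ∙ toQPt v) (proj₁ height-cone) ≡ s zero
    s∙height = trans (sym (cone-∙ s height-cone)) (trans (∙-comm s height) (basis-∙ zero s))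

  dominates⇒least : ∀ {X : Pt d} {k : ℕ} (x : Pt d) (j : ℕ) →
    (∀ v → v ∈ Pd → toQPt v ∙ toQPt (ext X (pos k)) ≤ toQPt v ∙ toQPt (ext x (pos j))) →
    k ℕ.≤ j × (j ≡ k → ∀ i → x i ≡ X i)
  dominates⇒least {X} {k} x j dom =
    ℤP.drop‿+≤+ (toℚ-cancel {pos k} {pos j} (≤-by (proj₁ least) refl)) ,
    λ { refl i → toℚ-injective {x i} {X i} (trans
        (solve 2 (λ x y → x := (x :- y) :+ y) refl (toℚ (x i)) (toℚ (X i)))
        (trans (cong (_+ toℚ (X i)) (proj₂ least (ℚP.+-inverseʳ (toℚ (pos k))) (suc i))) (ℚP.+-identityˡ (toℚ (X i))))) }
    where
    s = toQPt (ext x (pos j)) ⊖ toQPt (ext X (pos k))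
    least = height-least s λ v v∈ → subst (0ℚ ≤_)
      (sym (∙-⊖ʳ (toQPt v) (toQPt (ext x (pos j))) (toQPt (ext X (pos k))))) (0≤-diff (dom v v∈))

  -- Write `u` as a combination of `Pd`: a generator of positive weight vanishes at every point of
  -- `P` where `u` does.
  detect-P : ∀ u → (∀ p → p ∈ P → 0ℚ ≤ u ∙ hat p) → (Σ (Pt d) λ p → p ∈ P × u ∙ hat p ≢ 0ℚ) →
    Σ (Pt (suc d)) λ v → v ∈ Pd × (∀ p → p ∈ P → u ∙ hat p ≡ 0ℚ → v ⟨ p ⟩ ≡ 0ℚ)
  detect-P u 0≤u (p₀ , p₀∈ , ne) =
    let k = cone-Pd u 0≤u
        along : ∀ p → u ∙ hat p ≡ ∫ (λ v → v ⟨ p ⟩) (proj₁ k)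
        along p = trans (∙-comm u (hat p)) (trans (cone-∙ (hat p) k) (∫-cong (proj₁ k) (λ v → ∙-comm (hat p) (toQPt v))))
        v , v∈ , h = some-atom (proj₁ (proj₂ k)) (λ v → v ⟨ p₀ ⟩) (λ e → ne (trans (along p₀) e))
    in v , v∈ , λ p p∈ e → h (λ v → v ⟨ p ⟩) (λ v v∈ → Pd-nonneg v p v∈ p∈) (trans (sym (along p)) e)

  private
    detect-Pd : ∀ u → (∀ p → p ∈ P → 0ℚ ≤ u ∙ hat p) → (Σ (Pt d) λ p → p ∈ P × u ∙ hat p ≢ 0ℚ) →
      Σ (Σ (Pt (suc d)) (_∈ Pd)) λ ρ → ∀ p → p ∈ P → u ∙ hat p ≡ 0ℚ → proj₁ ρ ⟨ p ⟩ ≡ 0ℚ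
    detect-Pd u 0≤u p = let v , v∈ , h = detect-P u 0≤u p in (v , v∈) , h

    module CoreP = Core P m r {R = Σ (Pt (suc d)) (_∈ Pd)} proj₁ int-M
      (λ (v , v∈) p p∈ → Pd-nonneg v p v∈ p∈) (λ (v , v∈) → Pd-M v v∈)
      (λ x j _ dom → dominates⇒least x j (λ v v∈ → subst (_≤ toQPt v ∙ toQPt (ext x (pos j))) (sym (Pd-M v v∈)) (dom (v , v∈))))
      detect-Pd

  codeg-P : ∀ c → IsCodeg P c → c ≡ r
  codeg-P = CoreP.codeg

  -- The meeting point of both implications, stated on generators alone. `X` and `Y` are the
  -- functionals of the two Cayley joins in homogeneous form, normalised to the values 0 and 1; that
  -- they lie in the cones over `F` and `F*` is proved afterwards.
  record Join (F G : List (Pt d)) (Fs Gs : List (Pt (suc d))) : Set where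
    field
      F⊆ : ∀ p → p ∈ F → p ∈ P
      G⊆ : ∀ p → p ∈ G → p ∈ P
      Fs⊆ : ∀ v → v ∈ Fs → v ∈ Pd
      Gs⊆ : ∀ v → v ∈ Gs → v ∈ Pd
      cover : ∀ p → p ∈ P → p ∈ F ⊎ p ∈ G
      cover* : ∀ v → v ∈ Pd → v ∈ Fs ⊎ v ∈ Gs
      Fs-F : ∀ v p → v ∈ Fs → p ∈ F → v ⟨ p ⟩ ≡ 0ℚ
      Gs-G : ∀ v p → v ∈ Gs → p ∈ G → v ⟨ p ⟩ ≡ 0ℚ
      X : Pt (suc d)
      Fs-X : ∀ v → v ∈ Fs → toQPt v ∙ toQPt X ≡ 0ℚ
      Gs-X : ∀ v → v ∈ Gs → toQPt v ∙ toQPt X ≡ 1ℚ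
      Y : Pt (suc d)
      Y-F : ∀ p → p ∈ F → Y ⟨ p ⟩ ≡ 0ℚ
      Y-G : ∀ p → p ∈ G → Y ⟨ p ⟩ ≡ 1ℚ

  subPt : Pt n → Pt n → Pt n
  subPt x y i = x i ℤ.- y i

  toQPt-sub : (x y : Pt n) → ∀ i → toQPt (subPt x y) i ≡ (toQPt x ⊖ toQPt y) i
  toQPt-sub x y i = toℚ-sub (x i) (y i)

  E : Pt (suc d)
  E = ext (λ _ → pos 0) (pos 1)

  E-hat : ∀ p → E ⟨ p ⟩ ≡ 1ℚ
  E-hat p = trans (∙-hat (toQPt E) p) (trans (cong (1ℚ +_) (sum-≡0 (λ i → ℚP.*-zeroˡ (toℚ (p i))))) (ℚP.+-identityʳ 1ℚ))

  -- `M` pairs to 1 with all of `Pd` and `E` with every hat, so passing to `M - X` and `E - Y`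
  -- exchanges the values 0 and 1. Every fact about `F` and `F*` thereby also holds for `G` and
  -- `G*`.
  swap : ∀ {F G Fs Gs} → Join F G Fs Gs → Join G F Gs Fs
  swap J = record
    { F⊆ = G⊆ ; G⊆ = F⊆ ; Fs⊆ = Gs⊆ ; Gs⊆ = Fs⊆
    ; cover = λ p p∈ → flip (cover p p∈) ; cover* = λ v v∈ → flip (cover* v v∈)
    ; Fs-F = Gs-G ; Gs-G = Fs-F
    ; X = subPt M X
    ; Fs-X = λ v v∈ → trans (sub-X v) (trans (cong₂ _-_ (Pd-M v (Gs⊆ v v∈)) (Gs-X v v∈)) (ℚP.+-inverseʳ 1ℚ))
    ; Gs-X = λ v v∈ → trans (sub-X v) (trans (cong₂ _-_ (Pd-M v (Fs⊆ v v∈)) (Fs-X v v∈)) (solve 0 (con 1ℚ :- con 0ℚ := con 1ℚ) refl))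
    ; Y = subPt E Y
    ; Y-F = λ p p∈ → trans (sub-Y p) (trans (cong₂ _-_ (E-hat p) (Y-G p p∈)) (ℚP.+-inverseʳ 1ℚ))
    ; Y-G = λ p p∈ → trans (sub-Y p) (trans (cong₂ _-_ (E-hat p) (Y-F p p∈)) (solve 0 (con 1ℚ :- con 0ℚ := con 1ℚ) refl)) }
    where
    open Join J
    flip : {S T : Set} → S ⊎ T → T ⊎ S
    flip (inj₁ s) = inj₂ s
    flip (inj₂ t) = inj₁ t
    sub-X : ∀ v → toQPt v ∙ toQPt (subPt M X) ≡ toQPt v ∙ toQPt M - toQPt v ∙ toQPt X
    sub-X v = trans (∙-congʳ (toQPt v) (toQPt-sub M X)) (∙-⊖ʳ (toQPt v) (toQPt M) (toQPt X))
    sub-Y : ∀ p → subPt E Y ⟨ p ⟩ ≡ E ⟨ p ⟩ - Y ⟨ p ⟩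
    sub-Y p = trans (∙-congˡ (hat p) (toQPt-sub E Y)) (∙-⊖ˡ (toQPt E) (toQPt Y) (hat p))

  -- The `F`-part `x` of a decomposition of `M` pairs to 0 with `Fs`. With `Gs` the discarded
  -- `G`-part pairs to 0, which leaves the value 1 of `M`. So `x` and `X` agree on `Pd` and are
  -- equal.
  X-cone : ∀ {F G Fs Gs} (J : Join F G Fs Gs) → Cone F (toQPt (Join.X J))
  X-cone J =
    let V , V' , V∈ , V'∈ , split = ∫-split (proj₁ (proj₂ cone-M)) cover
        x = barycentre hat V
        at : ∀ v → toQPt v ∙ x ≡ ∫ (λ p → v ⟨ p ⟩) V
        at v = ∙-barycentre (toQPt v) hat V
        v∙x : ∀ v → v ∈ Pd → toQPt v ∙ x ≡ toQPt v ∙ toQPt X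
        v∙x v v∈ = case cover* v v∈ of λ
          { (inj₁ v∈Fs) → trans (at v) (trans (∫-≡0 (on⁺⇒on V∈) (λ p p∈ → Fs-F v p v∈Fs p∈)) (sym (Fs-X v v∈Fs)))
          ; (inj₂ v∈Gs) → trans (at v) (trans (sym (ℚP.+-identityʳ (∫ (λ p → v ⟨ p ⟩) V)))
              (trans (cong (∫ (λ p → v ⟨ p ⟩) V +_) (sym (∫-≡0 (on⁺⇒on V'∈) (λ p p∈ → Gs-G v p v∈Gs p∈))))
              (trans (sym (split (λ p → v ⟨ p ⟩))) (trans (sym (cone-∙ (toQPt v) cone-M)) (trans (Pd-M v v∈) (sym (Gs-X v v∈Gs))))))) }
        x≡X = vanish-Pd (x ⊖ toQPt X) (λ v v∈ → trans (∙-comm (x ⊖ toQPt X) (toQPt v)) (trans (∙-⊖ʳ (toQPt v) x (toQPt X))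
          (trans (cong (_- toQPt v ∙ toQPt X) (v∙x v v∈)) (ℚP.+-inverseʳ (toQPt v ∙ toQPt X)))))
    in V , V∈ , λ i → trans (solve 2 (λ x y → x := (x :- y) :+ y) refl (x i) (toQPt X i))
         (trans (cong (_+ toQPt X i) (x≡X i)) (ℚP.+-identityˡ (toQPt X i)))
    where open Join J

  pad-hat : ∀ p v (j : ℤ) → toQPt (pad (ext p (pos 1))) ∙ toQPt (ext v j) ≡ v ⟨ p ⟩
  pad-hat p v j = trans (pad-∙ (ext p (pos 1)) v j) (∙-comm (hat p) (toQPt v))

  nowhere-0 : ∀ v → v ∈ Pd → ¬ (∀ p → p ∈ P → v ⟨ p ⟩ ≡ 0ℚ)
  nowhere-0 v v∈ v≡0 = <⇒≢0 0<1 (trans (sym (Pd-M v v∈)) (cone-≡0 (toQPt v) cone-M v≡0))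

  -- Interior lattice points of the faces in a join

  module JoinFacts {F G : List (Pt d)} {Fs Gs : List (Pt (suc d))} (J : Join F G Fs Gs) where
    open Join J

    coneX : Cone F (toQPt X)
    coneX = X-cone J

    cone-M-X : Cone G (toQPt (subPt M X))
    cone-M-X = X-cone (swap J)

    X+[M-X] : ∀ u → u ∙ toQPt X + u ∙ toQPt (subPt M X) ≡ u ∙ toQPt M
    X+[M-X] u = trans (cong (u ∙ toQPt X +_) (trans (∙-congʳ u (toQPt-sub M X)) (∙-⊖ʳ u (toQPt M) (toQPt X))))
      (solve 2 (λ x y → x :+ (y :- x) := y) refl (u ∙ toQPt X) (u ∙ toQPt M))

    height-X : Σ ℕ λ k → X zero ≡ pos k
    height-X = natural (X zero) (subst (0ℚ ≤_) (basis-∙ zero (toQPt X))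
      (cone-nonneg height coneX (λ p _ → subst (0ℚ ≤_) (sym (height-hat p)) 0≤1)))

    k : ℕ
    k = proj₁ height-X

    X₀ : Pt d
    X₀ i = X (suc i)

    X≗ : ∀ i → toQPt X i ≡ toQPt (ext X₀ (pos k)) i
    X≗ = ext-η X (pos k) (proj₂ height-X)

    restrict : ∀ {y} → ConeOf toQPt Pd y →
      Σ (QPt (suc d)) λ y' → (∀ p → p ∈ F → y' ∙ hat p ≡ y ∙ hat p) × (∀ p → p ∈ G → y' ∙ hat p ≡ 0ℚ)
    restrict {y} c =
      let V , V' , V∈ , V'∈ , split = ∫-split (proj₁ (proj₂ c)) cover*
          y' = barycentre toQPt V'
          at : ∀ p → y' ∙ hat p ≡ ∫ (λ v → v ⟨ p ⟩) V'
          at p = trans (∙-comm y' (hat p)) (trans (∙-barycentre (hat p) toQPt V') (∫-cong V' (λ v → ∙-comm (hat p) (toQPt v))))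
          along : ∀ p → y ∙ hat p ≡ ∫ (λ v → v ⟨ p ⟩) (proj₁ c)
          along p = trans (∙-comm y (hat p)) (trans (cone-∙ (hat p) c) (∫-cong (proj₁ c) (λ v → ∙-comm (hat p) (toQPt v))))
      in y' ,
         (λ p p∈ → trans (at p) (sym (trans (along p) (trans (split (λ v → v ⟨ p ⟩))
           (trans (cong (_+ ∫ (λ v → v ⟨ p ⟩) V') (∫-≡0 (on⁺⇒on V∈) (λ v v∈ → Fs-F v p v∈ p∈))) (ℚP.+-identityˡ (∫ (λ v → v ⟨ p ⟩) V'))))))) ,
         λ p p∈ → trans (at p) (∫-≡0 (on⁺⇒on V'∈) (λ v v∈ → Gs-G v p v∈ p∈))

    -- u is a signed combination of Pd, and dropping the part supported on Fs does not change it on F.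
    extend-by-0 : ∀ u → Σ (QPt (suc d)) λ u' → (∀ p → p ∈ F → u' ∙ hat p ≡ u ∙ hat p) × (∀ p → p ∈ G → u' ∙ hat p ≡ 0ℚ)
    extend-by-0 u =
      let ε , 0<ε , 0≤ = shrink u
          q , qε = inverse ε (<⇒≢0 0<ε)
          h , h-F , h-G = restrict height-cone
          z , z-F , z-G = restrict (cone-Pd (lin 1ℚ height (- ε) u) 0≤)
      -- `u` is `q` times the difference of `height` and `height - ε u`, both in the cone of `Pd`;
      -- each is replaced by its restriction.
      in lin q h (- q) z ,
         (λ p p∈ → trans (∙-linˡ q h (- q) z (hat p))
           (trans (cong₂ (λ a b → q * a + (- q) * b) (h-F p p∈) (trans (z-F p p∈) (∙-linˡ 1ℚ height (- ε) u (hat p))))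
             (trans (solve 4 (λ q h e u → q :* h :+ (:- q) :* (con 1ℚ :* h :+ (:- e) :* u) := (q :* e) :* u) refl q (height ∙ hat p) ε (u ∙ hat p))
               (trans (cong (_* (u ∙ hat p)) qε) (ℚP.*-identityˡ (u ∙ hat p)))))) ,
         λ p p∈ → trans (∙-linˡ q h (- q) z (hat p)) (trans (cong₂ (λ a b → q * a + (- q) * b) (h-G p p∈) (z-G p p∈))
           (solve 1 (λ q → q :* con 0ℚ :+ (:- q) :* con 0ℚ := con 0ℚ) refl q))

    extended-nonneg : ∀ u u' → (∀ p → p ∈ F → 0ℚ ≤ u ∙ hat p) → (∀ p → p ∈ F → u' ∙ hat p ≡ u ∙ hat p) →
      (∀ p → p ∈ G → u' ∙ hat p ≡ 0ℚ) → ∀ p → p ∈ P → 0ℚ ≤ u' ∙ hat p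
    extended-nonneg u u' 0≤u u'F u'G p p∈ = case cover p p∈ of λ
      { (inj₁ p∈F) → subst (0ℚ ≤_) (sym (u'F p p∈F)) (0≤u p p∈F)
      ; (inj₂ p∈G) → ≤-reflexive (sym (u'G p p∈G)) }

    -- The functional, extended by 0 to `G`, is nonnegative on `P` and vanishes at both summands of
    -- `M`, which is interior to the cone over `P`.
    int-X : Int F (toQPt (ext X₀ (pos k)))
    int-X = int-cong X≗ (coneX , interior)
      where
      interior : ∀ u → (∀ p → p ∈ F → 0ℚ ≤ u ∙ hat p) → u ∙ toQPt X ≡ 0ℚ → ∀ p → p ∈ F → u ∙ hat p ≡ 0ℚ
      interior u 0≤u u∙X p p∈ =
        let u' , u'F , u'G = extend-by-0 u
            u'∙X = trans (cone-const u' coneX 1ℚ u (λ p p∈ → trans (u'F p p∈) (sym (ℚP.*-identityˡ (u ∙ hat p)))))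
                     (trans (ℚP.*-identityˡ (u ∙ toQPt X)) u∙X)
            u'∙M = trans (sym (X+[M-X] u')) (cong₂ _+_ u'∙X (cone-≡0 u' cone-M-X u'G))
        in trans (sym (u'F p p∈)) (proj₂ int-M u' (extended-nonneg u u' 0≤u u'F u'G) u'∙M p (F⊆ p p∈))

    private
      R : Set
      R = Σ (Pt (suc d)) (_∈ Gs)

      dominates : ∀ x j → Cone F (toQPt (ext x (pos j))) → (∀ (ρ : R) → 1ℚ ≤ toQPt (proj₁ ρ) ∙ toQPt (ext x (pos j))) →
        ∀ v → v ∈ Pd → toQPt v ∙ toQPt (ext X₀ (pos k)) ≤ toQPt v ∙ toQPt (ext x (pos j))
      dominates x j cone 1≤ v v∈ = case cover* v v∈ of λ
        { (inj₁ v∈Fs) → ≤-reflexive (trans (sym (∙-congʳ (toQPt v) X≗))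
            (trans (Fs-X v v∈Fs) (sym (cone-≡0 (toQPt v) cone (λ p p∈ → Fs-F v p v∈Fs p∈)))))
        ; (inj₂ v∈Gs) → subst (_≤ toQPt v ∙ toQPt (ext x (pos j))) (trans (sym (Gs-X v v∈Gs)) (∙-congʳ (toQPt v) X≗)) (1≤ (v , v∈Gs)) }

      detect : ∀ u → (∀ p → p ∈ F → 0ℚ ≤ u ∙ hat p) → (Σ (Pt d) λ p → p ∈ F × u ∙ hat p ≢ 0ℚ) →
        Σ R λ ρ → ∀ p → p ∈ F → u ∙ hat p ≡ 0ℚ → proj₁ ρ ⟨ p ⟩ ≡ 0ℚ
      detect u 0≤u (p₀ , p₀∈ , ne) =
        let u' , u'F , u'G = extend-by-0 u
            v , v∈ , h = detect-P u' (extended-nonneg u u' 0≤u u'F u'G) (p₀ , F⊆ p₀ p₀∈ , λ e → ne (trans (sym (u'F p₀ p₀∈)) e))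
            v-G : ∀ p → p ∈ G → v ⟨ p ⟩ ≡ 0ℚ
            v-G p p∈ = h p (G⊆ p p∈) (u'G p p∈)
        -- The detected `v` vanishes on `G` since `u'` does; were it in `Fs`, it would vanish on all
        -- of `P`.
        in (v , (case cover* v v∈ of λ
             { (inj₂ v∈Gs) → v∈Gs
             ; (inj₁ v∈Fs) → ⊥-elim (nowhere-0 v v∈ λ p p∈ → case cover p p∈ of λ
                 { (inj₁ p∈F) → Fs-F v p v∈Fs p∈F ; (inj₂ p∈G) → v-G p p∈G }) })) ,
           λ p p∈ e → h p (F⊆ p p∈) (trans (u'F p p∈) e)

      module CoreF = Core F X₀ k {R = R} proj₁ int-X
        (λ (v , v∈) p p∈ → Pd-nonneg v p (Gs⊆ v v∈) (F⊆ p p∈))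
        (λ (v , v∈) → trans (sym (∙-congʳ (toQPt v) X≗)) (Gs-X v v∈))
        (λ x j cone 1≤ → dominates⇒least x j (dominates x j cone 1≤))
        detect

    codeg-F : ∀ c → IsCodeg F c → c ≡ k
    codeg-F = CoreF.codeg

    gorenstein-F : Gorenstein F
    gorenstein-F = CoreF.gorenstein

    abstract
      -- The cut that gave `X`, made on the height: its `Fs`-part agrees with `Y` on `P`. The
      -- `Gs`-part is kept so that integrals against the full height can be compared with those
      -- against `Y`.
      Y-split : Σ (ConeOf toQPt Fs (toQPt Y)) λ c → Σ (Meas (Pt (suc d))) λ V' → V' on⁺ (_∈ Gs) ×
        (∀ g → ∫ g (proj₁ height-cone) ≡ ∫ g (proj₁ c) + ∫ g V')
      Y-split =
        let V , V' , V∈ , V'∈ , split = ∫-split (proj₁ (proj₂ height-cone)) cover*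
            y = barycentre toQPt V
            at : ∀ p → y ∙ hat p ≡ ∫ (λ v → v ⟨ p ⟩) V
            at p = trans (∙-comm y (hat p)) (trans (∙-barycentre (hat p) toQPt V) (∫-cong V (λ v → ∙-comm (hat p) (toQPt v))))
            ∫V' : ∀ p → ∫ (λ v → v ⟨ p ⟩) V + ∫ (λ v → v ⟨ p ⟩) V' ≡ 1ℚ
            ∫V' p = trans (sym (split (λ v → v ⟨ p ⟩))) (trans (∫-cong (proj₁ height-cone) (λ v → ∙-comm (toQPt v) (hat p)))
              (trans (sym (cone-∙ (hat p) height-cone)) (trans (∙-comm (hat p) height) (height-hat p))))
            y∙p : ∀ p → p ∈ P → y ∙ hat p ≡ Y ⟨ p ⟩
            y∙p p p∈ = case cover p p∈ of λ
              { (inj₁ p∈F) → trans (at p) (trans (∫-≡0 (on⁺⇒on V∈) (λ v v∈ → Fs-F v p v∈ p∈F)) (sym (Y-F p p∈F)))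
              ; (inj₂ p∈G) → trans (at p) (trans (sym (ℚP.+-identityʳ (∫ (λ v → v ⟨ p ⟩) V)))
                  (trans (cong (∫ (λ v → v ⟨ p ⟩) V +_) (sym (∫-≡0 (on⁺⇒on V'∈) (λ v v∈ → Gs-G v p v∈ p∈G))))
                    (trans (∫V' p) (sym (Y-G p p∈G))))) }
            y≡Y = vanish-P (y ⊖ toQPt Y) (λ p p∈ → trans (∙-⊖ˡ y (toQPt Y) (hat p))
              (trans (cong (_- Y ⟨ p ⟩) (y∙p p p∈)) (ℚP.+-inverseʳ (Y ⟨ p ⟩))))
        in (V , V∈ , λ i → trans (solve 2 (λ x y → x := (x :- y) :+ y) refl (y i) (toQPt Y i))
             (trans (cong (_+ toQPt Y i) (y≡Y i)) (ℚP.+-identityˡ (toQPt Y i)))) , V' , V'∈ , split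

    coneY : ConeOf toQPt Fs (toQPt Y)
    coneY = proj₁ Y-split

    Y-M : toQPt M ∙ toQPt Y ≡ ∫ (λ _ → 1ℚ) (proj₁ coneY)
    Y-M = trans (cone-∙ (toQPt M) coneY) (∫-cong-on (on⁺⇒on (proj₁ (proj₂ coneY)))
      (λ v v∈ → trans (∙-comm (toQPt M) (toQPt v)) (Pd-M v (Fs⊆ v v∈))))

    -- Every generator of `P^×` pairs to 1 with `M`, so the pairing with `M` is the height in the
    -- cone over `F*`.
    height-Y : Σ ℕ λ l → M ·ᶻ Y ≡ pos l
    height-Y = natural (M ·ᶻ Y) (subst (0ℚ ≤_) (sym (trans (toℚ-∙ M Y) Y-M)) (∫-nonneg (proj₁ (proj₂ coneY)) (λ _ _ → 0≤1)))

    l : ℕ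
    l = proj₁ height-Y

    l≡ : toQPt M ∙ toQPt Y ≡ toℚ (pos l)
    l≡ = trans (sym (toℚ-∙ M Y)) (cong toℚ (proj₂ height-Y))

    hat-coneY : Cone Fs (toQPt (ext Y (pos l)))
    hat-coneY = proj₁ coneY , proj₁ (proj₂ coneY) , λ { zero → trans (sym Y-M) l≡ ; (suc i) → proj₂ (proj₂ coneY) i }

    int-Y : Int Fs (toQPt (ext Y (pos l)))
    int-Y = hat-coneY , interior
      where
      interior : ∀ u → (∀ v → v ∈ Fs → 0ℚ ≤ u ∙ hat v) → u ∙ toQPt (ext Y (pos l)) ≡ 0ℚ → ∀ v → v ∈ Fs → u ∙ hat v ≡ 0ℚ
      interior u 0≤u u∙Y v v∈ = trans (sym (f-Fs v v∈)) (proj₂ height-strict f 0≤f ∫f v (Fs⊆ v v∈))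
        where
        -- `u` cut off by a factor that is 1 on `Fs` and 0 on `Gs`. Its integral against the height
        -- is the value of `u` at the lift of `Y`, hence 0.
        f : Pt (suc d) → ℚ
        f v = (1ℚ - toQPt v ∙ toQPt X) * (u ∙ hat v)
        f-Fs : ∀ v → v ∈ Fs → f v ≡ u ∙ hat v
        f-Fs v v∈ = trans (cong (λ x → (1ℚ - x) * (u ∙ hat v)) (Fs-X v v∈)) (solve 1 (λ x → (con 1ℚ :- con 0ℚ) :* x := x) refl (u ∙ hat v))
        f-Gs : ∀ v → v ∈ Gs → f v ≡ 0ℚ
        f-Gs v v∈ = trans (cong (λ x → (1ℚ - x) * (u ∙ hat v)) (Gs-X v v∈)) (solve 1 (λ x → (con 1ℚ :- con 1ℚ) :* x := con 0ℚ) refl (u ∙ hat v))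
        0≤f : ∀ v → v ∈ Pd → 0ℚ ≤ f v
        0≤f v v∈ = case cover* v v∈ of λ
          { (inj₁ v∈Fs) → subst (0ℚ ≤_) (sym (f-Fs v v∈Fs)) (0≤u v v∈Fs) ; (inj₂ v∈Gs) → ≤-reflexive (sym (f-Gs v v∈Gs)) }
        ∫f : ∫ f (proj₁ height-cone) ≡ 0ℚ
        ∫f =
          let c , V' , V'∈ , split = Y-split
          in trans (split f) (trans (cong₂ _+_
               (trans (∫-cong-on (on⁺⇒on (proj₁ (proj₂ c))) f-Fs) (trans (sym (cone-∙ u hat-coneY)) u∙Y))
               (∫-≡0 (on⁺⇒on V'∈) f-Gs)) (ℚP.+-identityˡ 0ℚ))

    private
      R* : Set
      R* = Σ (Pt d) (_∈ G)

      ρ* : R* → Pt (suc (suc d))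
      ρ* (p , _) = pad (ext p (pos 1))

      -- On `P` the functional `x` is at least `Y`: both are 0 on `F`, and on `G` it is at least 1.
      -- So `x - Y` is nonnegative, and its value at `M` is the difference of heights.
      least* : ∀ x j → Cone Fs (toQPt (ext x (pos j))) → (∀ ρ → 1ℚ ≤ toQPt (ρ* ρ) ∙ toQPt (ext x (pos j))) →
        l ℕ.≤ j × (j ≡ l → ∀ i → x i ≡ Y i)
      least* x j cone 1≤ =
        ℤP.drop‿+≤+ (toℚ-cancel {pos l} {pos j} (≤-by (M-nonneg s 0≤s) (sym s∙M))) ,
        λ j≡l i → toℚ-injective {x i} {Y i} (trans (solve 2 (λ x y → x := (x :- y) :+ y) refl (toℚ (x i)) (toℚ (Y i)))
          (trans (cong (_+ toℚ (Y i)) (M-vanish s 0≤s (trans s∙M (trans (cong (λ j → toℚ (pos j) - toℚ (pos l)) j≡l) (ℚP.+-inverseʳ (toℚ (pos l))))) i))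
            (ℚP.+-identityˡ (toℚ (Y i)))))
        where
        s = toQPt x ⊖ toQPt Y
        x∙M : toQPt x ∙ toQPt M ≡ toℚ (pos j)
        x∙M = trans (∙-comm (toQPt x) (toQPt M)) (trans (sym (pad-∙ M x (pos j)))
          (trans (cone-const (toQPt (pad M)) cone 1ℚ height (λ v v∈ → trans (pad-∙ M v (pos 1))
              (trans (∙-comm (toQPt M) (toQPt v)) (trans (Pd-M v (Fs⊆ v v∈)) (sym (trans (ℚP.*-identityˡ (height ∙ hat v)) (height-hat v)))))))
            (trans (ℚP.*-identityˡ (height ∙ toQPt (ext x (pos j)))) (basis-∙ zero (toQPt (ext x (pos j)))))))
        s∙M : s ∙ toQPt M ≡ toℚ (pos j) - toℚ (pos l)
        s∙M = trans (∙-⊖ˡ (toQPt x) (toQPt Y) (toQPt M)) (cong₂ _-_ x∙M (trans (∙-comm (toQPt Y) (toQPt M)) l≡))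
        Y≤x : ∀ p → p ∈ P → Y ⟨ p ⟩ ≤ x ⟨ p ⟩
        Y≤x p p∈ = case cover p p∈ of λ
          { (inj₁ p∈F) → ≤-reflexive (trans (Y-F p p∈F) (sym (trans (sym (pad-hat p x (pos j)))
              (cone-≡0 (toQPt (pad (ext p (pos 1)))) cone (λ v v∈ → trans (pad-hat p v (pos 1)) (Fs-F v p v∈ p∈F))))))
          ; (inj₂ p∈G) → subst₂ _≤_ (sym (Y-G p p∈G)) (pad-hat p x (pos j)) (1≤ (p , p∈G)) }
        0≤s : ∀ p → p ∈ P → 0ℚ ≤ s ∙ hat p
        0≤s p p∈ = subst (0ℚ ≤_) (sym (∙-⊖ˡ (toQPt x) (toQPt Y) (hat p))) (0≤-diff (Y≤x p p∈))

      -- If no p ∈ G vanished on the whole face {u = 0} of Fs, a sum z of points of that face would be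
      -- positive on G, so z - εv₀ would lie in the cone of Fs with u(z - εv₀) < 0.
      detect* : ∀ u → (∀ v → v ∈ Fs → 0ℚ ≤ u ∙ hat v) → (Σ (Pt (suc d)) λ v → v ∈ Fs × u ∙ hat v ≢ 0ℚ) →
        Σ R* λ ρ → ∀ v → v ∈ Fs → u ∙ hat v ≡ 0ℚ → toQPt (ρ* ρ) ∙ hat v ≡ 0ℚ
      detect* u 0≤u (v₀ , v₀∈ , ne) = case search G test of λ
          { (inj₁ (p , p∈ , good)) → (p , p∈) , λ v v∈ e → trans (pad-hat p v (pos 1)) (good v v∈ e)
          ; (inj₂ bad) → ⊥-elim (impossible bad) }
        where
        OnFace : Pt (suc d) → Set
        OnFace v = v ∈ Fs × u ∙ hat v ≡ 0ℚ
        Bad : Pt d → Set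
        Bad p = Σ (Pt (suc d)) λ v → OnFace v × v ⟨ p ⟩ ≢ 0ℚ
        test : ∀ p → p ∈ G → (∀ v → v ∈ Fs → u ∙ hat v ≡ 0ℚ → v ⟨ p ⟩ ≡ 0ℚ) ⊎ Bad p
        test p p∈ = case search Fs (λ v v∈ → test-v v v∈ (u ∙ hat v ℚP.≟ 0ℚ) (v ⟨ p ⟩ ℚP.≟ 0ℚ)) of λ
            { (inj₁ (v , _ , b)) → inj₂ (v , b) ; (inj₂ good) → inj₁ good }
          where
          test-v : ∀ v → v ∈ Fs → Dec (u ∙ hat v ≡ 0ℚ) → Dec (v ⟨ p ⟩ ≡ 0ℚ) →
            (OnFace v × v ⟨ p ⟩ ≢ 0ℚ) ⊎ (u ∙ hat v ≡ 0ℚ → v ⟨ p ⟩ ≡ 0ℚ)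
          test-v v v∈ (yes e) (no ne) = inj₁ ((v∈ , e) , ne)
          test-v v v∈ (yes e) (yes e') = inj₂ λ _ → e'
          test-v v v∈ (no ne) _ = inj₂ λ e → ⊥-elim (ne e)
        gather : (L : List (Pt d)) → (∀ p → p ∈ L → p ∈ G) → (∀ p → p ∈ L → Bad p) →
          Σ (Meas (Pt (suc d))) λ W → W on⁺ OnFace × (∀ p → p ∈ L → 0ℚ < ∫ (λ v → v ⟨ p ⟩) W)
        gather [] _ _ = [] , [] , λ _ ()
        gather (p ∷ L) L⊆ bad =
          let W , W∈ , pos-W = gather L (λ q q∈ → L⊆ q (there q∈)) (λ q q∈ → bad q (there q∈))
              v , v-on , v≢0 = bad p (here refl)
              0≤v : ∀ q → q ∈ p ∷ L → 0ℚ ≤ 1ℚ * v ⟨ q ⟩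
              0≤v q q∈ = 0≤* 0≤1 (Pd-nonneg v q (Fs⊆ v (proj₁ v-on)) (G⊆ q (L⊆ q q∈)))
          in (1ℚ , v) ∷ W , (0≤1 , v-on) ∷ W∈ , λ
            { _ (here refl) → ℚP.<-≤-trans (≤∧≢⇒0< (0≤v p (here refl)) (λ e → v≢0 (trans (sym (ℚP.*-identityˡ (v ⟨ p ⟩))) e)))
                (subst (_≤ 1ℚ * v ⟨ p ⟩ + ∫ (λ v → v ⟨ p ⟩) W) (ℚP.+-identityʳ (1ℚ * v ⟨ p ⟩))
                  (ℚP.+-monoʳ-≤ (1ℚ * v ⟨ p ⟩) (∫-nonneg W∈ (λ v v-on → Pd-nonneg v p (Fs⊆ v (proj₁ v-on)) (G⊆ p (L⊆ p (here refl)))))))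
            ; q (there q∈) → ℚP.<-≤-trans (pos-W q q∈)
                (subst (_≤ 1ℚ * v ⟨ q ⟩ + ∫ (λ v → v ⟨ q ⟩) W) (ℚP.+-identityˡ (∫ (λ v → v ⟨ q ⟩) W))
                  (ℚP.+-monoˡ-≤ (∫ (λ v → v ⟨ q ⟩) W) (0≤v q (there q∈)))) }
        impossible : (∀ p → p ∈ G → Bad p) → ⊥
        impossible bad = ℚP.<-irrefl refl (ℚP.<-≤-trans 0<εū
            (≤-by ū-nonneg (trans (solve 1 (λ y → con 0ℚ :- y := con 0ℚ :+ (:- con 1ℚ) :* y) refl (ε * (ū ∙ toQPt v₀))) (sym ū∙y))))
          where
          W = proj₁ (gather G (λ _ p → p) bad)
          W∈ = proj₁ (proj₂ (gather G (λ _ p → p) bad))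
          pos-W = proj₂ (proj₂ (gather G (λ _ p → p) bad))
          z = barycentre toQPt W
          z∙ : ∀ x → z ∙ x ≡ ∫ (λ v → toQPt v ∙ x) W
          z∙ x = trans (∙-comm z x) (trans (∙-barycentre x toQPt W) (∫-cong W (λ v → ∙-comm x (toQPt v))))
          rm = room (λ p → z ∙ hat p) (λ p → v₀ ⟨ p ⟩) G (λ p p∈ → subst (0ℚ <_) (sym (z∙ (hat p))) (pos-W p p∈))
          ε = proj₁ rm
          y = lin 1ℚ z (- ε) (toQPt v₀)
          y∙ : ∀ x → y ∙ x ≡ z ∙ x + (- ε) * (toQPt v₀ ∙ x)
          y∙ x = trans (∙-linˡ 1ℚ z (- ε) (toQPt v₀) x) (cong (_+ (- ε) * (toQPt v₀ ∙ x)) (ℚP.*-identityˡ (z ∙ x)))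
          y-Fs : ∀ x → (∀ v → v ∈ Fs → toQPt v ∙ x ≡ 0ℚ) → y ∙ x ≡ 0ℚ
          y-Fs x e = trans (y∙ x) (trans (cong₂ (λ a b → a + (- ε) * b)
              (trans (z∙ x) (∫-≡0 (on⁺⇒on W∈) (λ v v-on → e v (proj₁ v-on)))) (e v₀ v₀∈))
            (solve 1 (λ e → con 0ℚ :+ (:- e) :* con 0ℚ := con 0ℚ) refl ε))
          0≤y : ∀ p → p ∈ P → 0ℚ ≤ y ∙ hat p
          0≤y p p∈ = case cover p p∈ of λ
            { (inj₁ p∈F) → ≤-reflexive (sym (y-Fs (hat p) (λ v v∈ → Fs-F v p v∈ p∈F)))
            ; (inj₂ p∈G) → subst (0ℚ ≤_) (sym (y∙ (hat p))) (proj₂ (proj₂ rm) ε (<⇒≤ (proj₁ (proj₂ rm))) ≤-refl p p∈G) }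
          cone-y = cone-Pd y 0≤y
          -- `y` vanishes at `X`, where the generators in `Gs` have value 1, so only generators in
          -- `Fs` carry weight.
          on-Fs = ∫-support {T = _∈ Fs} {f = λ v → toQPt v ∙ toQPt X} (proj₁ (proj₂ cone-y))
            (λ v v∈ → case cover* v v∈ of λ
              { (inj₁ v∈Fs) → ≤-reflexive (sym (Fs-X v v∈Fs)) ; (inj₂ v∈Gs) → subst (0ℚ ≤_) (sym (Gs-X v v∈Gs)) 0≤1 })
            (trans (trans (∫-cong (proj₁ cone-y) (λ v → ∙-comm (toQPt v) (toQPt X))) (trans (sym (cone-∙ (toQPt X) cone-y)) (∙-comm (toQPt X) y)))
              (y-Fs (toQPt X) Fs-X))
            (λ v v∈ e → case cover* v v∈ of λ
              { (inj₁ v∈Fs) → v∈Fs ; (inj₂ v∈Gs) → ⊥-elim (<⇒≢0 0<1 (trans (sym (Gs-X v v∈Gs)) e)) })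
          -- Pairing with `M` replaces the extra coordinate 1 of the hats, so `ū` acts on `Fs` as
          -- `u` does on the lifts, without the additional dimension.
          ū = lin (u zero) (toQPt M) 1ℚ (λ i → u (suc i))
          ū-hat : ∀ v → v ∈ Fs → ū ∙ toQPt v ≡ u ∙ hat v
          ū-hat v v∈ = trans (∙-linˡ (u zero) (toQPt M) 1ℚ (λ i → u (suc i)) (toQPt v))
            (trans (cong₂ _+_ (trans (cong (u zero *_) (trans (∙-comm (toQPt M) (toQPt v)) (Pd-M v (Fs⊆ v v∈)))) (ℚP.*-identityʳ (u zero)))
                              (ℚP.*-identityˡ ((λ i → u (suc i)) · v)))
              (sym (∙-hat u v)))
          ū-nonneg : 0ℚ ≤ ū ∙ y
          ū-nonneg = subst (0ℚ ≤_) (sym (trans (cone-∙ ū cone-y) (sym (proj₂ (proj₂ on-Fs) (λ v → ū ∙ toQPt v)))))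
            (∫-nonneg (proj₁ (proj₂ on-Fs)) (λ v v∈ → subst (0ℚ ≤_) (sym (ū-hat v v∈)) (0≤u v v∈)))
          ū∙y : ū ∙ y ≡ 0ℚ + (- 1ℚ) * (ε * (ū ∙ toQPt v₀))
          ū∙y = trans (∙-linʳ ū 1ℚ z (- ε) (toQPt v₀)) (trans
            (cong (λ a → 1ℚ * a + (- ε) * (ū ∙ toQPt v₀)) (trans (∙-barycentre ū toQPt W)
              (∫-≡0 (on⁺⇒on W∈) (λ v v-on → trans (ū-hat v (proj₁ v-on)) (proj₂ v-on)))))
            (solve 2 (λ e x → con 1ℚ :* con 0ℚ :+ (:- e) :* x := con 0ℚ :+ (con (- 1ℚ)) :* (e :* x)) refl ε (ū ∙ toQPt v₀)))
          0<εū : 0ℚ < ε * (ū ∙ toQPt v₀)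
          0<εū = ≤∧≢⇒0< (0≤* (<⇒≤ (proj₁ (proj₂ rm))) (subst (0ℚ ≤_) (sym (ū-hat v₀ v₀∈)) (0≤u v₀ v₀∈)))
            (λ e → ne (trans (sym (ū-hat v₀ v₀∈)) (*≡0⇒≡0 (<⇒≢0 (proj₁ (proj₂ rm))) e)))

      module CoreFs = Core Fs Y l {R = R*} ρ* int-Y
        (λ (p , p∈) v v∈ → subst (0ℚ ≤_) (sym (pad-hat p v (pos 1))) (Pd-nonneg v p (Fs⊆ v v∈) (G⊆ p p∈)))
        (λ (p , p∈) → trans (pad-hat p Y (pos l)) (Y-G p p∈))
        least* detect*

    codeg-Fs : ∀ c → IsCodeg Fs c → c ≡ l
    codeg-Fs = CoreFs.codeg

    gorenstein-Fs : Gorenstein Fs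
    gorenstein-Fs = CoreFs.gorenstein

  -- Codegree sums and Cayley joins out of a join

  module _ {F G : List (Pt d)} {Fs Gs : List (Pt (suc d))} (J : Join F G Fs Gs) where
    private
      module A = JoinFacts J
      module B = JoinFacts (swap J)
    open Join J

    heights-sum : A.k ℕ.+ B.k ≡ r
    heights-sum = ℤP.+-injective (begin
      pos A.k ℤ.+ pos B.k                  ≡⟨ sym (cong₂ ℤ._+_ (proj₂ A.height-X) (proj₂ B.height-X)) ⟩
      X zero ℤ.+ (pos r ℤ.- X zero)        ≡⟨ ℤP.+-comm (X zero) (pos r ℤ.- X zero) ⟩
      (pos r ℤ.- X zero) ℤ.+ X zero        ≡⟨ ℤP.+-assoc (pos r) (ℤ.- X zero) (X zero) ⟩
      pos r ℤ.+ (ℤ.- X zero ℤ.+ X zero)    ≡⟨ cong (λ z → pos r ℤ.+ z) (ℤP.+-inverseˡ (X zero)) ⟩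
      pos r ℤ.+ pos 0                      ≡⟨ ℤP.+-identityʳ (pos r) ⟩
      pos r ∎)
      where open ≡-Reasoning

    -- Evaluate `Y` at `M = X + (M - X)`: it is 0 on `F` and agrees with the height on `G`. Thus
    -- `F*` has the codegree of `G`.
    codeg-dual : A.l ≡ B.k
    codeg-dual = ℤP.+-injective (toℚ-injective {pos A.l} {pos B.k} (begin
      toℚ (pos A.l)                                               ≡⟨ sym A.l≡ ⟩
      toQPt M ∙ toQPt Y                                           ≡⟨ ∙-comm (toQPt M) (toQPt Y) ⟩
      toQPt Y ∙ toQPt M                                           ≡⟨ sym (A.X+[M-X] (toQPt Y)) ⟩
      toQPt Y ∙ toQPt X + toQPt Y ∙ toQPt (subPt M X)             ≡⟨ cong₂ _+_ (cone-≡0 (toQPt Y) A.coneX Y-F)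
                                                                       (cone-const (toQPt Y) A.cone-M-X 1ℚ height (λ p p∈ → trans (Y-G p p∈)
                                                                         (sym (trans (ℚP.*-identityˡ (height ∙ hat p)) (height-hat p))))) ⟩
      0ℚ + 1ℚ * (height ∙ toQPt (subPt M X))                      ≡⟨ solve 1 (λ x → con 0ℚ :+ con 1ℚ :* x := x) refl (height ∙ toQPt (subPt M X)) ⟩
      height ∙ toQPt (subPt M X)                                  ≡⟨ basis-∙ zero (toQPt (subPt M X)) ⟩
      toℚ (subPt M X zero)                                        ≡⟨ cong toℚ (proj₂ B.height-X) ⟩
      toℚ (pos B.k) ∎))
      where open ≡-Reasoning

    codeg-sum : ∀ cF cFs → IsCodeg F cF → IsCodeg Fs cFs → cF ℕ.+ cFs ≡ r
    codeg-sum cF cFs hF hFs = trans (cong₂ ℕ._+_ (A.codeg-F cF hF) (trans (A.codeg-Fs cFs hFs) codeg-dual)) heights-sum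

    -- Each generator of `P^×` vanishes on `F`, hence at `x`, or on `G`, hence at `y = -x`.
    direct : Direct F G
    direct x y Fx Gy x+y≡0 = vanish-Pd x λ v v∈ → trans (∙-comm x (toQPt v)) (case cover* v v∈ of λ
      { (inj₁ v∈Fs) → Fx (toQPt v) (λ p p∈ → Fs-F v p v∈Fs p∈)
      ; (inj₂ v∈Gs) → trans (sym (ℚP.+-identityʳ (toQPt v ∙ x)))
          (trans (cong (toQPt v ∙ x +_) (sym (Gy (toQPt v) (λ p p∈ → Gs-G v p v∈Gs p∈)))) (dot-sum (toQPt v) x y x+y≡0)) })
      where
      dot-sum : ∀ {n} (u x y : QPt n) → (∀ i → x i + y i ≡ 0ℚ) → u ∙ x + u ∙ y ≡ 0ℚ
      dot-sum u x y e = trans (sym (sum-+ (λ i → u i * x i) (λ i → u i * y i)))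
        (sum-≡0 (λ i → trans (sym (ℚP.*-distribˡ-+ (u i) (x i) (y i))) (trans (cong (u i *_) (e i)) (ℚP.*-zeroʳ (u i)))))

    cayley : CayleyJoin P F G
    cayley = affRank-++ F⊆ G⊆ cover direct ,
      (λ x → mk⇔ (conv-mono (λ p p∈ → case cover p p∈ of λ { (inj₁ p∈F) → ∈-++⁺ˡ p∈F ; (inj₂ p∈G) → ∈-++⁺ʳ F p∈G }) x)
                 (conv-mono (λ p p∈ → case ∈-++⁻ F p∈ of λ { (inj₁ p∈F) → F⊆ p p∈F ; (inj₂ p∈G) → G⊆ p p∈G }) x)) ,
      -- `Y` rises from 0 on `F` to 1 on `G`, whereas the definition asks for a drop by 1; hence the
      -- sign, with the constant coefficient of `Y` as `δ`.
      Y' , Y zero ,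
      All.tabulate (λ {p} p∈ → toℚ-injective {Y' ·ᶻ p} {Y zero}
        (trans (value p) (trans (cong (λ z → toℚ (Y zero) - z) (Y-F p p∈)) (ℚP.+-identityʳ (toℚ (Y zero)))))) ,
      All.tabulate (λ {p} p∈ → toℚ-injective {Y' ·ᶻ p} {Y zero ℤ.- pos 1}
        (trans (value p) (trans (cong (λ z → toℚ (Y zero) - z) (Y-G p p∈)) (sym (toℚ-sub (Y zero) (pos 1))))))
      where
      Y' = negPt (λ i → Y (suc i))
      value : ∀ p → toℚ (Y' ·ᶻ p) ≡ toℚ (Y zero) - Y ⟨ p ⟩
      value p = trans (toℚ-∙ Y' p) (trans (negPt-∙ (λ i → Y (suc i)) (toQPt p))
        (trans (solve 2 (λ a x → :- x := a :- (a :+ x)) refl (toℚ (Y zero)) ((λ i → toℚ (Y (suc i))) · p))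
          (cong (λ z → toℚ (Y zero) - z) (sym (∙-hat (toQPt Y) p)))))

    direct* : Direct Fs Gs
    direct* x y Fx Gy x+y≡0 = λ { zero → x₀≡0 ; (suc i) → t≡0 i }
      where
      t : QPt (suc d)
      t i = x (suc i)
      pad∙ : ∀ p (z : QPt (suc (suc d))) → toQPt (pad (ext p (pos 1))) ∙ z ≡ hat p ∙ (λ i → z (suc i))
      pad∙ p z = trans (cong (_+ hat p ∙ (λ i → z (suc i))) (ℚP.*-zeroˡ (z zero))) (ℚP.+-identityˡ (hat p ∙ (λ i → z (suc i))))
      t∙p : ∀ p → p ∈ P → t ∙ hat p ≡ 0ℚ
      t∙p p p∈ = trans (∙-comm t (hat p)) (case cover p p∈ of λ
        { (inj₁ p∈F) → trans (sym (pad∙ p x)) (Fx (toQPt (pad (ext p (pos 1)))) (λ v v∈ → trans (pad-hat p v (pos 1)) (Fs-F v p v∈ p∈F)))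
        ; (inj₂ p∈G) →
            let y≡0 = trans (sym (pad∙ p y)) (Gy (toQPt (pad (ext p (pos 1)))) (λ v v∈ → trans (pad-hat p v (pos 1)) (Gs-G v p v∈ p∈G)))
            in trans (∙-congʳ (hat p) (λ i → trans (solve 2 (λ a b → a := (a :+ b) :- b) refl (x (suc i)) (y (suc i)))
                   (trans (cong (_- y (suc i)) (x+y≡0 (suc i))) (ℚP.+-identityˡ (- y (suc i))))))
                 (trans (sum-cong (λ i → solve 2 (λ h y → h :* (:- y) := con (- 1ℚ) :* (h :* y)) refl (hat p i) (y (suc i))))
                   (trans (sum-* (- 1ℚ) (λ i → hat p i * y (suc i))) (trans (cong (- 1ℚ *_) y≡0) (ℚP.*-zeroʳ (- 1ℚ))))) })
      t≡0 : ∀ i → t i ≡ 0ℚ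
      t≡0 = vanish-P t t∙p
      -- Pairing with `M` minus the height vanishes on the lifts of `Fs`, so it recovers the first
      -- coordinate of `x` from the others.
      u : QPt (suc (suc d))
      u = qext (- 1ℚ) (toQPt M)
      u-hat : ∀ v → v ∈ Fs → u ∙ hat v ≡ 0ℚ
      u-hat v v∈ = trans (∙-hat u v) (trans (cong (- 1ℚ +_) (trans (∙-comm (toQPt M) (toQPt v)) (Pd-M v (Fs⊆ v v∈)))) (ℚP.+-inverseˡ 1ℚ))
      x₀≡0 : x zero ≡ 0ℚ
      x₀≡0 = trans (solve 1 (λ a → a := :- (con (- 1ℚ) :* a :+ con 0ℚ)) refl (x zero))
        (trans (cong (λ z → - (- 1ℚ * x zero + z)) (sym (∙-≡0ʳ (toQPt M) t≡0))) (cong -_ (Fx u u-hat)))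

    cayley* : CayleyJoin Pd Fs Gs
    cayley* = affRank-++ Fs⊆ Gs⊆ cover* direct* ,
      (λ x → mk⇔ (conv-mono (λ v v∈ → case cover* v v∈ of λ { (inj₁ v∈Fs) → ∈-++⁺ˡ v∈Fs ; (inj₂ v∈Gs) → ∈-++⁺ʳ Fs v∈Gs }) x)
                 (conv-mono (λ v v∈ → case ∈-++⁻ Fs v∈ of λ { (inj₁ v∈Fs) → Fs⊆ v v∈Fs ; (inj₂ v∈Gs) → Gs⊆ v v∈Gs }) x)) ,
      negPt X , pos 0 ,
      All.tabulate (λ {v} v∈ → toℚ-injective {negPt X ·ᶻ v} {pos 0} (trans (value v) (cong -_ (Fs-X v v∈)))) ,
      All.tabulate (λ {v} v∈ → toℚ-injective {negPt X ·ᶻ v} {pos 0 ℤ.- pos 1} (trans (value v) (cong -_ (Gs-X v v∈))))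
      where
      value : ∀ v → toℚ (negPt X ·ᶻ v) ≡ - (toQPt v ∙ toQPt X)
      value v = trans (toℚ-∙ (negPt X) v) (trans (negPt-∙ X (toQPt v)) (cong -_ (∙-comm (toQPt X) (toQPt v))))

  -- Faces of P and their duals

  dualFace⁺ : ∀ {F v} → v ∈ Pd → (∀ p → p ∈ F → v ⟨ p ⟩ ≡ 0ℚ) → v ∈ dualFace Pd F
  dualFace⁺ {F} {v} v∈ v≡0 = ∈-filter⁺ (λ y → all? (λ p → y ·ᶻ ext p (pos 1) ℤ.≟ pos 0) F) v∈
    (All.tabulate (λ {p} p∈ → toℚ-injective {v ·ᶻ ext p (pos 1)} {pos 0} (trans (toℚ-∙ v (ext p (pos 1))) (v≡0 p p∈))))

  dualFace⁻ : ∀ {F v} → v ∈ dualFace Pd F → v ∈ Pd × (∀ p → p ∈ F → v ⟨ p ⟩ ≡ 0ℚ)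
  dualFace⁻ {F} {v} v∈ =
    let v∈Pd , v≡0 = ∈-filter⁻ (λ y → all? (λ p → y ·ᶻ ext p (pos 1) ℤ.≟ pos 0) F) {xs = Pd} v∈
    in v∈Pd , λ p p∈ → trans (sym (toℚ-∙ v (ext p (pos 1)))) (cong toℚ (All.lookup v≡0 p∈))

  face⁺ : ∀ {u c p} → p ∈ P → u · p ≡ c → p ∈ face P u c
  face⁺ {u} {c} p∈ e = ∈-filter⁺ (λ v → u · v ℚP.≟ c) p∈ e

  face⁻ : ∀ {u c p} → p ∈ face P u c → p ∈ P × u · p ≡ c
  face⁻ {u} {c} p∈ = ∈-filter⁻ (λ v → u · v ℚP.≟ c) {xs = P} p∈

-- All weight of `x` sits on zeros of `g`, hence in `T`, so `x` satisfies every affine equation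
-- valid on `T`. Through the equations that define a face, this places `x` in it.
conv-const : {L T : List (Pt n)} {x : QPt n} (W : Meas (Pt n)) → W on⁺ (_∈ L) → ∫ (λ _ → 1ℚ) W ≡ 1ℚ →
  (∀ i → barycentre toQPt W i ≡ x i) → (g : Pt n → ℚ) → (∀ v → v ∈ L → 0ℚ ≤ g v) →
  ∫ g W ≡ 0ℚ → (∀ v → v ∈ L → g v ≡ 0ℚ → v ∈ T) →
  ∀ (f : QPt n) a → (∀ q → q ∈ T → f · q ≡ a) → f ∙ x ≡ a
conv-const {x = x} W W∈ mass bary g 0≤g e on-T f a f≡a =
  let V , V∈ , V≡ = ∫-support W∈ 0≤g e on-T
  in begin
    f ∙ x                       ≡⟨ sym (∙-congʳ f bary) ⟩
    f ∙ barycentre toQPt W      ≡⟨ ∙-barycentre f toQPt W ⟩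
    ∫ (λ v → f · v) W           ≡⟨ sym (V≡ (λ v → f · v)) ⟩
    ∫ (λ v → f · v) V           ≡⟨ ∫-cong-on (on⁺⇒on V∈) f≡a ⟩
    ∫ (λ _ → a) V               ≡⟨ V≡ (λ _ → a) ⟩
    ∫ (λ _ → a) W               ≡⟨ ∫-const a W ⟩
    a * ∫ (λ _ → 1ℚ) W          ≡⟨ cong (a *_) mass ⟩
    a * 1ℚ                      ≡⟨ ℚP.*-identityʳ a ⟩
    a ∎
  where open ≡-Reasoning

-- The integer δ - ⟨u,x⟩ is the weight of G in x, hence 0 or 1.
on-one-side : {F G : List (Pt n)} (u : Pt n) (δ : ℤ) → All (λ v → u ·ᶻ v ≡ δ) F → All (λ v → u ·ᶻ v ≡ δ ℤ.- pos 1) G →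
  (x : Pt n) → InConv (F ++ G) (toQPt x) →
  (∀ f a → (∀ q → q ∈ F → f · q ≡ a) → f · x ≡ a) ⊎ (∀ f a → (∀ q → q ∈ G → f · q ≡ a) → f · x ≡ a)
on-one-side {n} {F} {G} u δ uF uG x k = go (toℚ t ℚP.≟ 0ℚ)
  where
  t = δ ℤ.- u ·ᶻ x
  g h : Pt n → ℚ
  g v = toℚ δ - toQPt u · v
  h v = 1ℚ - g v
  g-F : ∀ v → v ∈ F → g v ≡ 0ℚ
  g-F v v∈ = trans (cong (λ z → toℚ δ - z) (trans (sym (toℚ-∙ u v)) (cong toℚ (All.lookup uF v∈)))) (ℚP.+-inverseʳ (toℚ δ))
  g-G : ∀ v → v ∈ G → g v ≡ 1ℚ
  g-G v v∈ = trans (cong (λ z → toℚ δ - z) (trans (sym (toℚ-∙ u v)) (trans (cong toℚ (All.lookup uG v∈)) (toℚ-sub δ (pos 1)))))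
    (solve 1 (λ d → d :- (d :- con 1ℚ) := con 1ℚ) refl (toℚ δ))
  meas = conv⇒meas {gens = F ++ G} {x = toQPt x} k
  W = proj₁ meas
  W∈ = proj₁ (proj₂ meas)
  mass = proj₁ (proj₂ (proj₂ meas))
  bary = proj₂ (proj₂ (proj₂ meas))
  split : ∀ v → v ∈ F ++ G → (v ∈ F × g v ≡ 0ℚ) ⊎ (v ∈ G × g v ≡ 1ℚ)
  split v v∈ = case ∈-++⁻ F v∈ of λ { (inj₁ p) → inj₁ (p , g-F v p) ; (inj₂ p) → inj₂ (p , g-G v p) }
  0≤g : ∀ v → v ∈ F ++ G → 0ℚ ≤ g v
  0≤g v v∈ = case split v v∈ of λ
    { (inj₁ (_ , e)) → ≤-reflexive (sym e) ; (inj₂ (_ , e)) → subst (0ℚ ≤_) (sym e) 0≤1 }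
  0≤h : ∀ v → v ∈ F ++ G → 0ℚ ≤ h v
  0≤h v v∈ = case split v v∈ of λ
    { (inj₁ (_ , e)) → subst (λ z → 0ℚ ≤ 1ℚ - z) (sym e) 0≤1 ; (inj₂ (_ , e)) → subst (λ z → 0ℚ ≤ 1ℚ - z) (sym e) ≤-refl }
  ∫g : ∫ g W ≡ toℚ t
  ∫g = trans (∫-sub (λ _ → toℚ δ) (λ v → toQPt u · v) W) (trans (cong₂ _-_
      (trans (∫-const (toℚ δ) W) (trans (cong (toℚ δ *_) mass) (ℚP.*-identityʳ (toℚ δ))))
      (trans (sym (∙-barycentre (toQPt u) toQPt W)) (trans (∙-congʳ (toQPt u) bary) (sym (toℚ-∙ u x)))))
    (sym (toℚ-sub δ (u ·ᶻ x))))
  ∫h : ∫ h W ≡ 1ℚ - toℚ t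
  ∫h = trans (∫-sub (λ _ → 1ℚ) g W) (cong₂ _-_ mass ∫g)
  go : Dec (toℚ t ≡ 0ℚ) → _
  go (yes t≡0) = inj₁ (conv-const W W∈ mass bary g 0≤g (trans ∫g t≡0) (λ v v∈ e → case split v v∈ of λ
    { (inj₁ (p , _)) → p ; (inj₂ (_ , e')) → ⊥-elim (<⇒≢0 0<1 (trans (sym e') e)) }))
  go (no t≢0) = inj₂ (conv-const W W∈ mass bary h 0≤h (trans ∫h 1-t≡0) (λ v v∈ e → case split v v∈ of λ
    { (inj₂ (p , _)) → p ; (inj₁ (_ , e')) → ⊥-elim (<⇒≢0 0<1 (trans (cong (λ z → 1ℚ - z) (sym e')) e)) }))
    where
    1≤t : 1ℚ ≤ toℚ t
    1≤t = 1≤toℚ t (subst (0ℚ ≤_) ∫g (∫-nonneg W∈ 0≤g)) t≢0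
    t≤1 : toℚ t ≤ 1ℚ
    t≤1 = ≤-by (∫-nonneg W∈ 0≤h) (sym ∫h)
    1-t≡0 : 1ℚ - toℚ t ≡ 0ℚ
    1-t≡0 = trans (cong (λ z → 1ℚ - z) (≤-antisym t≤1 1≤t)) (ℚP.+-inverseʳ 1ℚ)

-- The two implications for a face of P

module Faces (d : ℕ) (P : List (Pt d)) (r : ℕ) (1≤r : 1 ℕ.≤ r) (m : Pt d)
  (int-M : Int P (toQPt (ext m (pos r))))
  (Pd : List (Pt (suc d))) (dual : ∀ y → InConv Pd y ⇔ InDual P r m y)
  (u : QPt d) (c : ℚ) (valid : Valid P u c) where

  open Setup d P r 1≤r m int-M Pd dual

  F : List (Pt d)
  F = face P u c

  Fs : List (Pt (suc d))
  Fs = dualFace Pd F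

  F⊆P : ∀ p → p ∈ F → p ∈ P
  F⊆P p p∈ = proj₁ (face⁻ {u} {c} p∈)

  -- A generator on one side satisfies the equations of that face, and the filter defining the face
  -- therefore lists it. This applies to `P` with the equations of `F` and `G`, and to `P^×` with
  -- the vanishing conditions of `F*` and `G*`.
  cayley⇒join : (u' : QPt d) (c' : ℚ) → CayleyJoin P F (face P u' c') → CayleyJoin Pd Fs (dualFace Pd (face P u' c')) →
    Join F (face P u' c') Fs (dualFace Pd (face P u' c'))
  cayley⇒join u' c' (_ , conv , a , δ , aF , aG) (_ , conv* , b , ε , bF , bG) = record
    { F⊆ = F⊆P
    ; G⊆ = λ p p∈ → proj₁ (face⁻ {u'} {c'} p∈)
    ; Fs⊆ = λ v v∈ → proj₁ (dualFace⁻ {F} v∈)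
    ; Gs⊆ = λ v v∈ → proj₁ (dualFace⁻ {G} v∈)
    ; cover = λ p p∈ → case on-one-side a δ aF aG p (Equivalence.to (conv (toQPt p)) (vertex∈conv P p∈)) of λ
        { (inj₁ h) → inj₁ (face⁺ {u} {c} p∈ (h u c (λ q q∈ → proj₂ (face⁻ {u} {c} q∈))))
        ; (inj₂ h) → inj₂ (face⁺ {u'} {c'} p∈ (h u' c' (λ q q∈ → proj₂ (face⁻ {u'} {c'} q∈)))) }
    ; cover* = λ v v∈ → case on-one-side b ε bF bG v (Equivalence.to (conv* (toQPt v)) (vertex∈conv Pd v∈)) of λ
        { (inj₁ h) → inj₁ (dualFace⁺ {F} v∈ (λ p p∈ → trans (∙-comm (toQPt v) (hat p)) (h (hat p) 0ℚ (λ w w∈ →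
            trans (∙-comm (hat p) (toQPt w)) (proj₂ (dualFace⁻ {F} w∈) p p∈)))))
        ; (inj₂ h) → inj₂ (dualFace⁺ {G} v∈ (λ p p∈ → trans (∙-comm (toQPt v) (hat p)) (h (hat p) 0ℚ (λ w w∈ →
            trans (∙-comm (hat p) (toQPt w)) (proj₂ (dualFace⁻ {G} w∈) p p∈))))) }
    ; Fs-F = λ v p v∈ p∈ → proj₂ (dualFace⁻ {F} v∈) p p∈
    ; Gs-G = λ v p v∈ p∈ → proj₂ (dualFace⁻ {G} v∈) p p∈
    ; X = X
    ; Fs-X = λ v v∈ → trans (X-value v (proj₁ (dualFace⁻ {F} v∈))) (trans (cong (λ z → toℚ ε - toℚ z) (All.lookup bF v∈)) (ℚP.+-inverseʳ (toℚ ε)))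
    ; Gs-X = λ v v∈ → trans (X-value v (proj₁ (dualFace⁻ {G} v∈))) (trans (cong (λ z → toℚ ε - toℚ z) (All.lookup bG v∈)) (δ-[δ-1] ε))
    ; Y = Y
    ; Y-F = λ p p∈ → trans (Y-value p) (trans (cong (λ z → toℚ δ - toℚ z) (All.lookup aF p∈)) (ℚP.+-inverseʳ (toℚ δ)))
    ; Y-G = λ p p∈ → trans (Y-value p) (trans (cong (λ z → toℚ δ - toℚ z) (All.lookup aG p∈)) (δ-[δ-1] δ)) }
    where
    G = face P u' c'
    δ-[δ-1] : ∀ δ → toℚ δ - toℚ (δ ℤ.- pos 1) ≡ 1ℚ
    δ-[δ-1] δ = trans (cong (λ z → toℚ δ - z) (toℚ-sub δ (pos 1))) (solve 1 (λ d → d :- (d :- con 1ℚ) := con 1ℚ) refl (toℚ δ))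
    -- The affine function `ε - b`, which is 0 on `F*` and 1 on `G*`, made linear by putting `M`,
    -- equal to 1 on `Pd`, in place of the constant 1.
    X : Pt (suc d)
    X i = ε ℤ.* M i ℤ.- b i
    X-value : ∀ v → v ∈ Pd → toQPt v ∙ toQPt X ≡ toℚ ε - toℚ (b ·ᶻ v)
    X-value v v∈ = trans (∙-congʳ (toQPt v) {x' = lin (toℚ ε) (toQPt M) (- 1ℚ) (toQPt b)}
        (λ i → trans (toℚ-sub (ε ℤ.* M i) (b i)) (trans (cong (_- toℚ (b i)) (toℚ-* ε (M i)))
          (solve 2 (λ x y → x :- y := x :+ con (- 1ℚ) :* y) refl (toℚ ε * toℚ (M i)) (toℚ (b i))))))
      (trans (∙-linʳ (toQPt v) (toℚ ε) (toQPt M) (- 1ℚ) (toQPt b))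
        (trans (cong₂ (λ x y → toℚ ε * x + - 1ℚ * y) (Pd-M v v∈) (trans (∙-comm (toQPt v) (toQPt b)) (sym (toℚ-∙ b v))))
          (solve 2 (λ e y → e :* con 1ℚ :+ con (- 1ℚ) :* y := e :- y) refl (toℚ ε) (toℚ (b ·ᶻ v)))))
    Y : Pt (suc d)
    Y = ext (negPt a) δ
    Y-value : ∀ p → Y ⟨ p ⟩ ≡ toℚ δ - toℚ (a ·ᶻ p)
    Y-value p = trans (∙-hat (toQPt Y) p) (cong (toℚ δ +_) (trans (negPt-∙ a (toQPt p)) (cong -_ (sym (toℚ-∙ a p)))))

  -- The face G forced by equality of codegrees

  module CodegSum (cF cFs : ℕ) (X₀ : Pt d) (int-X : Int F (toQPt (ext X₀ (pos cF))))
    (Y : Pt (suc d)) (int-Y : Int Fs (toQPt (ext Y (pos cFs)))) (sum≡r : cF ℕ.+ cFs ≡ r) where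

    X : Pt (suc d)
    X = ext X₀ (pos cF)

    Fs⊆Pd : ∀ v → v ∈ Fs → v ∈ Pd
    Fs⊆Pd v v∈ = proj₁ (dualFace⁻ {F} v∈)

    Fs-F : ∀ v p → v ∈ Fs → p ∈ F → v ⟨ p ⟩ ≡ 0ℚ
    Fs-F v p v∈ p∈ = proj₂ (dualFace⁻ {F} v∈) p p∈

    OffFs : Pt (suc d) → Set
    OffFs v = v ∈ Pd × ¬ (v ∈ Fs)

    vanishes? : ∀ v → Dec (All (λ p → v ⟨ p ⟩ ≡ 0ℚ) F)
    vanishes? v = all? (λ p → v ⟨ p ⟩ ℚP.≟ 0ℚ) F

    in-Fs? : ∀ v → v ∈ Pd → v ∈ Fs ⊎ OffFs v
    in-Fs? v v∈ with vanishes? v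
    ... | yes v≡0 = inj₁ (dualFace⁺ {F} v∈ (λ p p∈ → All.lookup v≡0 p∈))
    ... | no v≢0 = inj₂ (v∈ , λ v∈Fs → v≢0 (All.tabulate (λ {p} p∈ → Fs-F v p v∈Fs p∈)))

    -- The indicator of the generators off `Fs`, decided by vanishing on `F`. It cuts test functions
    -- off before they are integrated against the height.
    χ : Pt (suc d) → ℚ
    χ v with vanishes? v
    ... | yes _ = 0ℚ
    ... | no _ = 1ℚ

    χ-Fs : ∀ v → v ∈ Fs → χ v ≡ 0ℚ
    χ-Fs v v∈ with vanishes? v
    ... | yes _ = refl
    ... | no v≢0 = ⊥-elim (v≢0 (All.tabulate (λ {p} p∈ → Fs-F v p v∈ p∈)))

    χ-off : ∀ v → OffFs v → χ v ≡ 1ℚ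
    χ-off v (v∈ , v∉) with vanishes? v
    ... | yes v≡0 = ⊥-elim (v∉ (dualFace⁺ {F} v∈ (λ p p∈ → All.lookup v≡0 p∈)))
    ... | no _ = refl

    in-F? : ∀ p → p ∈ P → p ∈ F ⊎ ¬ (p ∈ F)
    in-F? p p∈ with u · p ℚP.≟ c
    ... | yes e = inj₁ (face⁺ {u} {c} p∈ e)
    ... | no ne = inj₂ λ p∈F → ne (proj₂ (face⁻ {u} {c} p∈F))

    Fs-X : ∀ v → v ∈ Fs → toQPt v ∙ toQPt X ≡ 0ℚ
    Fs-X v v∈ = cone-≡0 (toQPt v) (proj₁ int-X) (λ p p∈ → Fs-F v p v∈ p∈)

    Pd-X-nonneg : ∀ v → v ∈ Pd → 0ℚ ≤ toQPt v ∙ toQPt X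
    Pd-X-nonneg v v∈ = cone-nonneg (toQPt v) (proj₁ int-X) (λ p p∈ → Pd-nonneg v p v∈ (F⊆P p p∈))

    X≡0⇒Fs : ∀ v → v ∈ Pd → toQPt v ∙ toQPt X ≡ 0ℚ → v ∈ Fs
    X≡0⇒Fs v v∈ e = dualFace⁺ {F} v∈ (proj₂ int-X (toQPt v) (λ p p∈ → Pd-nonneg v p v∈ (F⊆P p p∈)) e)

    off-X : ∀ v → OffFs v → 1ℚ ≤ toQPt v ∙ toQPt X
    off-X v (v∈ , v∉) = subst (1ℚ ≤_) (toℚ-∙ v X) (1≤toℚ (v ·ᶻ X) (subst (0ℚ ≤_) (sym (toℚ-∙ v X)) (Pd-X-nonneg v v∈))
      (λ e → v∉ (X≡0⇒Fs v v∈ (trans (sym (toℚ-∙ v X)) e))))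

    Y-cone : ConeOf toQPt Fs (toQPt Y)
    Y-cone = let W , W∈ , e = proj₁ int-Y in W , W∈ , λ i → e (suc i)

    Y∙ : ∀ x → toQPt Y ∙ x ≡ ∫ (λ v → toQPt v ∙ x) (proj₁ Y-cone)
    Y∙ x = trans (∙-comm (toQPt Y) x) (trans (cone-∙ x Y-cone) (∫-cong (proj₁ Y-cone) (λ v → ∙-comm x (toQPt v))))

    Y-M : toQPt Y ∙ toQPt M ≡ toℚ (pos cFs)
    Y-M = trans (Y∙ (toQPt M)) (trans (∫-cong-on (on⁺⇒on (proj₁ (proj₂ Y-cone))) (λ v v∈ → Pd-M v (Fs⊆Pd v v∈)))
      (proj₂ (proj₂ (proj₁ int-Y)) zero))

    Y-F : ∀ p → p ∈ F → Y ⟨ p ⟩ ≡ 0ℚ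
    Y-F p p∈ = trans (Y∙ (hat p)) (∫-≡0 (on⁺⇒on (proj₁ (proj₂ Y-cone))) (λ v v∈ → Fs-F v p v∈ p∈))

    Y-nonneg : ∀ p → p ∈ P → 0ℚ ≤ Y ⟨ p ⟩
    Y-nonneg p p∈ = subst (0ℚ ≤_) (sym (Y∙ (hat p))) (∫-nonneg (proj₁ (proj₂ Y-cone)) (λ v v∈ → Pd-nonneg v p (Fs⊆Pd v v∈) p∈))

    -- The functional u - c cutting out F is a combination of elements of F*.
    Y≡0⇒F : ∀ p → p ∈ P → Y ⟨ p ⟩ ≡ 0ℚ → p ∈ F
    Y≡0⇒F p p∈ e = face⁺ {u} {c} p∈ (trans (solve 2 (λ x c → x := (:- c :+ x) :+ c) refl (u · p) c)
        (trans (cong (_+ c) (trans (sym (y-hat p)) y∙p)) (ℚP.+-identityˡ c)))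
      where
      y = qext (- c) u
      y-hat : ∀ p → y ∙ hat p ≡ - c + u · p
      y-hat p = ∙-hat y p
      cone-y = cone-Pd y λ p p∈ → subst (0ℚ ≤_) (sym (trans (y-hat p) (ℚP.+-comm (- c) (u · p)))) (0≤-diff (All.lookup valid p∈))
      y∙ : ∀ x → y ∙ x ≡ ∫ (λ v → toQPt v ∙ x) (proj₁ cone-y)
      y∙ x = trans (∙-comm y x) (trans (cone-∙ x cone-y) (∫-cong (proj₁ cone-y) (λ v → ∙-comm x (toQPt v))))
      y∙X : y ∙ toQPt X ≡ 0ℚ
      y∙X = cone-≡0 y (proj₁ int-X) λ q q∈ → trans (y-hat q) (trans (cong (- c +_) (proj₂ (face⁻ {u} {c} q∈))) (ℚP.+-inverseˡ c))
      -- `y` vanishes at `X`, whose zeros among the generators lie in `Fs`. Each of those vanishes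
      -- at `p`, since `Y` is interior to the cone over `Fs` and `p` is nonnegative there.
      on-Fs = ∫-support (proj₁ (proj₂ cone-y)) Pd-X-nonneg (trans (sym (y∙ (toQPt X))) y∙X) X≡0⇒Fs
      Fs-p : ∀ v → v ∈ Fs → v ⟨ p ⟩ ≡ 0ℚ
      Fs-p v v∈ = trans (sym (pad-hat p v (pos 1))) (proj₂ int-Y (toQPt (pad (ext p (pos 1))))
        (λ v v∈ → subst (0ℚ ≤_) (sym (pad-hat p v (pos 1))) (Pd-nonneg v p (Fs⊆Pd v v∈) p∈))
        (trans (pad-hat p Y (pos cFs)) e) v v∈)
      y∙p : y ∙ hat p ≡ 0ℚ
      y∙p = trans (y∙ (hat p)) (trans (sym (proj₂ (proj₂ on-Fs) (λ v → v ⟨ p ⟩))) (∫-≡0 (on⁺⇒on (proj₁ (proj₂ on-Fs))) Fs-p))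

    off-Y : ∀ p → p ∈ P → ¬ (p ∈ F) → 1ℚ ≤ Y ⟨ p ⟩
    off-Y p p∈ p∉ = subst (1ℚ ≤_) (toℚ-∙ Y (ext p (pos 1))) (1≤toℚ (Y ·ᶻ ext p (pos 1))
      (subst (0ℚ ≤_) (sym (toℚ-∙ Y (ext p (pos 1)))) (Y-nonneg p p∈))
      (λ e → p∉ (Y≡0⇒F p p∈ (trans (sym (toℚ-∙ Y (ext p (pos 1)))) e))))

    abstract
      parts : Σ (Meas (Pt (suc d))) λ V → Σ (Meas (Pt (suc d))) λ V' → V on⁺ (_∈ Fs) × V' on⁺ OffFs ×
        (∀ g → ∫ g (proj₁ height-cone) ≡ ∫ g V + ∫ g V')
      parts = ∫-split (proj₁ (proj₂ height-cone)) in-Fs?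

    V = proj₁ parts
    V' = proj₁ (proj₂ parts)
    V∈ = proj₁ (proj₂ (proj₂ parts))
    V'∈ = proj₁ (proj₂ (proj₂ (proj₂ parts)))
    split = proj₂ (proj₂ (proj₂ (proj₂ parts)))

    along-height : ∀ x → ∫ (λ v → toQPt v ∙ x) V + ∫ (λ v → toQPt v ∙ x) V' ≡ x zero
    along-height x = trans (sym (split (λ v → toQPt v ∙ x))) (trans (∫-cong (proj₁ height-cone) (λ v → ∙-comm (toQPt v) x))
      (trans (sym (cone-∙ x height-cone)) (trans (∙-comm x height) (basis-∙ zero x))))

    y : QPt (suc d)
    y = barycentre toQPt V

    y∙ : ∀ x → y ∙ x ≡ ∫ (λ v → toQPt v ∙ x) V
    y∙ x = trans (∙-comm y x) (trans (∙-barycentre x toQPt V) (∫-cong V (λ v → ∙-comm x (toQPt v))))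

    y≤1 : ∀ p → p ∈ P → y ∙ hat p + ∫ (λ v → v ⟨ p ⟩) V' ≡ 1ℚ
    y≤1 p p∈ = trans (cong (_+ ∫ (λ v → v ⟨ p ⟩) V') (y∙ (hat p))) (along-height (hat p))

    V'-nonneg : ∀ p → p ∈ P → 0ℚ ≤ ∫ (λ v → v ⟨ p ⟩) V'
    V'-nonneg p p∈ = ∫-nonneg V'∈ (λ v v∈ → Pd-nonneg v p (proj₁ v∈) p∈)

    t : QPt (suc d)
    t = toQPt Y ⊖ y

    t∙ : ∀ x → t ∙ x ≡ toQPt Y ∙ x - y ∙ x
    t∙ x = ∙-⊖ˡ (toQPt Y) y x

    -- On `F` both `Y` and `y` vanish. Off `F`, integrality gives `Y` at least 1, while `y`, a part
    -- of the height, is at most 1.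
    t-nonneg : ∀ p → p ∈ P → 0ℚ ≤ t ∙ hat p
    t-nonneg p p∈ = subst (0ℚ ≤_) (sym (t∙ (hat p))) (case in-F? p p∈ of λ
      { (inj₁ p∈F) → ≤-reflexive (sym (trans (cong₂ _-_ (Y-F p p∈F) (trans (y∙ (hat p)) (∫-≡0 (on⁺⇒on V∈) (λ v v∈ → Fs-F v p v∈ p∈F))))
                       (ℚP.+-inverseʳ 0ℚ)))
      ; (inj₂ p∉F) → 0≤-diff (≤-trans (≤-by (V'-nonneg p p∈) (trans (cong (_- y ∙ hat p) (sym (y≤1 p p∈)))
                       (solve 2 (λ a b → (a :+ b) :- a := b) refl (y ∙ hat p) (∫ (λ v → v ⟨ p ⟩) V')))) (off-Y p p∈ p∉F)) })

    -- The slack in the bound of `cF` from below by the mass of `V'`; the slack in the bound for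
    -- `cFs` is `t ∙ M`.
    excess : ℚ
    excess = ∫ (λ v → toQPt v ∙ toQPt X - 1ℚ) V'

    excess-nonneg : 0ℚ ≤ excess
    excess-nonneg = ∫-nonneg V'∈ (λ v v∈ → 0≤-diff (off-X v v∈))

    excess≡ : excess ≡ toℚ (pos cF) - ∫ (λ _ → 1ℚ) V'
    excess≡ = trans (∫-sub (λ v → toQPt v ∙ toQPt X) (λ _ → 1ℚ) V') (cong (_- ∫ (λ _ → 1ℚ) V')
      (trans (sym (trans (cong (_+ ∫ (λ v → toQPt v ∙ toQPt X) V') (∫-≡0 (on⁺⇒on V∈) Fs-X)) (ℚP.+-identityˡ (∫ (λ v → toQPt v ∙ toQPt X) V'))))
        (along-height (toQPt X))))

    t∙M : t ∙ toQPt M ≡ toℚ (pos cFs) - (toℚ (pos r) - ∫ (λ _ → 1ℚ) V')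
    t∙M = trans (t∙ (toQPt M)) (cong₂ _-_ Y-M (trans (solve 2 (λ a b → a := (a :+ b) :- b) refl (y ∙ toQPt M) (∫ (λ _ → 1ℚ) V'))
      (cong (_- ∫ (λ _ → 1ℚ) V') (trans (cong₂ _+_ (y∙ (toQPt M)) (sym (∫-cong-on (on⁺⇒on V'∈) (λ v v∈ → Pd-M v (proj₁ v∈)))))
        (along-height (toQPt M))))))

    -- The mass of `V'` cancels between the two slacks and leaves `cF + cFs - r`, so two nonnegative
    -- numbers add up to 0.
    no-slack : t ∙ toQPt M ≡ 0ℚ × excess ≡ 0ℚ
    no-slack = +≡0⇒≡0 (M-nonneg t t-nonneg) excess-nonneg (trans (cong₂ _+_ t∙M excess≡)
      (trans (solve 4 (λ f s r a → (s :- (r :- a)) :+ (f :- a) := (f :+ s) :- r) refl (toℚ (pos cF)) (toℚ (pos cFs)) (toℚ (pos r)) (∫ (λ _ → 1ℚ) V'))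
        (trans (cong (_- toℚ (pos r)) (trans (sym (toℚ-+ (pos cF) (pos cFs))) (cong (λ k → toℚ (pos k)) sum≡r))) (ℚP.+-inverseʳ (toℚ (pos r))))))

    Y≡y : ∀ i → toQPt Y i ≡ y i
    Y≡y i = trans (solve 2 (λ a b → a := (a :- b) :+ b) refl (toQPt Y i) (y i))
      (trans (cong (_+ y i) (M-vanish t t-nonneg (proj₁ no-slack) i)) (ℚP.+-identityˡ (y i)))

    -- f is supported off Fs, where the height has positive coefficients.
    off-vanish : (f : Pt (suc d) → ℚ) → (∀ v → OffFs v → 0ℚ ≤ f v) → ∫ f V' ≡ 0ℚ → ∀ v → OffFs v → f v ≡ 0ℚ
    off-vanish f 0≤f e v v∈ = trans (sym (χf-off v v∈)) (proj₂ height-strict χf 0≤χf ∫χf v (proj₁ v∈))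
      where
      χf : Pt (suc d) → ℚ
      χf v = χ v * f v
      χf-off : ∀ v → OffFs v → χf v ≡ f v
      χf-off v v∈ = trans (cong (_* f v) (χ-off v v∈)) (ℚP.*-identityˡ (f v))
      χf-Fs : ∀ v → v ∈ Fs → χf v ≡ 0ℚ
      χf-Fs v v∈ = trans (cong (_* f v) (χ-Fs v v∈)) (ℚP.*-zeroˡ (f v))
      0≤χf : ∀ v → v ∈ Pd → 0ℚ ≤ χf v
      0≤χf v v∈ = case in-Fs? v v∈ of λ
        { (inj₁ v∈Fs) → ≤-reflexive (sym (χf-Fs v v∈Fs)) ; (inj₂ off) → subst (0ℚ ≤_) (sym (χf-off v off)) (0≤f v off) }
      ∫χf : ∫ χf (proj₁ height-cone) ≡ 0ℚ
      ∫χf = trans (split χf) (trans (cong₂ _+_ (∫-≡0 (on⁺⇒on V∈) χf-Fs) (trans (∫-cong-on (on⁺⇒on V'∈) χf-off) e)) (ℚP.+-identityˡ 0ℚ))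

    off-X≡1 : ∀ v → OffFs v → toQPt v ∙ toQPt X ≡ 1ℚ
    off-X≡1 v v∈ = trans (solve 1 (λ x → x := (x :- con 1ℚ) :+ con 1ℚ) refl (toQPt v ∙ toQPt X))
      (trans (cong (_+ 1ℚ) (off-vanish (λ v → toQPt v ∙ toQPt X - 1ℚ) (λ v v∈ → 0≤-diff (off-X v v∈)) (proj₂ no-slack) v v∈)) (ℚP.+-identityˡ 1ℚ))

    Y+V'≡1 : ∀ p → p ∈ P → Y ⟨ p ⟩ + ∫ (λ v → v ⟨ p ⟩) V' ≡ 1ℚ
    Y+V'≡1 p p∈ = trans (cong (_+ ∫ (λ v → v ⟨ p ⟩) V') (∙-congˡ (hat p) Y≡y)) (y≤1 p p∈)

    Y≤1 : ∀ p → p ∈ P → Y ⟨ p ⟩ ≤ 1ℚ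
    Y≤1 p p∈ = ≤-by (V'-nonneg p p∈) (trans (cong (_- Y ⟨ p ⟩) (sym (Y+V'≡1 p p∈)))
      (solve 2 (λ a b → (a :+ b) :- a := b) refl (Y ⟨ p ⟩) (∫ (λ v → v ⟨ p ⟩) V')))

    off-Y≡1 : ∀ p → p ∈ P → ¬ (p ∈ F) → Y ⟨ p ⟩ ≡ 1ℚ
    off-Y≡1 p p∈ p∉ = ≤-antisym (Y≤1 p p∈) (off-Y p p∈ p∉)

    -- At such a `p` the part `Y` uses up the whole height 1, so the combination `V'` contributes 0;
    -- its coefficients are positive on all generators off `Fs`.
    off-off : ∀ v p → OffFs v → p ∈ P → Y ⟨ p ⟩ ≡ 1ℚ → v ⟨ p ⟩ ≡ 0ℚ
    off-off v p v∈ p∈ Y≡1 = off-vanish (λ v → v ⟨ p ⟩) (λ v v∈ → Pd-nonneg v p (proj₁ v∈) p∈)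
      (trans (solve 2 (λ a b → b := (a :+ b) :- a) refl (Y ⟨ p ⟩) (∫ (λ v → v ⟨ p ⟩) V'))
        (trans (cong₂ _-_ (Y+V'≡1 p p∈) Y≡1) (ℚP.+-inverseʳ 1ℚ))) v v∈

    -- `G` is where `Y` attains its upper bound 1 on `P`. `Valid` asks for a lower bound, hence the
    -- sign; the constant coefficient of `Y` moves into `c'`.
    u' : QPt d
    u' i = toℚ (ℤ.- Y (suc i))

    c' : ℚ
    c' = toℚ (Y zero) - 1ℚ

    u'-value : ∀ p → u' · p ≡ toℚ (Y zero) - Y ⟨ p ⟩
    u'-value p = trans (negPt-∙ (λ i → Y (suc i)) (toQPt p))
      (trans (solve 2 (λ a x → :- x := a :- (a :+ x)) refl (toℚ (Y zero)) ((λ i → toℚ (Y (suc i))) · p))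
        (cong (λ z → toℚ (Y zero) - z) (sym (∙-hat (toQPt Y) p))))

    valid' : Valid P u' c'
    valid' = All.tabulate λ {p} p∈ → ≤-by (0≤-diff (Y≤1 p p∈)) (trans (cong (_- c') (u'-value p))
      (solve 2 (λ a x → (a :- x) :- (a :- con 1ℚ) := con 1ℚ :- x) refl (toℚ (Y zero)) (Y ⟨ p ⟩)))

    G : List (Pt d)
    G = face P u' c'

    G-Y : ∀ p → p ∈ G → Y ⟨ p ⟩ ≡ 1ℚ
    G-Y p p∈ = trans (solve 2 (λ a x → x := a :- (a :- x)) refl (toℚ (Y zero)) (Y ⟨ p ⟩))
      (trans (cong (λ z → toℚ (Y zero) - z) (trans (sym (u'-value p)) (proj₂ (face⁻ {u'} {c'} p∈))))
        (solve 1 (λ a → a :- (a :- con 1ℚ) := con 1ℚ) refl (toℚ (Y zero))))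

    Y-G : ∀ p → p ∈ P → Y ⟨ p ⟩ ≡ 1ℚ → p ∈ G
    Y-G p p∈ e = face⁺ {u'} {c'} p∈ (trans (u'-value p) (cong (λ z → toℚ (Y zero) - z) e))

    G⊆P : ∀ p → p ∈ G → p ∈ P
    G⊆P p p∈ = proj₁ (face⁻ {u'} {c'} p∈)

    cover : ∀ p → p ∈ P → p ∈ F ⊎ p ∈ G
    cover p p∈ = case in-F? p p∈ of λ { (inj₁ p∈F) → inj₁ p∈F ; (inj₂ p∉F) → inj₂ (Y-G p p∈ (off-Y≡1 p p∈ p∉F)) }

    -- A generator in both dual faces would vanish on `F` and `G`, hence on all of `P`.
    Gs-off : ∀ v → v ∈ dualFace Pd G → OffFs v
    Gs-off v v∈ = v∈Pd , λ v∈Fs → nowhere-0 v v∈Pd λ p p∈ → case cover p p∈ of λ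
        { (inj₁ p∈F) → Fs-F v p v∈Fs p∈F ; (inj₂ p∈G) → proj₂ (dualFace⁻ {G} v∈) p p∈G }
      where v∈Pd = proj₁ (dualFace⁻ {G} v∈)

    join : Join F G Fs (dualFace Pd G)
    join = record
      { F⊆ = F⊆P ; G⊆ = G⊆P ; Fs⊆ = Fs⊆Pd ; Gs⊆ = λ v v∈ → proj₁ (dualFace⁻ {G} v∈)
      ; cover = cover
      ; cover* = λ v v∈ → case in-Fs? v v∈ of λ
          { (inj₁ v∈Fs) → inj₁ v∈Fs
          ; (inj₂ off) → inj₂ (dualFace⁺ {G} v∈ (λ p p∈ → off-off v p off (G⊆P p p∈) (G-Y p p∈))) }
      ; Fs-F = Fs-F ; Gs-G = λ v p v∈ p∈ → proj₂ (dualFace⁻ {G} v∈) p p∈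
      ; X = X ; Fs-X = Fs-X ; Gs-X = λ v v∈ → off-X≡1 v (Gs-off v v∈)
      ; Y = Y ; Y-F = Y-F ; Y-G = G-Y }

  codeg-sum⇒cayley : ∀ cF cFs → IsCodeg F cF → IsCodeg Fs cFs → cF ℕ.+ cFs ≡ r → Cond2 P Pd F
  codeg-sum⇒cayley cF cFs hF hFs sum≡r =
    let X , int-X = codeg⇒int hF
        Y , int-Y = codeg⇒int hFs
        module S = CodegSum cF cFs X int-X Y int-Y sum≡r
    in S.u' , S.c' , S.valid' , cayley S.join , cayley* S.join

  cayley⇒codeg-sum : ∀ cF cFs → IsCodeg F cF → IsCodeg Fs cFs → Cond2 P Pd F → cF ℕ.+ cFs ≡ r
  cayley⇒codeg-sum cF cFs hF hFs (u' , c' , _ , j , j*) = codeg-sum (cayley⇒join u' c' j j*) cF cFs hF hFs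

  consequences : (u' : QPt d) (c' : ℚ) → CayleyJoin P F (face P u' c') → CayleyJoin Pd Fs (dualFace Pd (face P u' c')) →
    Consequences P Pd F (face P u' c')
  consequences u' c' j@((kP , kF , kG , rankP , rankF , rankG , kF+kG≡kP) , _) j* =
    A.gorenstein-F , B.gorenstein-F , A.gorenstein-Fs , B.gorenstein-Fs , codegs , degs , cydims
    where
    J = cayley⇒join u' c' j j*
    module A = JoinFacts J
    module B = JoinFacts (swap J)
    G = face P u' c'
    codegs : ∀ cP cF cG → IsCodeg P cP → IsCodeg F cF → IsCodeg G cG → cP ≡ cF ℕ.+ cG
    codegs cP cF cG hP hF hG = trans (codeg-P cP hP) (sym (trans (cong₂ ℕ._+_ (A.codeg-F cF hF) (B.codeg-F cG hG)) (heights-sum J)))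
    ∸-+ : ∀ {a b k l} → a ℕ.≤ k → b ℕ.≤ l → (k ℕ.+ l) ℕ.∸ (a ℕ.+ b) ≡ (k ℕ.∸ a) ℕ.+ (l ℕ.∸ b)
    ∸-+ {a} {b} {k} {l} a≤k b≤l = begin
      (k ℕ.+ l) ℕ.∸ (a ℕ.+ b)      ≡⟨ sym (ℕP.∸-+-assoc (k ℕ.+ l) a b) ⟩
      (k ℕ.+ l) ℕ.∸ a ℕ.∸ b        ≡⟨ cong (ℕ._∸ b) (ℕP.+-∸-comm l a≤k) ⟩
      ((k ℕ.∸ a) ℕ.+ l) ℕ.∸ b      ≡⟨ ℕP.+-∸-assoc (k ℕ.∸ a) b≤l ⟩
      (k ℕ.∸ a) ℕ.+ (l ℕ.∸ b) ∎
      where open ≡-Reasoning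
    degs : ∀ dP dF dG → IsDeg P dP → IsDeg F dF → IsDeg G dG → dP ≡ dF ℕ.+ dG
    degs dP dF dG (k , c , rk , hP , refl) (kF' , cF , rkF , hF , refl) (kG' , cG , rkG , hG , refl) =
      trans (cong₂ ℕ._∸_ k≡ (codegs c cF cG hP hF hG)) (∸-+ (codeg≤rank rkF hF) (codeg≤rank rkG hG))
      where
      k≡ : k ≡ kF' ℕ.+ kG'
      k≡ = trans (affRank-unique rk rankP) (trans (sym kF+kG≡kP) (cong₂ ℕ._+_ (affRank-unique rankF rkF) (affRank-unique rankG rkG)))
    cydims : ∀ yP yF yG → IsCYdim P yP → IsCYdim F yF → IsCYdim G yG → yP ≡ yF ℤ.+ yG
    cydims _ _ _ (dP , cP , hdP , hP , refl) (dF , cF , hdF , hF , refl) (dG , cG , hdG , hG , refl) =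
      trans (cong₂ (λ a b → pos a ℤ.- pos b) (degs dP dF dG hdP hdF hdG) (codegs cP cF cG hP hF hG))
        (ℤ-solve (pos dF) (pos dG) (pos cF) (pos cG))
      where
      ℤ-solve : ∀ a b c e → (a ℤ.+ b) ℤ.- (c ℤ.+ e) ≡ (a ℤ.- c) ℤ.+ (b ℤ.- e)
      ℤ-solve = ℤS.solve 4 (λ a b c e → (a ℤS.:+ b) ℤS.:- (c ℤS.:+ e) ℤS.:= (a ℤS.:- c) ℤS.:+ (b ℤS.:- e)) refl

theorem4p12 : (d : ℕ) (P : List (Pt d)) (r : ℕ) (m : Pt d) →
    AffRank P (suc d) → GorensteinIdx P r m →
    (Pd : List (Pt (suc d))) → (∀ y → InConv Pd y ⇔ InDual P r m y) →
    (u : QPt d) (c : ℚ) → Valid P u c →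
    ((cF cFs : ℕ) → IsCodeg (face P u c) cF → IsCodeg (dualFace Pd (face P u c)) cFs →
    (cF ℕ.+ cFs ≡ r ⇔ Cond2 P Pd (face P u c))) ×
    ((u' : QPt d) (c' : ℚ) → Valid P u' c' →
    CayleyJoin P (face P u c) (face P u' c') →
    CayleyJoin Pd (dualFace Pd (face P u c)) (dualFace Pd (face P u' c')) →
    Consequences P Pd (face P u c) (face P u' c'))
theorem4p12 d P r m _ (1≤r , int-rP , _) Pd dual u c valid =
  (λ cF cFs hF hFs → mk⇔ (codeg-sum⇒cayley cF cFs hF hFs) (cayley⇒codeg-sum cF cFs hF hFs)) ,
  λ u' c' _ → consequences u' c'
  where open Faces d P r 1≤r m (scale-relInt⇒int P r 1≤r m int-rP) Pd dual u c valid
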